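{- Let $\Phi$ be of type $A_n$. For a subset $S\subseteq\Phi$, the following are equivalent: (a) $\mathrm{conv}(S)$ is a simplex of $\mathcal T'$ with vertex set $S$, i.e. $S=w(B(I))$ for some $i\in[n]$, $w\in W^i$ and $I\in\mathcal I_{ab}(\alpha_i)$; (b) $S=R(G)$ for some $n$-anti-standard graph $G$. That is, the simplices of the triangulation $\mathcal T'=\{\mathrm{conv}(w(B(I)))\mid i\in[n],\ w\in W^i,\ I\in\mathcal I_{ab}(\alpha_i)\}$ of the boundary of $\mathrm{conv}(\Phi)$ are exactly the convex hulls of the sets $R(G)$ with $G$ an $n$-anti-standard graph.
   Context: $\Phi$ is a root system of type $A_n$ in a Euclidean space $E$ with inner product $(-,-)$, simple roots $\alpha_1,\dots,\alpha_n$, $\alpha_{i,j}=\sum_{h=i}^j\alpha_h$ ($1\le i\le j\le n$) the positive roots, $\theta=\alpha_{1,n}$, Weyl group $W$ with length function $\ell$. $W^i$ is the set of minimal length representatives of the left cosets $W/W\langle\Pi\setminus\{\alpha_i\}\rangle$. The root poset is $\Phi^+$ ordered by $\beta\le\gamma$ iff $\gamma-\beta$ is a nonnegative integer combination of simple roots; an abelian ideal is an upward-closed $I\subseteq\Phi^+$ with $(I+I)\cap\Phi=\emptyset$. Border: $B(I)=\{\beta\in I\mid$ for all $\gamma_1,\gamma_2\in\Pi$ with $\beta-\gamma_1,\beta-\gamma_2\in\Phi^+$, $\beta-\gamma_1-\gamma_2\notin I\}$. Affine setting: $\hat V=E\oplus\mathbb R\delta$ with the form extending $(-,-)$ with $\delta$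 in its radical; $\hat\Phi=\{\beta+k\delta\}$, $\alpha_0=-\theta+\delta$, $\hat\Pi=\Pi\cup\{\alpha_0\}$, $\hat\Phi^+=\Phi^+\cup\{\beta+k\delta\mid\beta\in\Phi,k\ge1\}$; $\hat W$ generated by the reflections $s_\beta(x)=x-\frac{2(x,\beta)}{(\beta,\beta)}\beta$, $\beta\in\hat\Pi$; $N(w)=\{\beta\in\hat\Phi^+\mid w^{ -1}(\beta)\in-\hat\Phi^+\}$; for each abelian ideal $I$ there is a unique $w_I\in\hat W$ with $N(w_I)=\{\delta-\beta\mid\beta\in I\}$; $\mathcal I_{ab}(\alpha)=\{I\mid w_I^{ -1}(-\theta+2\delta)=\alpha\}$. An $n$-anti-standard graph is a simple directed graph (no loops, no multiple edges) with vertex set $[n+1]$ and exactly $n$ directed edges such that (1) every vertex is either a source or a target of edges, but not both; (2) for all edges $(s,t)$ and $(s',t')$ (source, target), $s<s'$ implies $t\le t'$. To an edge $(i,j)$ associate the root $\rho(i,j)=\alpha_{i,j-1}$ if $i<j$ and $\rho(i,j)=-\alpha_{j,i-1}$ if $i>j$; $R(G)=\{\rho(e)\mid e\text{ edge of }G\}$. -}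

module Defs where

open import Level using (0ℓ)
open import Data.Nat as ℕ using (ℕ; zero; suc)
open import Data.Integer as ℤ using (ℤ; +_)
open import Data.Fin as Fin using (Fin; toℕ; inject₁)
open import Data.Vec as Vec using (Vec; zipWith; tabulate; replicate)
open import Data.List as List using (List; []; _∷_; _++_; reverse; length)
open import Data.List.Relation.Unary.All using (All)
open import Data.List.Relation.Unary.Unique.Propositional using (Unique)
open import Data.List.Membership.Propositional using (_∈_)
open import Data.Product using (Σ; ∃; ∃-syntax; _×_; _,_; proj₁; proj₂)
open import Data.Sum using (_⊎_)
open import Data.Bool using (Bool; if_then_else_; _∧_)
open import Relation.Nullary using (¬_; does)
open import Relation.Binary.PropositionalEquality using (_≡_; _≢_)
open import Relation.Unary using (Pred; _≐_)

-- Root system of type A_n realised in E = ℤ^{n+1} (standard inner product),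
-- simple roots α_h = e_h - e_{h+1}.  Everything is 0-based:
-- simple roots are indexed by Fin n, vertices [n+1] by Fin (suc n).
module _ (n : ℕ) where

  E : Set
  E = Vec ℤ (suc n)

  infixl 6 _⊕_ _⊖_
  _⊕_ : E → E → E
  u ⊕ v = zipWith ℤ._+_ u v

  _⊖_ : E → E → E
  u ⊖ v = zipWith ℤ._-_ u v

  ⊝_ : E → E
  ⊝ v = Vec.map ℤ.-_ v

  _·_ : ℤ → E → E
  c · v = Vec.map (c ℤ.*_) v

  𝟎 : E
  𝟎 = replicate (suc n) (+ 0)

  ⟪_,_⟫ : E → E → ℤ
  ⟪ u , v ⟫ = List.foldr ℤ._+_ (+ 0) (Vec.toList (zipWith ℤ._*_ u v))

  e : Fin (suc n) → E
  e i = tabulate (λ k → if does (k Fin.≟ i) then + 1 else + 0)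

  -- simple roots α_h (h : Fin n stands for α_{h+1})
  α : Fin n → E
  α h = e (inject₁ h) ⊖ e (Fin.suc h)

  sumα : ℕ → ℕ → E
  sumα lo hi = List.foldr
    (λ h acc → if (lo ℕ.≤ᵇ toℕ h) ∧ (toℕ h ℕ.<ᵇ hi) then α h ⊕ acc else acc)
    𝟎 (List.allFin n)

  αr : Fin n → Fin n → E
  αr i j = sumα (toℕ i) (suc (toℕ j))

  θ : E
  θ = sumα 0 n

  isPos : E → Set
  isPos v = ∃[ i ] ∃[ j ] (i Fin.≤ j × v ≡ αr i j)

  isRoot : E → Set
  isRoot v = isPos v ⊎ isPos (⊝ v)

  lincomb : Vec ℕ n → E
  lincomb c = List.foldr (λ h acc → (+ Vec.lookup c h) · α h ⊕ acc) 𝟎 (List.allFin n)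

  _≼_ : E → E → Set
  β ≼ γ = ∃[ c ] (γ ⊖ β ≡ lincomb c)

  AbelianIdeal : Pred E 0ℓ → Set
  AbelianIdeal I =
    (∀ β → I β → isPos β) ×
    (∀ β γ → I β → isPos γ → β ≼ γ → I γ) ×
    (∀ β γ → I β → I γ → ¬ isRoot (β ⊕ γ))

  Border : Pred E 0ℓ → Pred E 0ℓ
  Border I β = I β ×
    (∀ h₁ h₂ → isPos (β ⊖ α h₁) → isPos (β ⊖ α h₂) → ¬ I (β ⊖ α h₁ ⊖ α h₂))

  image : (E → E) → Pred E 0ℓ → Pred E 0ℓ
  image f P v = ∃[ b ] (P b × v ≡ f b)

  -- reflection s_β(x) = x - (2(x,β)/(β,β)) β, for roots (β,β) = 2
  reflE : E → E → E
  reflE β x = x ⊖ (⟪ x , β ⟫ · β)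

  -- Weyl group W: elements given by words in the simple reflections;
  -- the word h₁ ∷ … ∷ h_k stands for s_{h₁} ⋯ s_{h_k}
  actW : List (Fin n) → E → E
  actW [] x = x
  actW (h ∷ w) x = reflE (α h) (actW w x)

  -- w ∈ W^i (given by a word w): ℓ(w) = |w| is ≤ the length of every word
  -- representing an element of the coset w W⟨Π ∖ {α_i}⟩
  MinCosetRep : Fin n → List (Fin n) → Set
  MinCosetRep i w =
    ∀ (u : List (Fin n)) → All (_≢ i) u →
    ∀ (x : List (Fin n)) → (∀ v → actW x v ≡ actW (w ++ u) v) →
    length w ℕ.≤ length x

  -- affine setting: V̂ = E ⊕ ℤδ, a vector is (x , coefficient of δ)
  V̂ : Set
  V̂ = E × ℤ

  _⊖̂_ : V̂ → V̂ → V̂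
  (x , a) ⊖̂ (y , b) = (x ⊖ y , a ℤ.- b)

  _·̂_ : ℤ → V̂ → V̂
  c ·̂ (x , a) = (c · x , c ℤ.* a)

  ⊝̂_ : V̂ → V̂
  ⊝̂ (x , a) = (⊝ x , ℤ.- a)

  ⟪_,_⟫̂ : V̂ → V̂ → ℤ
  ⟪ (x , _) , (y , _) ⟫̂ = ⟪ x , y ⟫

  reflV : V̂ → V̂ → V̂
  reflV β x = x ⊖̂ (⟪ x , β ⟫̂ ·̂ β)

  α̂ : Fin (suc n) → V̂
  α̂ Fin.zero = (⊝ θ , + 1)
  α̂ (Fin.suc h) = (α h , + 0)

  actŴ : List (Fin (suc n)) → V̂ → V̂
  actŴ [] x = x
  actŴ (h ∷ w) x = reflV (α̂ h) (actŴ w x)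

  isAffPos : V̂ → Set
  isAffPos (v , k) = (isPos v × k ≡ + 0) ⊎ (isRoot v × + 1 ℤ.≤ k)

  -- N(w) = {β ∈ Φ̂⁺ | w⁻¹(β) ∈ -Φ̂⁺}; w⁻¹ is given by the reversed word
  N : List (Fin (suc n)) → Pred V̂ 0ℓ
  N w γ = isAffPos γ × isAffPos (⊝̂ actŴ (reverse w) γ)

  δminus : Pred E 0ℓ → Pred V̂ 0ℓ
  δminus I γ = ∃[ β ] (I β × γ ≡ (⊝ β , + 1))

  -- I ∈ 𝓘_ab(α): I abelian and w_I⁻¹(-θ+2δ) = α, where w_I is the
  -- (unique) element with N(w_I) = {δ - β | β ∈ I}
  Iab : Pred E 0ℓ → E → Set
  Iab I a = AbelianIdeal I ×
    ∃[ w ] (N w ≐ δminus I × actŴ (reverse w) (⊝ θ , + 2) ≡ (a , + 0))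

  SimplexT′ : Pred E 0ℓ → Set₁
  SimplexT′ S = ∃[ i ] ∃[ w ] (MinCosetRep i w ×
    ∃[ I ] (Iab I (α i) × S ≐ image (actW w) (Border I)))

  Graph : Set
  Graph = List (Fin (suc n) × Fin (suc n))

  IsSource : Graph → Fin (suc n) → Set
  IsSource G v = ∃[ t ] ((v , t) ∈ G)

  IsTarget : Graph → Fin (suc n) → Set
  IsTarget G v = ∃[ s ] ((s , v) ∈ G)

  AntiStandard : Graph → Set
  AntiStandard G =
    Unique G ×
    length G ≡ n ×
    (∀ s t → (s , t) ∈ G → s ≢ t) ×
    (∀ v → (IsSource G v ⊎ IsTarget G v) × ¬ (IsSource G v × IsTarget G v)) ×
    (∀ s t s′ t′ → (s , t) ∈ G → (s′ , t′) ∈ G → s Fin.< s′ → t Fin.≤ t′)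

  -- ρ(i,j) = α_{i,j-1} if i<j, -α_{j,i-1} if i>j (1-based); 0-based below
  ρ : Fin (suc n) → Fin (suc n) → E
  ρ a b = if toℕ a ℕ.<ᵇ toℕ b then sumα (toℕ a) (toℕ b)
          else ⊝ sumα (toℕ b) (toℕ a)

  R : Graph → Pred E 0ℓ
  R G v = ∃[ s ] ∃[ t ] ((s , t) ∈ G × v ≡ ρ s t)

  FromGraph : Pred E 0ℓ → Set
  FromGraph S = ∃[ G ] (AntiStandard G × S ≐ R G)

{-# OPTIONS --safe #-}
-- A vertex permutation w ∈ W^p is increasing on the rows [0,p] and on the columns [p+1,n] (exchange
-- condition one way, bubble sort with an inversion count the other way).
--
-- An element of the affine Weyl group permutes the vectors e_a + iδ, which are totally ordered by
-- positivity of affine roots.  In these terms w_I keeps e_0, …, e_n decreasing, and e_a - e_b ∈ I means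
-- that the image of e_a exceeds that of e_b + δ.  If w_I⁻¹(-θ+2δ) = α_p, the image of e_0 is covered by
-- that of e_n + 2δ, so every e_a lies above or below e_n + δ; as affine Weyl group elements have total
-- δ-shift zero, exactly e_0, …, e_p lie above.  Hence I consists of cells in the rows [0,p] and the columns
-- [p+1,n], its first row and last column are full, and B(I) is a lattice path with n cells joining two
-- corners of this rectangle: one cell on each antidiagonal.  Applying w gives an anti-standard graph.
--
-- Conversely, list the vertices of an anti-standard graph with the sources first.  By the pigeonhole
-- principle the edges form such a lattice path.  Its steps, read as a word in the letters "row" and
-- "column", are a finite permutation increasing on rows and on columns; conjugating a word for it by a power of
-- the rotation of the affine Dynkin diagram gives w_I for the ideal I above the path.
module Submission where

open import Defs
open import Level using (0ℓ)
open import Data.Nat using (ℕ; _≤_)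
open import Data.Product using (_×_)
open import Relation.Unary using (Pred)
open import Data.Nat as ℕ using (ℕ; zero; suc; _<_; z≤n; s≤s; _<ᵇ_; _≤ᵇ_)
import Data.Nat.Properties as ℕₚ
open import Data.Integer as ℤ using (ℤ; +_; -[1+_])
import Data.Integer.Properties as ℤₚ
open import Data.Integer.Tactic.RingSolver using (solve-∀)
open import Data.Fin as Fin using (Fin; toℕ; inject₁)
import Data.Fin.Properties as Finₚ
open import Data.Vec as Vec using (Vec; []; _∷_; zipWith; tabulate; replicate)
open import Data.List as List using (List; []; _∷_; _++_; reverse; length)
open import Data.Product using (∃-syntax; _,_; proj₁; proj₂)
open import Data.Sum using (_⊎_; inj₁; inj₂)
open import Data.Bool using (Bool; true; false; if_then_else_; _∧_; T)
open import Data.Empty using (⊥; ⊥-elim)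
open import Relation.Nullary using (¬_; Dec; yes; no; does)
open import Relation.Binary.Definitions using (tri<; tri≈; tri>)
open import Relation.Binary.PropositionalEquality
open import Relation.Unary using (_≐_)
open import Data.List.Membership.Propositional using (_∈_)
open import Data.List.Membership.Propositional.Properties using (∈-tabulate⁺; ∈-tabulate⁻)
open import Data.List.Properties using (length-tabulate; reverse-involutive)
import Data.List.Relation.Unary.Unique.Propositional.Properties as Uniqueₚ
open import Data.List.Relation.Unary.Unique.Propositional using (Unique)
open import Function using (_∘_; id)
import Data.Bool.Properties as Boolₚ
open import Relation.Nullary.Decidable using (_×-dec_; map′)
open import Data.List.Relation.Unary.All as All using (All)
import Data.List.Relation.Unary.AllPairs as AllPairs
open import Data.List.Membership.Propositional.Properties using (∈-lookup)
open import Data.List.Relation.Unary.Any using (here)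

-- Vectors, roots and partial sums

-- Two obstacles shape the argument. An ideal is an arbitrary predicate, so nothing can be searched
-- for in it until membership is decidable; comparing images in the decidable order `≻` provides
-- this. And an affine element is known only through some word, so the number of `e_a` above
-- `e_n + δ` must come from an invariant: cutting the ordered vectors into windows of length `δ`
-- that start at the image of `e_n`, each image has a window number `K` or `K + 1`, and these
-- numbers, suitably normalised, sum to `p + 1` over `n + 1` indices. Division by `n + 1` leaves a
-- single solution. Conversely, no explicit word for `w_I` is written down. The rotation preserves
-- `≻`; it changes the total shift and so lies outside the affine Weyl group, but conjugation by it
-- permutes the simple reflections. Undoing `p + 1` rotations turns the columns into the first
-- `n - p` vectors and the rows, raised by `δ`, into the others. The comparison of a row with a
-- column plus `δ` then happens at equal height, where a finite permutation decides it.

infixl 6 _+v_ _-v_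
_+v_ _-v_ : ∀ {m} → Vec ℤ m → Vec ℤ m → Vec ℤ m
u +v v = zipWith ℤ._+_ u v
u -v v = zipWith ℤ._-_ u v

negv : ∀ {m} → Vec ℤ m → Vec ℤ m
negv v = Vec.map ℤ.-_ v

-- Total coordinate function, 0 out of range.
co : ∀ {m} → Vec ℤ m → ℕ → ℤ
co []      k       = + 0
co (x ∷ v) zero    = x
co (x ∷ v) (suc k) = co v k

co-ext : ∀ {m} {u v : Vec ℤ m} → (∀ k → k < m → co u k ≡ co v k) → u ≡ v
co-ext {u = []}    {[]}    h = refl
co-ext {u = x ∷ u} {y ∷ v} h =
  cong₂ _∷_ (h 0 (s≤s z≤n)) (co-ext (λ k k<m → h (suc k) (s≤s k<m)))

co-+ : ∀ {m} (u v : Vec ℤ m) k → co (u +v v) k ≡ co u k ℤ.+ co v k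
co-+ []      []      k       = refl
co-+ (x ∷ u) (y ∷ v) zero    = refl
co-+ (x ∷ u) (y ∷ v) (suc k) = co-+ u v k

co-minus : ∀ {m} (u v : Vec ℤ m) k → co (u -v v) k ≡ co u k ℤ.- co v k
co-minus []      []      k       = refl
co-minus (x ∷ u) (y ∷ v) zero    = refl
co-minus (x ∷ u) (y ∷ v) (suc k) = co-minus u v k

co-neg : ∀ {m} (u : Vec ℤ m) k → co (negv u) k ≡ ℤ.- co u k
co-neg []      k       = refl
co-neg (x ∷ u) zero    = refl
co-neg (x ∷ u) (suc k) = co-neg u k

co-scale : ∀ {m} c (u : Vec ℤ m) k → co (Vec.map (c ℤ.*_) u) k ≡ c ℤ.* co u k
co-scale c []      k       = sym (ℤₚ.*-zeroʳ c)
co-scale c (x ∷ u) zero    = refl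
co-scale c (x ∷ u) (suc k) = co-scale c u k

co-zero : ∀ m k → co (replicate m (+ 0)) k ≡ + 0
co-zero zero    k       = refl
co-zero (suc m) zero    = refl
co-zero (suc m) (suc k) = co-zero m k

-- Kronecker's symbol. The imaginary root of the affine setting is not this `δ`; it is carried by
-- the second component of `V̂`.
δ : ℕ → ℕ → ℤ
δ zero    zero    = + 1
δ zero    (suc b) = + 0
δ (suc a) zero    = + 0
δ (suc a) (suc b) = δ a b

δ-refl : ∀ a → δ a a ≡ + 1
δ-refl zero    = refl
δ-refl (suc a) = δ-refl a

δ-≢ : ∀ {a b} → a ≢ b → δ a b ≡ + 0
δ-≢ {zero}  {zero}  h = ⊥-elim (h refl)
δ-≢ {zero}  {suc b} h = refl
δ-≢ {suc a} {zero}  h = refl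
δ-≢ {suc a} {suc b} h = δ-≢ (h ∘ cong suc)

eN : ∀ m → ℕ → Vec ℤ m
eN zero    a       = []
eN (suc m) zero    = + 1 ∷ replicate m (+ 0)
eN (suc m) (suc a) = + 0 ∷ eN m a

co-eN : ∀ {m a} → a < m → ∀ k → co (eN m a) k ≡ δ a k
co-eN {suc m} {zero}  a<m zero    = refl
co-eN {suc m} {zero}  a<m (suc k) = co-zero m k
co-eN {suc m} {suc a} a<m zero    = refl
co-eN {suc m} {suc a} (s≤s a<m) (suc k) = co-eN a<m k

private
  tabulate-0 : ∀ m → tabulate {n = m} (λ _ → + 0) ≡ replicate m (+ 0)
  tabulate-0 zero    = refl
  tabulate-0 (suc m) = cong (+ 0 ∷_) (tabulate-0 m)

  tabulate-δ : ∀ m (i : Fin m) →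
    tabulate (λ k → if does (k Fin.≟ i) then + 1 else + 0) ≡ eN m (toℕ i)
  tabulate-δ (suc m) Fin.zero    = cong (+ 1 ∷_) (tabulate-0 m)
  tabulate-δ (suc m) (Fin.suc i) = cong (+ 0 ∷_) (tabulate-δ m i)

e≡eN : ∀ n (i : Fin (suc n)) → e n i ≡ eN (suc n) (toℕ i)
e≡eN n i = tabulate-δ (suc n) i

root : ∀ m → ℕ → ℕ → Vec ℤ m
root m a b = eN m a -v eN m b

co-r : ∀ {m a b} → a < m → b < m → ∀ k → co (root m a b) k ≡ δ a k ℤ.- δ b k
co-r {m} {a} {b} a< b< k =
  trans (co-minus (eN m a) (eN m b) k) (cong₂ ℤ._-_ (co-eN a< k) (co-eN b< k))

neg-r : ∀ m a b → negv (root m a b) ≡ root m b a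
neg-r m a b = co-ext λ k _ → trans (co-neg (root m a b) k)
  (trans (cong ℤ.-_ (co-minus (eN m a) (eN m b) k))
  (trans (solve-neg (co (eN m a) k) (co (eN m b) k)) (sym (co-minus (eN m b) (eN m a) k))))
  where
  solve-neg : ∀ x y → ℤ.- (x ℤ.- y) ≡ y ℤ.- x
  solve-neg = solve-∀

α≡r : ∀ n (h : Fin n) → α n h ≡ root (suc n) (toℕ h) (suc (toℕ h))
α≡r n h = cong₂ _-v_ (trans (e≡eN n (inject₁ h)) (cong (eN (suc n)) (Finₚ.toℕ-inject₁ h)))
                     (e≡eN n (Fin.suc h))

-- Coordinate `c` of the right side is 1, and a difference of two Kronecker symbols is 1 only if the
-- first of them is; coordinate `d` works the same way with -1.
r-injective : ∀ {m a b c d} → a < m → b < m → c < m → d < m → c ≢ d →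
  root m a b ≡ root m c d → a ≡ c × b ≡ d
r-injective {m} {a} {b} {c} {d} a< b< c< d< c≢d eq = a≡c , b≡d
  where
  at : ∀ k → δ a k ℤ.- δ b k ≡ δ c k ℤ.- δ d k
  at k = trans (sym (co-r a< b< k)) (trans (cong (λ v → co v k) eq) (co-r c< d< k))
  at-c : δ a c ℤ.- δ b c ≡ + 1
  at-c = trans (at c) (cong₂ ℤ._-_ (δ-refl c) (δ-≢ (c≢d ∘ sym)))
  at-d : δ a d ℤ.- δ b d ≡ -[1+ 0 ]
  at-d = trans (at d) (cong₂ ℤ._-_ (δ-≢ c≢d) (δ-refl d))
  a≡c : a ≡ c
  a≡c with a ℕ.≟ c | at-c
  ... | yes p | _ = p
  ... | no ¬p | q with b ℕ.≟ c
  ... | yes refl rewrite δ-≢ ¬p | δ-refl b with () ← q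
  ... | no ¬p'   rewrite δ-≢ ¬p | δ-≢ ¬p' with () ← q
  b≡d : b ≡ d
  b≡d with b ℕ.≟ d | at-d
  ... | yes p | _ = p
  ... | no ¬p | q with a ℕ.≟ d
  ... | yes refl rewrite δ-≢ ¬p | δ-refl a with () ← q
  ... | no ¬p'   rewrite δ-≢ ¬p | δ-≢ ¬p' with () ← q

-- On the root lattice this is the coefficient of the simple root `e_{k-1} - e_k`, that is, the
-- pairing with a fundamental coweight. Supports of roots are read off from it.
psum : ∀ {m} → ℕ → Vec ℤ m → ℤ
psum k       []      = + 0
psum zero    (x ∷ v) = + 0
psum (suc k) (x ∷ v) = x ℤ.+ psum k v

psum-zero : ∀ m k → psum k (replicate m (+ 0)) ≡ + 0
psum-zero zero    k       = refl
psum-zero (suc m) zero    = refl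
psum-zero (suc m) (suc k) = trans (ℤₚ.+-identityˡ _) (psum-zero m k)

psum-+ : ∀ {m} k (u v : Vec ℤ m) → psum k (u +v v) ≡ psum k u ℤ.+ psum k v
psum-+ k       []      []      = refl
psum-+ zero    (x ∷ u) (y ∷ v) = refl
psum-+ (suc k) (x ∷ u) (y ∷ v) =
  trans (cong (ℤ._+_ (x ℤ.+ y)) (psum-+ k u v)) (lem x y (psum k u) (psum k v))
  where
  lem : ∀ x y a b → x ℤ.+ y ℤ.+ (a ℤ.+ b) ≡ x ℤ.+ a ℤ.+ (y ℤ.+ b)
  lem = solve-∀

psum-minus : ∀ {m} k (u v : Vec ℤ m) → psum k (u -v v) ≡ psum k u ℤ.- psum k v
psum-minus k       []      []      = refl
psum-minus zero    (x ∷ u) (y ∷ v) = refl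
psum-minus (suc k) (x ∷ u) (y ∷ v) =
  trans (cong (ℤ._+_ (x ℤ.- y)) (psum-minus k u v)) (lem x y (psum k u) (psum k v))
  where
  lem : ∀ x y a b → x ℤ.- y ℤ.+ (a ℤ.- b) ≡ x ℤ.+ a ℤ.- (y ℤ.+ b)
  lem = solve-∀

psum-scale : ∀ {m} k c (u : Vec ℤ m) → psum k (Vec.map (c ℤ.*_) u) ≡ c ℤ.* psum k u
psum-scale k       c []      = sym (ℤₚ.*-zeroʳ c)
psum-scale zero    c (x ∷ u) = sym (ℤₚ.*-zeroʳ c)
psum-scale (suc k) c (x ∷ u) =
  trans (cong (ℤ._+_ (c ℤ.* x)) (psum-scale k c u)) (sym (ℤₚ.*-distribˡ-+ c x (psum k u)))

ι : Bool → ℤ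
ι b = if b then + 1 else + 0

psum-eN : ∀ {m a} → a < m → ∀ k → psum k (eN m a) ≡ ι (a <ᵇ k)
psum-eN {suc m} {zero}  a<m zero    = refl
psum-eN {suc m} {zero}  a<m (suc k) = trans (cong (ℤ._+_ (+ 1)) (psum-zero m k)) refl
psum-eN {suc m} {suc a} a<m zero    = refl
psum-eN {suc m} {suc a} (s≤s a<m) (suc k) = trans (ℤₚ.+-identityˡ _) (psum-eN a<m k)

psum-r : ∀ {m a b} → a < m → b < m → ∀ k → psum k (root m a b) ≡ ι (a <ᵇ k) ℤ.- ι (b <ᵇ k)
psum-r {m} {a} {b} a< b< k =
  trans (psum-minus k (eN m a) (eN m b)) (cong₂ ℤ._-_ (psum-eN a< k) (psum-eN b< k))

dot : ∀ {m} → Vec ℤ m → Vec ℤ m → ℤ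
dot u v = List.foldr ℤ._+_ (+ 0) (Vec.toList (zipWith ℤ._*_ u v))

dot-zeroʳ : ∀ {m} (u : Vec ℤ m) → dot u (replicate m (+ 0)) ≡ + 0
dot-zeroʳ []      = refl
dot-zeroʳ (x ∷ u) = cong₂ ℤ._+_ (ℤₚ.*-zeroʳ x) (dot-zeroʳ u)

dot-eN : ∀ {m} (u : Vec ℤ m) a → dot u (eN m a) ≡ co u a
dot-eN []      a       = refl
dot-eN (x ∷ u) zero    = trans (cong₂ ℤ._+_ (ℤₚ.*-identityʳ x) (dot-zeroʳ u)) (ℤₚ.+-identityʳ x)
dot-eN (x ∷ u) (suc a) =
  trans (cong₂ ℤ._+_ (ℤₚ.*-zeroʳ x) (dot-eN u a)) (ℤₚ.+-identityˡ _)

dot-minusʳ : ∀ {m} (x u v : Vec ℤ m) → dot x (u -v v) ≡ dot x u ℤ.- dot x v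
dot-minusʳ []      []      []      = refl
dot-minusʳ (x ∷ w) (y ∷ u) (z ∷ v) =
  trans (cong (ℤ._+_ (x ℤ.* (y ℤ.- z))) (dot-minusʳ w u v)) (lem x y z (dot w u) (dot w v))
  where
  lem : ∀ x y z a b → x ℤ.* (y ℤ.- z) ℤ.+ (a ℤ.- b) ≡ x ℤ.* y ℤ.+ a ℤ.- (x ℤ.* z ℤ.+ b)
  lem = solve-∀

dot-minusˡ : ∀ {m} (u v x : Vec ℤ m) → dot (u -v v) x ≡ dot u x ℤ.- dot v x
dot-minusˡ []      []      []      = refl
dot-minusˡ (y ∷ u) (z ∷ v) (x ∷ w) =
  trans (cong (ℤ._+_ ((y ℤ.- z) ℤ.* x)) (dot-minusˡ u v w)) (lem x y z (dot u w) (dot v w))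
  where
  lem : ∀ x y z a b → (y ℤ.- z) ℤ.* x ℤ.+ (a ℤ.- b) ≡ y ℤ.* x ℤ.+ a ℤ.- (z ℤ.* x ℤ.+ b)
  lem = solve-∀

dot-r : ∀ {m} (x : Vec ℤ m) a b → dot x (root m a b) ≡ co x a ℤ.- co x b
dot-r {m} x a b =
  trans (dot-minusʳ x (eN m a) (eN m b)) (cong₂ ℤ._-_ (dot-eN x a) (dot-eN x b))

-- Abstracts from the way the transposition is computed, so that the simple reflections (`swp`) and
-- the affine one (`swapEnds`) share one calculation.
record Transposition (a b : ℕ) (f : ℕ → ℕ) : Set where
  constructor transposition
  field
    distinct : a ≢ b
    left     : f a ≡ b
    right    : f b ≡ a
    other    : ∀ k → k ≢ a → k ≢ b → f k ≡ k

  involutive : ∀ k → f (f k) ≡ k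
  involutive k with k ℕ.≟ a | k ℕ.≟ b
  ... | yes refl | _ = trans (cong f left) right
  ... | no _ | yes refl = trans (cong f right) left
  ... | no p | no q = trans (cong f (other k p q)) (other k p q)

  injective : ∀ {j k} → f j ≡ f k → j ≡ k
  injective {j} {k} p = trans (sym (involutive j)) (trans (cong f p) (involutive k))

  bounded : ∀ {m} → a ≤ m → b ≤ m → ∀ k → k ≤ m → f k ≤ m
  bounded {m} a≤ b≤ k k≤ with k ℕ.≟ a | k ℕ.≟ b
  ... | yes refl | _ = subst (_≤ m) (sym left) b≤
  ... | no _ | yes refl = subst (_≤ m) (sym right) a≤
  ... | no p | no q = subst (_≤ m) (sym (other k p q)) k≤

  δ-transpose : ∀ c k → δ c (f k) ≡ δ (f c) k
  δ-transpose c k with c ℕ.≟ f k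
  ... | yes refl = trans (δ-refl (f k)) (sym (trans (cong (λ j → δ j k) (involutive k)) (δ-refl k)))
  ... | no p = trans (δ-≢ p) (sym (δ-≢ (λ q → p (trans (sym (involutive c)) (cong f q)))))

  co-reflection : ∀ {m} → a < m → b < m → (x : Vec ℤ m) → ∀ k →
    co (x -v Vec.map (dot x (root m a b) ℤ.*_) (root m a b)) k ≡ co x (f k)
  co-reflection {m} a< b< x k = trans (co-minus x (Vec.map (dot x (root m a b) ℤ.*_) (root m a b)) k)
    (trans (cong (ℤ._-_ (co x k)) (trans (co-scale (dot x (root m a b)) (root m a b) k)
      (cong₂ ℤ._*_ (dot-r x a b) (co-r a< b< k)))) step)
    where
    l₁ : ∀ u v → u ℤ.- (u ℤ.- v) ℤ.* (+ 1 ℤ.- + 0) ≡ v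
    l₁ = solve-∀
    l₂ : ∀ u v → v ℤ.- (u ℤ.- v) ℤ.* (+ 0 ℤ.- + 1) ≡ u
    l₂ = solve-∀
    l₃ : ∀ u v w → w ℤ.- (u ℤ.- v) ℤ.* (+ 0 ℤ.- + 0) ≡ w
    l₃ = solve-∀
    step : co x k ℤ.- (co x a ℤ.- co x b) ℤ.* (δ a k ℤ.- δ b k) ≡ co x (f k)
    step with k ℕ.≟ a | k ℕ.≟ b
    ... | yes refl | _ rewrite δ-refl k | δ-≢ (distinct ∘ sym) | left = l₁ (co x k) (co x b)
    ... | no p | yes refl rewrite δ-refl k | δ-≢ distinct | right = l₂ (co x a) (co x k)
    ... | no p | no q rewrite δ-≢ (p ∘ sym) | δ-≢ (q ∘ sym) | other k p q =
      l₃ (co x a) (co x b) (co x k)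

  reflection-eN : ∀ {m} → a < m → b < m → ∀ {c} → c < m →
    eN m c -v Vec.map (dot (eN m c) (root m a b) ℤ.*_) (root m a b) ≡ eN m (f c)
  reflection-eN {suc m} a< b< {c} c< = co-ext λ k _ →
    trans (co-reflection a< b< (eN (suc m) c) k)
    (trans (co-eN c< (f k)) (trans (δ-transpose c k)
      (sym (co-eN (s≤s (bounded (ℕ.s≤s⁻¹ a<) (ℕ.s≤s⁻¹ b<) c (ℕ.s≤s⁻¹ c<))) k))))

clamp : ℕ → ℕ → ℕ → ℕ
clamp lo hi h = (h ℕ.⊔ lo) ℕ.⊓ hi

private
  addα : ∀ n → ℕ → ℕ → Fin n → Vec ℤ (suc n) → Vec ℤ (suc n)
  addα n lo hi h acc = if (lo ≤ᵇ toℕ h) ∧ (toℕ h <ᵇ hi) then _⊕_ n (α n h) acc else acc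

  -- Generalised to a tail of the enumeration starting at `o`, so that the sum telescopes. An index
  -- outside the range has the same clamp as its successor, hence skipped terms fit into the
  -- telescope.
  foldr-sum : ∀ n lo hi m (f : Fin m → Fin n) o k → (∀ j → toℕ (f j) ≡ o ℕ.+ toℕ j) →
    lo ≤ hi →
    co (List.foldr (addα n lo hi) (𝟎 n) (List.tabulate f)) k ≡ δ (clamp lo hi o) k ℤ.- δ (clamp lo hi (o ℕ.+ m)) k
  foldr-sum n lo hi zero f o k fo lo≤hi rewrite ℕₚ.+-identityʳ o =
    trans (co-zero (suc n) k) (sym (ℤₚ.+-inverseʳ (δ (clamp lo hi o) k)))
  foldr-sum n lo hi (suc m) f o k fo lo≤hi
    with foldr-sum n lo hi m (f ∘ Fin.suc) (suc o) k (λ j → trans (fo (Fin.suc j)) (ℕₚ.+-suc o (toℕ j))) lo≤hi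
  ... | ih rewrite ℕₚ.+-suc o m
    with lo ≤ᵇ toℕ (f Fin.zero) in p | toℕ (f Fin.zero) <ᵇ hi in q
  ... | true | true = trans (co-+ (α n (f Fin.zero)) (List.foldr (addα n lo hi) (𝟎 n) (List.tabulate (f ∘ Fin.suc))) k)
      (trans (cong₂ ℤ._+_ (trans (cong (λ v → co v k) (α≡r n (f Fin.zero)))
           (co-r (ℕₚ.<-trans (Finₚ.toℕ<n (f Fin.zero)) (ℕₚ.n<1+n n)) (s≤s (Finₚ.toℕ<n (f Fin.zero))) k)) ih)
      (trans (cong₂ (λ a b → δ a k ℤ.- δ b k ℤ.+ (δ (clamp lo hi (suc o)) k ℤ.- δ (clamp lo hi (suc (o ℕ.+ m))) k)) ca cb)
        (lem (δ (clamp lo hi o) k) (δ (clamp lo hi (suc o)) k) (δ (clamp lo hi (suc (o ℕ.+ m))) k))))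
    where
    lem : ∀ x y z → x ℤ.- y ℤ.+ (y ℤ.- z) ≡ x ℤ.- z
    lem = solve-∀
    f0 : toℕ (f Fin.zero) ≡ o
    f0 = trans (fo Fin.zero) (ℕₚ.+-identityʳ o)
    lo≤o : lo ≤ o
    lo≤o = subst (lo ≤_) f0 (ℕₚ.≤ᵇ⇒≤ _ _ (subst T (sym p) _))
    o<hi : o < hi
    o<hi = subst (_< hi) f0 (ℕₚ.<ᵇ⇒< _ _ (subst T (sym q) _))
    ca : toℕ (f Fin.zero) ≡ clamp lo hi o
    ca = trans f0 (sym (trans (cong (ℕ._⊓ hi) (ℕₚ.m≥n⇒m⊔n≡m lo≤o)) (ℕₚ.m≤n⇒m⊓n≡m (ℕₚ.<⇒≤ o<hi))))
    cb : suc (toℕ (f Fin.zero)) ≡ clamp lo hi (suc o)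
    cb = trans (cong suc f0) (sym (trans (cong (ℕ._⊓ hi) (ℕₚ.m≥n⇒m⊔n≡m (ℕₚ.m≤n⇒m≤1+n lo≤o))) (ℕₚ.m≤n⇒m⊓n≡m o<hi)))
  ... | true | false = trans ih (cong (λ a → δ a k ℤ.- δ (clamp lo hi (suc (o ℕ.+ m))) k)
        (trans (ℕₚ.m≥n⇒m⊓n≡n (ℕₚ.≤-trans (ℕₚ.m≤n⇒m≤1+n hi≤o) (ℕₚ.m≤m⊔n (suc o) lo))) (sym (ℕₚ.m≥n⇒m⊓n≡n (ℕₚ.≤-trans hi≤o (ℕₚ.m≤m⊔n o lo))))))
    where
    f0 : toℕ (f Fin.zero) ≡ o
    f0 = trans (fo Fin.zero) (ℕₚ.+-identityʳ o)
    hi≤o : hi ≤ o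
    hi≤o = subst (hi ≤_) f0 (ℕₚ.≮⇒≥ (λ lt → subst T q (ℕₚ.<⇒<ᵇ lt)))
  ... | false | _ = trans ih (cong (λ a → δ (a ℕ.⊓ hi) k ℤ.- δ (clamp lo hi (suc (o ℕ.+ m))) k)
       (trans (ℕₚ.m≤n⇒m⊔n≡n o<lo) (sym (ℕₚ.m≤n⇒m⊔n≡n (ℕₚ.<⇒≤ o<lo)))))
    where
    f0 : toℕ (f Fin.zero) ≡ o
    f0 = trans (fo Fin.zero) (ℕₚ.+-identityʳ o)
    o<lo : o < lo
    o<lo = subst (_< lo) f0 (ℕₚ.≰⇒> (λ le → subst T p (ℕₚ.≤⇒≤ᵇ le)))

sumα≡r : ∀ n lo hi → lo ≤ hi → hi ≤ n → sumα n lo hi ≡ root (suc n) lo hi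
sumα≡r n lo hi lo≤hi hi≤n = co-ext λ k _ →
  trans (foldr-sum n lo hi n id 0 k (λ _ → refl) lo≤hi)
  (trans (cong₂ (λ a b → δ a k ℤ.- δ b k) (ℕₚ.m≤n⇒m⊓n≡m lo≤hi)
       (ℕₚ.m≥n⇒m⊓n≡n (ℕₚ.≤-trans hi≤n (ℕₚ.m≤m⊔n n lo))))
    (sym (co-r (s≤s (ℕₚ.≤-trans lo≤hi hi≤n)) (s≤s hi≤n) k)))

θ≡r : ∀ n → θ n ≡ root (suc n) 0 n
θ≡r n = sumα≡r n 0 n z≤n ℕₚ.≤-refl

PosRoot : ∀ n → Vec ℤ (suc n) → Set
PosRoot n v = ∃[ a ] ∃[ b ] (a < b × b ≤ n × v ≡ root (suc n) a b)

isPos⇒PosRoot : ∀ {n v} → isPos n v → PosRoot n v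
isPos⇒PosRoot {n} (i , j , i≤j , eq) = toℕ i , suc (toℕ j) , s≤s i≤j , Finₚ.toℕ<n j ,
  trans eq (sumα≡r n (toℕ i) (suc (toℕ j)) (ℕₚ.m≤n⇒m≤1+n i≤j) (Finₚ.toℕ<n j))

r-isPos : ∀ {n a b} → a < b → b ≤ n → isPos n (root (suc n) a b)
r-isPos {n} {a} {suc b} (s≤s a≤b) b<n = Fin.fromℕ< a<n , Fin.fromℕ< b<n ,
  subst₂ _≤_ (sym (Finₚ.toℕ-fromℕ< a<n)) (sym (Finₚ.toℕ-fromℕ< b<n)) a≤b ,
  sym (trans (cong₂ (λ x y → sumα n x (suc y)) (Finₚ.toℕ-fromℕ< a<n) (Finₚ.toℕ-fromℕ< b<n))
    (sumα≡r n a (suc b) (ℕₚ.m≤n⇒m≤1+n a≤b) b<n))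
  where
  a<n : a < n
  a<n = ℕₚ.≤-<-trans a≤b b<n

r-isRoot : ∀ {n a b} → a ≢ b → a ≤ n → b ≤ n → isRoot n (root (suc n) a b)
r-isRoot {n} {a} {b} a≢b a≤n b≤n with ℕₚ.<-cmp a b
... | tri< a<b _ _ = inj₁ (r-isPos a<b b≤n)

... | tri≈ _ a≡b _ = ⊥-elim (a≢b a≡b)
... | tri> _ _ b<a = inj₂ (subst (isPos n) (sym (neg-r (suc n) a b)) (r-isPos b<a a≤n))

isRoot⇒r : ∀ {n v} → isRoot n v → ∃[ a ] ∃[ b ] (a ≢ b × a ≤ n × b ≤ n × v ≡ root (suc n) a b)
isRoot⇒r {n} {v} (inj₁ p) with isPos⇒PosRoot p
... | a , b , a<b , b≤n , eq = a , b , ℕₚ.<⇒≢ a<b , ℕₚ.≤-trans (ℕₚ.<⇒≤ a<b) b≤n , b≤n , eq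
isRoot⇒r {n} {v} (inj₂ p) with isPos⇒PosRoot p
... | a , b , a<b , b≤n , eq = b , a , ℕₚ.>⇒≢ a<b , b≤n , ℕₚ.≤-trans (ℕₚ.<⇒≤ a<b) b≤n ,
  trans (co-ext λ k _ → sym (trans (co-neg (negv v) k) (trans (cong ℤ.-_ (co-neg v k)) (ℤₚ.neg-involutive _))))
        (trans (cong negv eq) (neg-r (suc n) a b))

ρ≡r : ∀ n (s t : Fin (suc n)) → ρ n s t ≡ root (suc n) (toℕ s) (toℕ t)
ρ≡r n s t with toℕ s <ᵇ toℕ t in p
... | true = sumα≡r n (toℕ s) (toℕ t) (ℕₚ.<⇒≤ (ℕₚ.<ᵇ⇒< _ _ (subst T (sym p) _))) (ℕ.s≤s⁻¹ (Finₚ.toℕ<n t))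
... | false = trans (cong negv (sumα≡r n (toℕ t) (toℕ s) (ℕₚ.≮⇒≥ (λ lt → subst T p (ℕₚ.<⇒<ᵇ lt))) (ℕ.s≤s⁻¹ (Finₚ.toℕ<n s))))
   (neg-r (suc n) (toℕ t) (toℕ s))

-- Finite permutations: exchange and sorting

swp : ℕ → ℕ → ℕ
swp zero    zero          = 1
swp zero    (suc zero)    = 0
swp zero    (suc (suc k)) = suc (suc k)
swp (suc h) zero          = zero
swp (suc h) (suc k)       = suc (swp h k)

swp-left : ∀ h → swp h h ≡ suc h
swp-left zero    = refl
swp-left (suc h) = cong suc (swp-left h)

swp-right : ∀ h → swp h (suc h) ≡ h
swp-right zero    = refl
swp-right (suc h) = cong suc (swp-right h)

swp-other : ∀ h k → k ≢ h → k ≢ suc h → swp h k ≡ k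
swp-other zero    zero          p q = ⊥-elim (p refl)
swp-other zero    (suc zero)    p q = ⊥-elim (q refl)
swp-other zero    (suc (suc k)) p q = refl
swp-other (suc h) zero          p q = refl
swp-other (suc h) (suc k)       p q = cong suc (swp-other h k (p ∘ cong suc) (q ∘ cong suc))

swp-transposition : ∀ h → Transposition h (suc h) (swp h)
swp-transposition h = transposition (ℕₚ.<⇒≢ (ℕₚ.n<1+n h)) (swp-left h) (swp-right h) (swp-other h)

swp-involutive : ∀ h k → swp h (swp h k) ≡ k
swp-involutive h = Transposition.involutive (swp-transposition h)

swp-bounded : ∀ {n h k} → h < n → k ≤ n → swp h k ≤ n
swp-bounded {h = h} {k} h<n = Transposition.bounded (swp-transposition h) (ℕₚ.<⇒≤ h<n) h<n k

swp-mono : ∀ h {j k} → j < k → ¬ (j ≡ h × k ≡ suc h) → swp h j < swp h k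
swp-mono zero    {zero}        {suc zero}    j<k p = ⊥-elim (p (refl , refl))
swp-mono zero    {zero}        {suc (suc k)} j<k p = s≤s (s≤s z≤n)
swp-mono zero    {suc zero}    {suc zero}    (s≤s ()) p
swp-mono zero    {suc zero}    {suc (suc k)} j<k p = s≤s z≤n
swp-mono zero    {suc (suc j)} {suc zero}    (s≤s ()) p
swp-mono zero    {suc (suc j)} {suc (suc k)} j<k p = j<k
swp-mono (suc h) {zero}        {suc k}       j<k p = s≤s z≤n
swp-mono (suc h) {suc j}       {suc k}       (s≤s j<k) p =
  s≤s (swp-mono h j<k (λ (x , y) → p (cong suc x , cong suc y)))

module _ {n : ℕ} where

  -- `w` sends `e_a` to `e_{sg w a}`; `pi w` is the inverse permutation, which tells from where a
  -- coordinate of the image is taken.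
  sg pi : List (Fin n) → ℕ → ℕ
  sg []      a = a
  sg (h ∷ w) a = swp (toℕ h) (sg w a)
  pi []      k = k
  pi (h ∷ w) k = pi w (swp (toℕ h) k)

  sg-pi : ∀ w k → sg w (pi w k) ≡ k
  sg-pi []      k = refl
  sg-pi (h ∷ w) k = trans (cong (swp (toℕ h)) (sg-pi w (swp (toℕ h) k))) (swp-involutive (toℕ h) k)

  pi-sg : ∀ w a → pi w (sg w a) ≡ a
  pi-sg []      a = refl
  pi-sg (h ∷ w) a = trans (cong (pi w) (swp-involutive (toℕ h) (sg w a))) (pi-sg w a)

  sg-injective : ∀ w {a b} → sg w a ≡ sg w b → a ≡ b
  sg-injective w {a} {b} p = trans (sym (pi-sg w a)) (trans (cong (pi w) p) (pi-sg w b))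

  sg-bounded : ∀ w {a} → a ≤ n → sg w a ≤ n
  sg-bounded []      a≤n = a≤n
  sg-bounded (h ∷ w) a≤n = swp-bounded (Finₚ.toℕ<n h) (sg-bounded w a≤n)

  pi-bounded : ∀ w {k} → k ≤ n → pi w k ≤ n
  pi-bounded []      k≤n = k≤n
  pi-bounded (h ∷ w) k≤n = pi-bounded w (swp-bounded (Finₚ.toℕ<n h) k≤n)

  pi-++ : ∀ w u k → pi (w ++ u) k ≡ pi u (pi w k)
  pi-++ []      u k = refl
  pi-++ (h ∷ w) u k = pi-++ w u (swp (toℕ h) k)

  co-reflE : ∀ h x k → co (reflE n (α n h) x) k ≡ co x (swp (toℕ h) k)
  co-reflE h x k = trans (cong (λ β → co (reflE n β x) k) (α≡r n h))
    (Transposition.co-reflection (swp-transposition (toℕ h))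
      (ℕₚ.<-trans (Finₚ.toℕ<n h) (ℕₚ.n<1+n n)) (s≤s (Finₚ.toℕ<n h)) x k)

  co-actW : ∀ w x k → co (actW n w x) k ≡ co x (pi w k)
  co-actW []      x k = refl
  co-actW (h ∷ w) x k = trans (co-reflE h (actW n w x) k) (co-actW w x (swp (toℕ h) k))

  actW-cong : ∀ x y → (∀ k → pi x k ≡ pi y k) → ∀ v → actW n x v ≡ actW n y v
  actW-cong x y h v = co-ext λ k _ →
    trans (co-actW x v k) (trans (cong (co v) (h k)) (sym (co-actW y v k)))

  private
    index : ∀ m → ℕ → Vec ℤ m
    index zero    o = []
    index (suc m) o = + o ∷ index m (suc o)

    co-index : ∀ m o {k} → k < m → co (index m o) k ≡ + (o ℕ.+ k)
    co-index (suc m) o {zero}  _ = cong +_ (sym (ℕₚ.+-identityʳ o))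
    co-index (suc m) o {suc k} (s≤s k<m) =
      trans (co-index m (suc o) k<m) (cong +_ (sym (ℕₚ.+-suc o k)))

  -- Both words are evaluated at `(0, 1, …, n)`, whose coordinates are distinct and therefore record
  -- the permutation.
  actW-faithful : ∀ x y → (∀ v → actW n x v ≡ actW n y v) → ∀ {k} → k ≤ n → pi x k ≡ pi y k
  actW-faithful x y h {k} k≤n = ℤₚ.+-injective
    (trans (sym (co-index (suc n) 0 (s≤s (pi-bounded x k≤n))))
    (trans (sym (co-actW x (index (suc n) 0) k))
    (trans (cong (λ v → co v k) (h (index (suc n) 0)))
    (trans (co-actW y (index (suc n) 0) k)
           (co-index (suc n) 0 (s≤s (pi-bounded y k≤n)))))))

  actW-r : ∀ w {a b} → a ≤ n → b ≤ n →
    actW n w (root (suc n) a b) ≡ root (suc n) (sg w a) (sg w b)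
  actW-r []      a≤n b≤n = refl
  actW-r (h ∷ w) {a} {b} a≤n b≤n = trans (cong (reflE n (α n h)) (actW-r w a≤n b≤n))
    (co-ext λ k _ → trans (co-reflE h (root (suc n) (sg w a) (sg w b)) k)
      (trans (co-r a< b< (swp (toℕ h) k))
      (trans (cong₂ ℤ._-_ (δ-transpose (sg w a) k) (δ-transpose (sg w b) k))
        (sym (co-r (s≤s (swp-bounded (Finₚ.toℕ<n h) (sg-bounded w a≤n)))
                   (s≤s (swp-bounded (Finₚ.toℕ<n h) (sg-bounded w b≤n))) k)))))
    where
    open Transposition (swp-transposition (toℕ h))
    a< = s≤s (sg-bounded w a≤n)
    b< = s≤s (sg-bounded w b≤n)

  -- The exchange condition. Follow `a` and `suc a` through the word from its right end: the first
  -- letter to reverse their order must find them at `h` and `suc h`, and deleting that letter gives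
  -- a word for `w s_a`.
  exchange : ∀ (w : List (Fin n)) a → sg w a < sg w (suc a) ⊎
    (∃[ x ] (suc (length x) ≡ length w × ∀ k → pi x k ≡ swp a (pi w k)))
  exchange []      a = inj₁ (ℕₚ.n<1+n a)
  exchange (h ∷ w) a with exchange w a
  ... | inj₂ (x , len , eq) = inj₂ (h ∷ x , cong suc len , λ k → eq (swp (toℕ h) k))
  ... | inj₁ lt with sg w a ℕ.≟ toℕ h | sg w (suc a) ℕ.≟ suc (toℕ h)
  ... | no p  | _     = inj₁ (swp-mono (toℕ h) lt (p ∘ proj₁))
  ... | yes _ | no q  = inj₁ (swp-mono (toℕ h) lt (q ∘ proj₂))
  ... | yes p | yes q = inj₂ (w , refl , eq)
    where
    pa : pi w (toℕ h) ≡ a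
    pa = trans (cong (pi w) (sym p)) (pi-sg w a)
    pb : pi w (suc (toℕ h)) ≡ suc a
    pb = trans (cong (pi w) (sym q)) (pi-sg w (suc a))
    eq : ∀ k → pi w k ≡ swp a (pi w (swp (toℕ h) k))
    eq k with k ℕ.≟ toℕ h | k ℕ.≟ suc (toℕ h)
    ... | yes refl | _ rewrite swp-left (toℕ h) | pb | swp-right a = pa
    ... | no _ | yes refl rewrite swp-right (toℕ h) | pa | swp-left a = pb
    ... | no ¬p | no ¬q rewrite swp-other (toℕ h) k ¬p ¬q =
      sym (swp-other a (pi w k)
        (λ e → ¬p (trans (sym (sg-pi w k)) (trans (cong (sg w) e) p)))
        (λ e → ¬q (trans (sym (sg-pi w k)) (trans (cong (sg w) e) q))))

  minCosetRep⇒increasing : ∀ i w → MinCosetRep n i w →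
    ∀ (h : Fin n) → h ≢ i → sg w (toℕ h) < sg w (suc (toℕ h))
  minCosetRep⇒increasing i w min h h≢i with exchange w (toℕ h)
  ... | inj₁ lt = lt
  ... | inj₂ (x , len , eq) = ⊥-elim (ℕₚ.<-irrefl refl (ℕₚ.<-≤-trans (ℕₚ.≤-reflexive len)
        (min (h ∷ []) (h≢i All.∷ All.[]) x
          (actW-cong x (w ++ h ∷ []) λ k → trans (eq k) (sym (pi-++ w (h ∷ []) k))))))

-- For `q = i + 1` the two blocks are the orbits of the parabolic subgroup that omits the reflection
-- `i`.
BlockMono : ℕ → ℕ → (ℕ → ℕ) → Set
BlockMono n q f = ∀ {a b} → a < b → b ≤ n → (a <ᵇ q) ≡ (b <ᵇ q) → f a < f b

T⇒≡ : ∀ {b} → T b → b ≡ true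
T⇒≡ {true} _ = refl

<⇒<ᵇ≡ : ∀ {a b} → a < b → (a <ᵇ b) ≡ true
<⇒<ᵇ≡ lt = T⇒≡ (ℕₚ.<⇒<ᵇ lt)

≤⇒<ᵇ≡ : ∀ {a b} → b ≤ a → (a <ᵇ b) ≡ false
≤⇒<ᵇ≡ {a} {b} le with a <ᵇ b in eq
... | false = refl
... | true  = ⊥-elim (ℕₚ.<⇒≱ (ℕₚ.<ᵇ⇒< a b (subst T (sym eq) _)) le)

<ᵇ≡⇒< : ∀ a b → (a <ᵇ b) ≡ true → a < b
<ᵇ≡⇒< a b eq = ℕₚ.<ᵇ⇒< a b (subst T (sym eq) _)

<ᵇ≡⇒≤ : ∀ a b → (a <ᵇ b) ≡ false → b ≤ a
<ᵇ≡⇒≤ a b eq = ℕₚ.≮⇒≥ λ lt → subst T eq (ℕₚ.<⇒<ᵇ lt)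

increasing⇒blockMono : ∀ {n} q f →
  (∀ {h} → h < n → suc h ≢ q → f h < f (suc h)) → BlockMono n q f
increasing⇒blockMono {n} q f inc {a} {suc b} (s≤s a≤b) b<n same with ℕₚ.m≤n⇒m<n∨m≡n a≤b
... | inj₂ refl = inc b<n ne
  where
  ne : suc a ≢ q
  ne refl with () ← trans (sym (<⇒<ᵇ≡ (ℕₚ.n<1+n a))) (trans same (≤⇒<ᵇ≡ {suc a} {suc a} ℕₚ.≤-refl))
... | inj₁ a<b = ℕₚ.<-trans (increasing⇒blockMono q f inc a<b (ℕₚ.<⇒≤ b<n) same′) (inc b<n ne)
  where
  same′ : (a <ᵇ q) ≡ (b <ᵇ q)
  same′ with a <ᵇ q in eq
  ... | true  = sym (<⇒<ᵇ≡ (ℕₚ.<-trans (ℕₚ.n<1+n b) (<ᵇ≡⇒< (suc b) q (sym same))))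
  ... | false = sym (≤⇒<ᵇ≡ (ℕₚ.≤-trans (<ᵇ≡⇒≤ a q eq) a≤b))
  ne : suc b ≢ q
  ne refl with () ← trans (sym (<⇒<ᵇ≡ (s≤s a≤b))) (trans same (≤⇒<ᵇ≡ {suc b} {suc b} ℕₚ.≤-refl))

-- The sum of the positions o + k, k < m, at which c holds: its increments count the inversions of a
-- word in the letters true and false.
height : ℕ → ℕ → (ℕ → Bool) → ℕ
height zero    o c = 0
height (suc m) o c = (if c 0 then o else 0) ℕ.+ height m (suc o) (c ∘ suc)

height-cong : ∀ m o {c c′} → (∀ {k} → k < m → c k ≡ c′ k) → height m o c ≡ height m o c′
height-cong zero    o h = refl
height-cong (suc m) o h = cong₂ ℕ._+_ (cong (λ b → if b then o else 0) (h (s≤s z≤n)))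
  (height-cong m (suc o) (λ k<m → h (s≤s k<m)))

height-swp-≤ : ∀ m o h c → suc h < m → height m o (c ∘ swp h) ≤ suc (height m o c)
height-swp-≤ (suc (suc m)) o zero c _ with c 0 | c 1
... | true  | true  = ℕₚ.n≤1+n _
... | true  | false = s≤s (ℕₚ.≤-reflexive refl)
... | false | true  = ℕₚ.≤-trans (ℕₚ.n≤1+n _) (ℕₚ.n≤1+n _)
... | false | false = ℕₚ.n≤1+n _
height-swp-≤ (suc m) o (suc h) c (s≤s lt) =
  ℕₚ.≤-trans (ℕₚ.+-monoʳ-≤ (if c 0 then o else 0) (height-swp-≤ m (suc o) h (c ∘ suc) lt))
    (ℕₚ.≤-reflexive (ℕₚ.+-suc _ _))

height-swp-≡ : ∀ m o h c → suc h < m → c h ≡ false → c (suc h) ≡ true →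
  suc (height m o (c ∘ swp h)) ≡ height m o c
height-swp-≡ (suc (suc m)) o zero c _ p q with c 0 | c 1
height-swp-≡ (suc (suc m)) o zero c _ refl refl | false | true = refl
height-swp-≡ (suc m) o (suc h) c (s≤s lt) p q =
  trans (sym (ℕₚ.+-suc (if c 0 then o else 0) _))
        (cong ((if c 0 then o else 0) ℕ.+_) (height-swp-≡ m (suc o) h (c ∘ suc) lt p q))

downClosed⇒threshold : ∀ m (c : ℕ → Bool) → (∀ k → suc k < m → c (suc k) ≡ true → c k ≡ true) →
  ∃[ q ] (q ≤ m × ∀ {k} → k < m → c k ≡ (k <ᵇ q))
downClosed⇒threshold zero c dc = 0 , z≤n , λ ()
downClosed⇒threshold (suc m) c dc
  with downClosed⇒threshold m (c ∘ suc) (λ k lt → dc (suc k) (s≤s lt)) | c 0 in c0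
... | q , q≤m , h | true = suc q , s≤s q≤m , λ { {zero} _ → c0 ; {suc k} (s≤s lt) → h lt }
... | q , q≤m , h | false = 0 , z≤n , allfalse
  where
  allfalse : ∀ {k} → k < suc m → c k ≡ false
  allfalse {zero}  _  = c0
  allfalse {suc k} lt with c (suc k) in eq
  ... | false = refl
  ... | true with () ← trans (sym (allfalse {k} (ℕₚ.<-trans (ℕₚ.n<1+n k) lt))) (dc k lt eq)

module _ {n : ℕ} where

  -- `len` says that the word has as many letters as `c` has inversions (a `false` before a `true`),
  -- since the sorted colouring has the least height. Minimality in the coset rests on this exact
  -- count.
  record Sorted (c : ℕ → Bool) : Set where
    field
      word   : List (Fin n)
      q      : ℕ
      q≤     : q ≤ suc n
      colour : ∀ {a} → a ≤ n → c (sg word a) ≡ (a <ᵇ q)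
      mono   : BlockMono n q (sg word)
      len    : length word ℕ.+ height (suc n) 0 (_<ᵇ q) ≡ height (suc n) 0 c

  private
    badPair : ∀ (c : ℕ → Bool) → Dec (∃[ h ] (c (toℕ {n} h) ≡ false × c (suc (toℕ h)) ≡ true))
    badPair c = Finₚ.any? λ (h : Fin n) → (c (toℕ h) Boolₚ.≟ false) ×-dec (c (suc (toℕ h)) Boolₚ.≟ true)

    -- Bubble sort with the height as termination measure: each adjacent swap of `false`, `true`
    -- lowers it by one. Swapping letters of different colours never disturbs the order within a
    -- colour.
    sort′ : ∀ m c → height (suc n) 0 c ≡ m → Sorted c
    sort′ m c hc with badPair c
    sort′ m c hc | no none with downClosed⇒threshold (suc n) c dc
      where
      dc : ∀ k → suc k < suc n → c (suc k) ≡ true → c k ≡ true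
      dc k (s≤s k<n) p with c k in eq
      ... | true  = refl
      ... | false = ⊥-elim (none (Fin.fromℕ< k<n , trans (cong c (Finₚ.toℕ-fromℕ< k<n)) eq ,
                                   trans (cong (c ∘ suc) (Finₚ.toℕ-fromℕ< k<n)) p))
    ... | q , q≤ , h = record
      { word = [] ; q = q ; q≤ = q≤ ; colour = λ a≤n → h (s≤s a≤n) ; mono = λ lt _ _ → lt
      ; len = sym (height-cong (suc n) 0 h) }
    sort′ zero c hc | yes (h , p , q)
      with () ← trans (height-swp-≡ (suc n) 0 (toℕ h) c (s≤s (Finₚ.toℕ<n h)) p q) hc
    sort′ (suc m) c hc | yes (h , p , q) = record
      { word = h ∷ S.word ; q = S.q ; q≤ = S.q≤ ; colour = S.colour ; mono = mono
      ; len = trans (cong suc S.len) step }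
      where
      step : suc (height (suc n) 0 (c ∘ swp (toℕ h))) ≡ height (suc n) 0 c
      step = height-swp-≡ (suc n) 0 (toℕ h) c (s≤s (Finₚ.toℕ<n h)) p q
      S : Sorted (c ∘ swp (toℕ h))
      S = sort′ m (c ∘ swp (toℕ h)) (ℕₚ.suc-injective (trans step hc))
      module S = Sorted S
      mono : BlockMono n S.q (sg (h ∷ S.word))
      mono {a} {b} a<b b≤n same = swp-mono (toℕ h) (S.mono a<b b≤n same) λ (x , y) → contra x y
        where
        contra : sg S.word a ≡ toℕ h → sg S.word b ≡ suc (toℕ h) → ⊥
        contra x y with () ← trans (sym q) (trans (sym (trans (cong (c ∘ swp (toℕ h)) x)
                              (cong c (swp-left (toℕ h)))))
           (trans (S.colour (ℕₚ.≤-trans (ℕₚ.<⇒≤ a<b) b≤n)) (trans same (trans (sym (S.colour b≤n))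
           (trans (cong (c ∘ swp (toℕ h)) y) (trans (cong c (swp-right (toℕ h))) p))))))

  abstract
    sort : ∀ c → Sorted c
    sort c = sort′ _ c refl

  private
    pi-parabolic : ∀ (i : Fin n) u → All (_≢ i) u → ∀ k →
      (pi u k <ᵇ suc (toℕ i)) ≡ (k <ᵇ suc (toℕ i))
    pi-parabolic i [] _ k = refl
    pi-parabolic i (h ∷ u) (h≢i All.∷ us) k =
      trans (pi-parabolic i u us (swp (toℕ h) k)) (swp-≡ (toℕ h) k λ e → h≢i (Finₚ.toℕ-injective e))
      where
      swp-≡ : ∀ h k {q} → h ≢ q → (swp h k <ᵇ suc q) ≡ (k <ᵇ suc q)
      swp-≡ zero    zero          {zero}  ne = ⊥-elim (ne refl)
      swp-≡ zero    zero          {suc q} ne = refl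
      swp-≡ zero    (suc zero)    {zero}  ne = ⊥-elim (ne refl)
      swp-≡ zero    (suc zero)    {suc q} ne = refl
      swp-≡ zero    (suc (suc k)) ne = refl
      swp-≡ (suc h) zero          ne = refl
      swp-≡ (suc h) (suc k) {zero}  ne = refl
      swp-≡ (suc h) (suc k) {suc q} ne = swp-≡ h k (ne ∘ cong suc)

    height-pi : ∀ q (x : List (Fin n)) →
      height (suc n) 0 (λ k → pi x k <ᵇ q) ≤ length x ℕ.+ height (suc n) 0 (_<ᵇ q)
    height-pi q []      = ℕₚ.≤-refl
    height-pi q (h ∷ x) = ℕₚ.≤-trans
      (height-swp-≤ (suc n) 0 (toℕ h) (λ k → pi x k <ᵇ q) (s≤s (Finₚ.toℕ<n h))) (s≤s (height-pi q x))

  -- Right multiplication by `u` keeps the colouring `pi x k <ᵇ q`, and each letter of `x` raises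
  -- the height by at most one. So every word in the coset needs at least as many letters as `c` has
  -- inversions.
  sorted⇒minCosetRep : ∀ {c} (S : Sorted c) (i : Fin n) → Sorted.q S ≡ suc (toℕ i) →
    MinCosetRep n i (Sorted.word S)
  sorted⇒minCosetRep {c} S i refl u us x eq = ℕₚ.+-cancelʳ-≤ (height (suc n) 0 (_<ᵇ q)) _ _
    (subst (_≤ length x ℕ.+ height (suc n) 0 (_<ᵇ q))
      (trans (height-cong (suc n) 0 colour-x) (sym len)) (height-pi q x))
    where
    open Sorted S
    colour-x : ∀ {k} → k < suc n → (pi x k <ᵇ q) ≡ c k
    colour-x {k} (s≤s k≤n) =
      trans (cong (_<ᵇ q) (trans (actW-faithful x (word ++ u) eq k≤n) (pi-++ word u k)))
      (trans (pi-parabolic i u us (pi word k))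
      (trans (sym (colour (pi-bounded word k≤n))) (cong c (sg-pi word k))))

increasing⇒id : ∀ {n} (f : ℕ → ℕ) → (∀ {a} → a ≤ n → f a ≤ n) →
  (∀ {a b} → a < b → b ≤ n → f a < f b) → ∀ {a} → a ≤ n → f a ≡ a
increasing⇒id {n} f bd inc {a} a≤n = ℕₚ.≤-antisym (upper (n ℕ.∸ a) a (ℕₚ.m+[n∸m]≡n a≤n)) (lower a a≤n)
  where
  lower : ∀ a → a ≤ n → a ≤ f a
  lower zero    _   = z≤n
  lower (suc a) a<n = ℕₚ.≤-<-trans (lower a (ℕₚ.<⇒≤ a<n)) (inc (ℕₚ.n<1+n a) a<n)
  upper : ∀ d a → a ℕ.+ d ≡ n → f a ≤ a
  upper zero    a eq rewrite ℕₚ.+-identityʳ a | eq = bd ℕₚ.≤-refl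
  upper (suc d) a eq = ℕ.s≤s⁻¹ (ℕₚ.<-≤-trans
    (inc (ℕₚ.n<1+n a) (ℕₚ.m+n≤o⇒m≤o (suc a) (ℕₚ.≤-reflexive (trans (sym (ℕₚ.+-suc a d)) eq))))
    (upper d (suc a) (trans (sym (ℕₚ.+-suc a d)) eq)))

-- Realises the inverse of `v` by a word. After sorting by the colour `v k <ᵇ q`, small values
-- precede large ones and each block stays increasing, so `v ∘ sg w` is an increasing self-map of
-- `[0,n]`, hence the identity.
blockSort : ∀ {n} q (v : ℕ → ℕ) → (∀ {k} → k ≤ n → v k ≤ n) →
  (∀ {j k} → j < k → k ≤ n → (v j <ᵇ q) ≡ (v k <ᵇ q) → v j < v k) →
  ∃[ w ] (∀ {a} → a ≤ n → v (sg {n} w a) ≡ a)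
blockSort {n} q v bd mono-v = word , increasing⇒id (v ∘ sg word) (bd ∘ sg-bounded word) inc
  where
  S = sort {n} (λ k → v k <ᵇ q)
  open Sorted S renaming (q to q′)
  inc : ∀ {a b} → a < b → b ≤ n → v (sg word a) < v (sg word b)
  inc {a} {b} a<b b≤n with v (sg word a) <ᵇ q in ea | v (sg word b) <ᵇ q in eb
  ... | true  | false = ℕₚ.<-≤-trans (<ᵇ≡⇒< (v (sg word a)) q ea) (<ᵇ≡⇒≤ (v (sg word b)) q eb)
  ... | false | true with () ← trans (sym (<⇒<ᵇ≡ (ℕₚ.<-trans a<b (<ᵇ≡⇒< b q′ (trans (sym (colour b≤n)) eb)))))
                       (trans (sym (colour (ℕₚ.≤-trans (ℕₚ.<⇒≤ a<b) b≤n))) ea)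
  inc {a} {b} a<b b≤n | true  | true = mono-v (mono a<b b≤n same) (sg-bounded word b≤n) (trans ea (sym eb))
    where same = trans (sym (colour (ℕₚ.≤-trans (ℕₚ.<⇒≤ a<b) b≤n))) (trans ea (trans (sym eb) (colour b≤n)))
  inc {a} {b} a<b b≤n | false | false = mono-v (mono a<b b≤n same) (sg-bounded word b≤n) (trans ea (sym eb))
    where same = trans (sym (colour (ℕₚ.≤-trans (ℕₚ.<⇒≤ a<b) b≤n))) (trans ea (trans (sym eb) (colour b≤n)))

-- The affine Weyl group on the vectors e_a + iδ

swapEnds : ℕ → ℕ → ℕ
swapEnds n a with a ℕ.≟ n | a ℕ.≟ 0
... | yes _ | _     = 0
... | no _  | yes _ = n
... | no _  | no _  = a

swapEnds-transposition : ∀ {n} → 1 ≤ n → Transposition n 0 (swapEnds n)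
swapEnds-transposition {suc m} _ = transposition (λ ()) left refl other
  where
  left : swapEnds (suc m) (suc m) ≡ 0
  left with suc m ℕ.≟ suc m
  ... | yes _ = refl
  ... | no p  = ⊥-elim (p refl)
  other : ∀ k → k ≢ suc m → k ≢ 0 → swapEnds (suc m) k ≡ k
  other k p q with k ℕ.≟ suc m | k ℕ.≟ 0
  ... | yes e | _     = ⊥-elim (p e)
  ... | no _  | yes e = ⊥-elim (q e)
  ... | no _  | no _  = refl

-- The pair (a , i) stands for e_a + iδ; a pair is larger when the difference is a positive affine root.
infix 4 _≻_
_≻_ : ℕ × ℤ → ℕ × ℤ → Set
(a , i) ≻ (b , j) = j ℤ.< i ⊎ (i ≡ j × a < b)

≻-trans : ∀ {x y z} → x ≻ y → y ≻ z → x ≻ z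
≻-trans (inj₁ p)          (inj₁ q)          = inj₁ (ℤₚ.<-trans q p)
≻-trans (inj₁ p)          (inj₂ (refl , _)) = inj₁ p
≻-trans (inj₂ (refl , _)) (inj₁ q)          = inj₁ q
≻-trans (inj₂ (refl , p)) (inj₂ (refl , q)) = inj₂ (refl , ℕₚ.<-trans p q)

≻-irrefl : ∀ {x} → ¬ (x ≻ x)
≻-irrefl (inj₁ p)       = ℤₚ.<-irrefl refl p
≻-irrefl (inj₂ (_ , p)) = ℕₚ.<-irrefl refl p

≻-cmp : ∀ x y → x ≻ y ⊎ x ≡ y ⊎ y ≻ x
≻-cmp (a , i) (b , j) with ℤₚ.<-cmp i j | ℕₚ.<-cmp a b
... | tri< p _ _ | _ = inj₂ (inj₂ (inj₁ p))
... | tri> _ _ p | _ = inj₁ (inj₁ p)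
... | tri≈ _ refl _ | tri< p _ _ = inj₁ (inj₂ (refl , p))
... | tri≈ _ refl _ | tri≈ _ refl _ = inj₂ (inj₁ refl)
... | tri≈ _ refl _ | tri> _ _ p = inj₂ (inj₂ (inj₂ (refl , p)))

_≻?_ : ∀ x y → Dec (x ≻ y)
x ≻? y with ≻-cmp x y
... | inj₁ p = yes p
... | inj₂ (inj₁ refl) = no ≻-irrefl
... | inj₂ (inj₂ p) = no λ q → ≻-irrefl (≻-trans p q)

≻-suc : ∀ {a i b j} → (a , i) ≻ (b , j) → (a , ℤ.suc i) ≻ (b , ℤ.suc j)
≻-suc (inj₁ p)          = inj₁ (ℤₚ.+-monoʳ-< (+ 1) p)
≻-suc (inj₂ (refl , p)) = inj₂ (refl , p)

private
  <⇒1≤- : ∀ {i j} → j ℤ.< i → + 1 ℤ.≤ i ℤ.- j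
  <⇒1≤- {i} {j} j<i = subst (ℤ._≤ i ℤ.- j) (lem j) (ℤₚ.+-monoˡ-≤ (ℤ.- j) (ℤₚ.i<j⇒suc[i]≤j j<i))
    where
    lem : ∀ j → + 1 ℤ.+ j ℤ.- j ≡ + 1
    lem = solve-∀

  1≤-⇒< : ∀ {i j} → + 1 ℤ.≤ i ℤ.- j → j ℤ.< i
  1≤-⇒< {i} {j} le = ℤₚ.suc[i]≤j⇒i<j (subst (ℤ.suc j ℤ.≤_) (lem i j) (ℤₚ.+-monoˡ-≤ j le))
    where
    lem : ∀ i j → i ℤ.- j ℤ.+ j ≡ i
    lem = solve-∀

  -≡0⇒≡ : ∀ {i j} → i ℤ.- j ≡ + 0 → i ≡ j
  -≡0⇒≡ {i} {j} = ℤₚ.i-j≡0⇒i≡j i j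

module _ {n : ℕ} where

  isAffPos⇒≻ : ∀ {a b i j} → a ≤ n → b ≤ n → isAffPos n (root (suc n) a b , i ℤ.- j) → (a , i) ≻ (b , j)
  isAffPos⇒≻ {a} {b} a≤n b≤n (inj₁ (pos , eq)) with isPos⇒PosRoot pos
  ... | c , d , c<d , d≤n , e
    with refl , refl ← r-injective (s≤s a≤n) (s≤s b≤n) (s≤s (ℕₚ.≤-trans (ℕₚ.<⇒≤ c<d) d≤n)) (s≤s d≤n) (ℕₚ.<⇒≢ c<d) e
    = inj₂ (-≡0⇒≡ eq , c<d)
  isAffPos⇒≻ a≤n b≤n (inj₂ (_ , le)) = inj₁ (1≤-⇒< le)

  ≻⇒isAffPos : ∀ {a b i j} → a ≤ n → b ≤ n → a ≢ b → (a , i) ≻ (b , j) →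
    isAffPos n (root (suc n) a b , i ℤ.- j)
  ≻⇒isAffPos a≤n b≤n a≢b (inj₁ p) = inj₂ (r-isRoot a≢b a≤n b≤n , <⇒1≤- p)
  ≻⇒isAffPos {i = i} a≤n b≤n a≢b (inj₂ (refl , a<b)) = inj₁ (r-isPos a<b b≤n , ℤₚ.+-inverseʳ i)

  ê : ℕ → ℤ → V̂ n
  ê a i = eN (suc n) a , i

  σ̂ : Fin (suc n) → ℕ → ℕ
  σ̂ Fin.zero    = swapEnds n
  σ̂ (Fin.suc h) = swp (toℕ h)

  -- As `α_0 = e_n - e_0 + δ`, its reflection sends `e_0` to `e_n + δ` and `e_n` to `e_0 - δ`.
  ε̂ : Fin (suc n) → ℕ → ℤ
  ε̂ Fin.zero    c = δ c 0 ℤ.- δ c n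
  ε̂ (Fin.suc h) c = + 0

  τ : List (Fin (suc n)) → ℕ → ℕ
  τ []      a = a
  τ (h ∷ v) a = σ̂ h (τ v a)

  d : List (Fin (suc n)) → ℕ → ℤ
  d []      a = + 0
  d (h ∷ v) a = d v a ℤ.+ ε̂ h (τ v a)

  reflV-minus : ∀ β x y → reflV n β (_⊖̂_ n x y) ≡ _⊖̂_ n (reflV n β x) (reflV n β y)
  reflV-minus (β , t) (x , i) (y , j) = cong₂ _,_
    (co-ext λ k _ → trans (co-minus (x -v y) (Vec.map (dot (x -v y) β ℤ.*_) β) k)
      (trans (cong₂ ℤ._-_ (co-minus x y k) (trans (co-scale (dot (x -v y) β) β k)
               (cong (ℤ._* co β k) (dot-minusˡ x y β))))
      (trans (lem (co x k) (co y k) (co β k) (dot x β) (dot y β))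
      (sym (trans (co-minus (x -v Vec.map (dot x β ℤ.*_) β) (y -v Vec.map (dot y β ℤ.*_) β) k)
        (cong₂ ℤ._-_ (co′ x) (co′ y)))))))
    (trans (cong (λ z → i ℤ.- j ℤ.- z ℤ.* t) (dot-minusˡ x y β)) (lem i j t (dot x β) (dot y β)))
    where
    lem : ∀ x y b p q → x ℤ.- y ℤ.- (p ℤ.- q) ℤ.* b ≡ x ℤ.- p ℤ.* b ℤ.- (y ℤ.- q ℤ.* b)
    lem = solve-∀
    co′ : ∀ x {k} → co (x -v Vec.map (dot x β ℤ.*_) β) k ≡ co x k ℤ.- dot x β ℤ.* co β k
    co′ x {k} = trans (co-minus x (Vec.map (dot x β ℤ.*_) β) k)
                      (cong (ℤ._-_ (co x k)) (co-scale (dot x β) β k))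

  actŴ-minus : ∀ v x y → actŴ n v (_⊖̂_ n x y) ≡ _⊖̂_ n (actŴ n v x) (actŴ n v y)
  actŴ-minus []      x y = refl
  actŴ-minus (h ∷ v) x y = trans (cong (reflV n (α̂ n h)) (actŴ-minus v x y))
                                 (reflV-minus (α̂ n h) (actŴ n v x) (actŴ n v y))

module _ {n : ℕ} (1≤n : 1 ≤ n) where

  σ̂-involutive : ∀ h a → σ̂ {n} h (σ̂ h a) ≡ a
  σ̂-involutive Fin.zero    = Transposition.involutive (swapEnds-transposition 1≤n)
  σ̂-involutive (Fin.suc h) = swp-involutive (toℕ h)

  σ̂-bounded : ∀ h {a} → a ≤ n → σ̂ {n} h a ≤ n
  σ̂-bounded Fin.zero    = Transposition.bounded (swapEnds-transposition 1≤n) ℕₚ.≤-refl z≤n _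
  σ̂-bounded (Fin.suc h) = swp-bounded (Finₚ.toℕ<n h)

  τ-bounded : ∀ v {a} → a ≤ n → τ {n} v a ≤ n
  τ-bounded []      a≤n = a≤n
  τ-bounded (h ∷ v) a≤n = σ̂-bounded h (τ-bounded v a≤n)

  τ-injective : ∀ v {a b} → τ {n} v a ≡ τ v b → a ≡ b
  τ-injective []      eq = eq
  τ-injective (h ∷ v) eq = τ-injective v
    (trans (sym (σ̂-involutive h _)) (trans (cong (σ̂ h) eq) (σ̂-involutive h _)))

  reflV-ê : ∀ h {c} i → c ≤ n → reflV n (α̂ n h) (ê c i) ≡ ê (σ̂ h c) (i ℤ.+ ε̂ h c)
  reflV-ê Fin.zero {c} i c≤n =
    trans (cong (λ β → reflV n (β , + 1) (ê c i)) (trans (cong negv (θ≡r n)) (neg-r (suc n) 0 n)))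
    (cong₂ _,_ (Transposition.reflection-eN (swapEnds-transposition 1≤n) ℕₚ.≤-refl (s≤s z≤n) (s≤s c≤n))
      (trans (cong (λ z → i ℤ.- z ℤ.* + 1) (trans (dot-r (eN (suc n) c) n 0)
        (cong₂ ℤ._-_ (co-eN (s≤s c≤n) n) (co-eN (s≤s c≤n) 0)))) (lem i (δ c n) (δ c 0))))
    where
    lem : ∀ i x y → i ℤ.- (x ℤ.- y) ℤ.* + 1 ≡ i ℤ.+ (y ℤ.- x)
    lem = solve-∀
  reflV-ê (Fin.suc h) {c} i c≤n =
    trans (cong (λ β → reflV n (β , + 0) (ê c i)) (α≡r n h))
    (cong₂ _,_ (Transposition.reflection-eN (swp-transposition (toℕ h))
        (s≤s (ℕₚ.<⇒≤ (Finₚ.toℕ<n h))) (s≤s (Finₚ.toℕ<n h)) (s≤s c≤n))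
      (cong (ℤ._-_ i) (ℤₚ.*-zeroʳ (dot (eN (suc n) c) (root (suc n) (toℕ h) (suc (toℕ h)))))))

  actŴ-ê : ∀ v {a} i → a ≤ n → actŴ n v (ê a i) ≡ ê (τ v a) (i ℤ.+ d v a)
  actŴ-ê []      {a} i a≤n = cong (ê a) (sym (ℤₚ.+-identityʳ i))
  actŴ-ê (h ∷ v) {a} i a≤n = trans (cong (reflV n (α̂ n h)) (actŴ-ê v i a≤n))
    (trans (reflV-ê h (i ℤ.+ d v a) (τ-bounded v a≤n))
           (cong (ê (τ (h ∷ v) a)) (ℤₚ.+-assoc i (d v a) (ε̂ h (τ v a)))))

  actŴ-r : ∀ v {a b} i j → a ≤ n → b ≤ n → actŴ n v (root (suc n) a b , i ℤ.- j) ≡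
    (root (suc n) (τ v a) (τ v b) , (i ℤ.+ d v a) ℤ.- (j ℤ.+ d v b))
  actŴ-r v {a} {b} i j a≤n b≤n = trans (actŴ-minus v (ê a i) (ê b j))
    (cong₂ (_⊖̂_ n) (actŴ-ê v i a≤n) (actŴ-ê v j b≤n))

  ⊝̂-r : ∀ a b i j → ⊝̂_ n (root (suc n) a b , i ℤ.- j) ≡ (root (suc n) b a , j ℤ.- i)
  ⊝̂-r a b i j = cong₂ _,_ (neg-r (suc n) a b) (lem i j)
    where
    lem : ∀ x y → ℤ.- (x ℤ.- y) ≡ y ℤ.- x
    lem = solve-∀

  -- The root is the difference of `e_a + iδ` and `e_b + jδ`. Thus roots made negative by `v` become
  -- statements about the order of two images.
  negative⇒≻ : ∀ v {a b} i j → a ≤ n → b ≤ n →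
    isAffPos n (⊝̂_ n (actŴ n v (root (suc n) a b , i ℤ.- j))) →
    (τ v b , j ℤ.+ d v b) ≻ (τ v a , i ℤ.+ d v a)
  negative⇒≻ v {a} {b} i j a≤n b≤n pos = isAffPos⇒≻ (τ-bounded v b≤n) (τ-bounded v a≤n)
    (subst (isAffPos n) (trans (cong (⊝̂_ n) (actŴ-r v i j a≤n b≤n))
      (⊝̂-r (τ v a) (τ v b) (i ℤ.+ d v a) (j ℤ.+ d v b))) pos)

  ≻⇒negative : ∀ v {a b} i j → a ≤ n → b ≤ n → a ≢ b →
    (τ v b , j ℤ.+ d v b) ≻ (τ v a , i ℤ.+ d v a) →
    isAffPos n (⊝̂_ n (actŴ n v (root (suc n) a b , i ℤ.- j)))
  ≻⇒negative v {a} {b} i j a≤n b≤n a≢b gt = subst (isAffPos n)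
    (sym (trans (cong (⊝̂_ n) (actŴ-r v i j a≤n b≤n))
      (⊝̂-r (τ v a) (τ v b) (i ℤ.+ d v a) (j ℤ.+ d v b))))
    (≻⇒isAffPos (τ-bounded v b≤n) (τ-bounded v a≤n) (a≢b ∘ sym ∘ τ-injective v) gt)

sumF : ℕ → (ℕ → ℤ) → ℤ
sumF zero    f = + 0
sumF (suc m) f = f 0 ℤ.+ sumF m (f ∘ suc)

sumF-cong : ∀ m {f g} → (∀ {a} → a < m → f a ≡ g a) → sumF m f ≡ sumF m g
sumF-cong zero    h = refl
sumF-cong (suc m) h = cong₂ ℤ._+_ (h (s≤s z≤n)) (sumF-cong m (h ∘ s≤s))

sumF-threshold : ∀ m q K → q ≤ m → sumF m (λ a → K ℤ.+ ι (a <ᵇ q)) ≡ + m ℤ.* K ℤ.+ + q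
sumF-threshold zero    zero    K _ = sym (trans (ℤₚ.+-identityʳ _) (ℤₚ.*-zeroˡ K))
sumF-threshold (suc m) zero    K _ = trans (cong (ℤ._+_ (K ℤ.+ + 0)) (sumF-threshold m 0 K z≤n))
  (lem K (+ m))
  where
  lem : ∀ K m → K ℤ.+ + 0 ℤ.+ (m ℤ.* K ℤ.+ + 0) ≡ (+ 1 ℤ.+ m) ℤ.* K ℤ.+ + 0
  lem = solve-∀
sumF-threshold (suc m) (suc q) K (s≤s q≤m) =
  trans (cong (ℤ._+_ (K ℤ.+ + 1)) (sumF-threshold m q K q≤m)) (lem K (+ m) (+ q))
  where
  lem : ∀ K m q → K ℤ.+ + 1 ℤ.+ (m ℤ.* K ℤ.+ q) ≡ (+ 1 ℤ.+ m) ℤ.* K ℤ.+ (+ 1 ℤ.+ q)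
  lem = solve-∀

-- Linearity in the form that `actŴ-minus` delivers: subtractivity gives `φ [] = 0` and lets the
-- basis vectors be peeled off one at a time.
sum-basis : ∀ m (φ : Vec ℤ m → ℤ) → (∀ u v → φ (u -v v) ≡ φ u ℤ.- φ v) →
  φ (replicate m (+ 1)) ≡ sumF m (φ ∘ eN m)
sum-basis zero φ sub = trans (sub [] []) (ℤₚ.+-inverseʳ (φ []))
sum-basis (suc m) φ sub = trans (lem (φ (replicate (suc m) (+ 1))) (φ (eN (suc m) 0)))
  (cong (ℤ._+_ (φ (eN (suc m) 0)))
    (trans (sym (trans (cong φ (sym peel)) (sub (replicate (suc m) (+ 1)) (eN (suc m) 0))))
      (sum-basis m (φ ∘ (+ 0 ∷_)) (λ u v → sub (+ 0 ∷ u) (+ 0 ∷ v)))))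
  where
  lem : ∀ x y → x ≡ y ℤ.+ (x ℤ.- y)
  lem = solve-∀
  ones-zeros : ∀ m → replicate m (+ 1) -v replicate m (+ 0) ≡ replicate m (+ 1)
  ones-zeros zero    = refl
  ones-zeros (suc m) = cong (+ 1 ∷_) (ones-zeros m)
  peel : replicate (suc m) (+ 1) -v eN (suc m) 0 ≡ + 0 ∷ replicate m (+ 1)
  peel = cong (+ 0 ∷_) (ones-zeros m)

private
  co-ones : ∀ m {k} → k < m → co (replicate m (+ 1)) k ≡ + 1
  co-ones (suc m) {zero}  _ = refl
  co-ones (suc m) {suc k} (s≤s lt) = co-ones m lt

  psum-ones : ∀ m k → k ≤ m → psum k (replicate m (+ 1)) ≡ + k
  psum-ones zero    zero    _ = refl
  psum-ones (suc m) zero    _ = refl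
  psum-ones (suc m) (suc k) (s≤s le) = cong (ℤ._+_ (+ 1)) (psum-ones m k le)

module _ {n : ℕ} (1≤n : 1 ≤ n) where

  private
    ones : V̂ n
    ones = replicate (suc n) (+ 1) , + 0

    reflV-orthogonal : ∀ {a b} t → a ≤ n → b ≤ n → reflV n (root (suc n) a b , t) ones ≡ ones
    reflV-orthogonal {a} {b} t a≤n b≤n = cong₂ _,_
      (co-ext λ k _ → trans (co-minus 𝟏 (Vec.map (dot 𝟏 β ℤ.*_) β) k)
        (trans (cong (ℤ._-_ (co 𝟏 k)) (trans (co-scale (dot 𝟏 β) β k) (cong (ℤ._* co β k) dot≡0)))
          (ℤₚ.+-identityʳ _)))
      (cong (λ z → + 0 ℤ.- z ℤ.* t) dot≡0)
      where
      β = root (suc n) a b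
      𝟏 = replicate (suc n) (+ 1)
      dot≡0 : dot 𝟏 β ≡ + 0
      dot≡0 = trans (dot-r 𝟏 a b) (cong₂ ℤ._-_ (co-ones (suc n) (s≤s a≤n)) (co-ones (suc n) (s≤s b≤n)))

    actŴ-ones : ∀ v → actŴ n v ones ≡ ones
    actŴ-ones [] = refl
    actŴ-ones (Fin.zero ∷ v) = trans (cong (reflV n (α̂ n Fin.zero)) (actŴ-ones v))
      (trans (cong (λ β → reflV n (β , + 1) ones) (trans (cong negv (θ≡r n)) (neg-r (suc n) 0 n)))
        (reflV-orthogonal (+ 1) ℕₚ.≤-refl z≤n))
    actŴ-ones (Fin.suc h ∷ v) = trans (cong (reflV n (α̂ n (Fin.suc h))) (actŴ-ones v))
      (trans (cong (λ β → reflV n (β , + 0) ones) (α≡r n h))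
        (reflV-orthogonal (+ 0) (ℕₚ.<⇒≤ (Finₚ.toℕ<n h)) (Finₚ.toℕ<n h)))

  -- The affine Weyl group fixes the all-ones vector; apply the functional (y , i) ↦ i + Σ_{k<q} y_k to
  -- its expansion in the basis vectors.
  balance : ∀ v q → q ≤ suc n → sumF (suc n) (λ a → d {n} v a ℤ.+ ι (τ {n} v a <ᵇ q)) ≡ + q
  balance v q q≤ = trans (sumF-cong (suc n) (sym ∘ φ-eN))
    (trans (sym (sum-basis (suc n) φ φ-minus))
    (trans (cong Λ (actŴ-ones v)) (trans (ℤₚ.+-identityˡ _) (psum-ones (suc n) q q≤))))
    where
    Λ : V̂ n → ℤ
    Λ (y , i) = i ℤ.+ psum q y
    φ : Vec ℤ (suc n) → ℤ
    φ x = Λ (actŴ n v (x , + 0))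
    φ-minus : ∀ x y → φ (x -v y) ≡ φ x ℤ.- φ y
    φ-minus x y = trans (cong Λ (actŴ-minus v (x , + 0) (y , + 0)))
      (trans (cong (ℤ._+_ (i ℤ.- j)) (psum-minus q x′ y′)) (lem i j (psum q x′) (psum q y′)))
      where
      x′ = proj₁ (actŴ n v (x , + 0))
      y′ = proj₁ (actŴ n v (y , + 0))
      i = proj₂ (actŴ n v (x , + 0))
      j = proj₂ (actŴ n v (y , + 0))
      lem : ∀ i j x y → i ℤ.- j ℤ.+ (x ℤ.- y) ≡ i ℤ.+ x ℤ.- (j ℤ.+ y)
      lem = solve-∀
    φ-eN : ∀ {a} → a < suc n → φ (eN (suc n) a) ≡ d v a ℤ.+ ι (τ v a <ᵇ q)
    φ-eN {a} (s≤s a≤n) = trans (cong Λ (actŴ-ê 1≤n v (+ 0) a≤n))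
      (cong₂ ℤ._+_ (ℤₚ.+-identityˡ (d v a)) (psum-eN (s≤s (τ-bounded 1≤n v a≤n)) q))

-- Ideals in 𝓘_ab(α_p)

-- The shape of the ideals in 𝓘_ab(α_p), when e_a - e_b is drawn as the cell in row a and column b.
record Staircase (n : ℕ) (I : Pred (E n) 0ℓ) (p : ℕ) : Set where
  field
    p<n       : p < n
    positive  : ∀ {β} → I β → PosRoot n β
    member?   : ∀ {a b} → a < b → b ≤ n → Dec (I (root (suc n) a b))
    upward    : ∀ {a b a′ b′} → a < b → b ≤ n → I (root (suc n) a b) → a′ ≤ a → b ≤ b′ → b′ ≤ n →
                I (root (suc n) a′ b′)
    row≤p     : ∀ {a b} → a < b → b ≤ n → I (root (suc n) a b) → a ≤ p
    p<column  : ∀ {a b} → a < b → b ≤ n → I (root (suc n) a b) → p < b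
    lastColumn : ∀ {a} → a ≤ p → I (root (suc n) a n)
    firstRow   : ∀ {b} → p < b → b ≤ n → I (root (suc n) 0 b)

private
  -- Uniqueness of division with remainder: `q` and `p + 1` both lie in `[0,n]`, which forces
  -- `K = 0`.
  balance-solution : ∀ n K q p → q ≤ n → p < n → + suc n ℤ.* K ℤ.+ + q ≡ + suc p → q ≡ suc p
  balance-solution n (+ zero) q p _ _ eq =
    ℤₚ.+-injective (trans (sym (trans (cong (ℤ._+ + q) (ℤₚ.*-zeroʳ (+ suc n))) (ℤₚ.+-identityˡ _))) eq)
  balance-solution n (+ suc k) q p _ p<n eq = ⊥-elim (ℕₚ.<⇒≱ (s≤s p<n)
    (ℕₚ.≤-trans (ℕₚ.≤-trans (ℕₚ.m≤m*n (suc n) (suc k)) (ℕₚ.m≤m+n (suc n ℕ.* suc k) q))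
      (ℕₚ.≤-reflexive (ℤₚ.+-injective (trans (cong (ℤ._+ + q) (ℤₚ.pos-* (suc n) (suc k))) eq)))))
  balance-solution n -[1+ k ] q p q≤n _ eq = ⊥-elim (ℕₚ.<⇒≱ (s≤s q≤n)
    (ℕₚ.≤-trans (ℕₚ.≤-trans (ℕₚ.m≤m*n (suc n) (suc k)) (ℕₚ.m≤n+m (suc n ℕ.* suc k) (suc p)))
      (ℕₚ.≤-reflexive (ℤₚ.+-injective (sym (trans (lem (+ suc n) (+ suc k) (+ q))
        (cong₂ ℤ._+_ eq (sym (ℤₚ.pos-* (suc n) (suc k))))))))))
    where
    lem : ∀ N k q → q ≡ N ℤ.* (ℤ.- k) ℤ.+ q ℤ.+ N ℤ.* k
    lem = solve-∀

  <-suc⇒≤ : ∀ {i j} → i ℤ.< ℤ.suc j → i ℤ.≤ j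
  <-suc⇒≤ {i} {j} lt = subst₂ ℤ._≤_ (lem i) (lem j) (ℤₚ.+-monoʳ-≤ -[1+ 0 ] (ℤₚ.i<j⇒suc[i]≤j lt))
    where
    lem : ∀ i → -[1+ 0 ] ℤ.+ (+ 1 ℤ.+ i) ≡ i
    lem = solve-∀

  suc≢ : ∀ {i} → i ≢ ℤ.suc i
  suc≢ {i} eq = ℤₚ.<-irrefl eq (ℤₚ.suc[i]≤j⇒i<j ℤₚ.≤-refl)

module _ {n : ℕ} (1≤n : 1 ≤ n) {I : Pred (E n) 0ℓ} {i : Fin n} (iab : Iab n I (α n i)) where

  private
    p : ℕ
    p = toℕ i
    p<n : p < n
    p<n = Finₚ.toℕ<n i

    positive : ∀ {β} → I β → PosRoot n β
    positive Iβ = isPos⇒PosRoot (proj₁ (proj₁ iab) _ Iβ)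

    w v : List (Fin (suc n))
    w = proj₁ (proj₂ iab)
    v = reverse w

    N⇒δ−I : ∀ {γ} → N n w γ → δminus n I γ
    N⇒δ−I = proj₁ (proj₁ (proj₂ (proj₂ iab)))
    δ−I⇒N : ∀ {γ} → δminus n I γ → N n w γ
    δ−I⇒N = proj₂ (proj₁ (proj₂ (proj₂ iab)))

    X : ℕ → ℕ × ℤ
    X a = τ v a , d v a
    X+δ : ℕ → ℕ × ℤ
    X+δ a = τ v a , ℤ.suc (d v a)

    X-cmp : ∀ {a b} → a ≢ b → ∀ i j → (τ v a , i) ≻ (τ v b , j) ⊎ (τ v b , j) ≻ (τ v a , i)
    X-cmp {a} {b} a≢b i j with ≻-cmp (τ v a , i) (τ v b , j)
    ... | inj₁ gt = inj₁ gt
    ... | inj₂ (inj₁ eq) = ⊥-elim (a≢b (τ-injective 1≤n v (cong proj₁ eq)))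
    ... | inj₂ (inj₂ lt) = inj₂ lt

    -- Otherwise the finite root `e_a - e_b` would lie in `N w`, whose members all have
    -- `δ`-coefficient 1.
    X-decreasing : ∀ {a b} → a < b → b ≤ n → X a ≻ X b
    X-decreasing {a} {b} a<b b≤n with X-cmp (ℕₚ.<⇒≢ a<b) (d v a) (d v b)
    ... | inj₁ gt = gt
    ... | inj₂ lt with N⇒δ−I {γ = (root (suc n) a b , + 0)} (≻⇒isAffPos {i = + 0} {j = + 0} a≤n b≤n a≢b (inj₂ (refl , a<b)) ,
                    ≻⇒negative 1≤n v (+ 0) (+ 0) a≤n b≤n a≢b
                      (subst₂ (λ x y → (τ v b , x) ≻ (τ v a , y))
                         (sym (ℤₚ.+-identityˡ _)) (sym (ℤₚ.+-identityˡ _)) lt))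
      where
      a≤n = ℕₚ.≤-trans (ℕₚ.<⇒≤ a<b) b≤n
      a≢b = ℕₚ.<⇒≢ a<b
    ... | _ , _ , eq with () ← cong proj₂ eq

    I⇒≻ : ∀ {a b} → a < b → b ≤ n → I (root (suc n) a b) → X a ≻ X+δ b
    I⇒≻ {a} {b} a<b b≤n Iab′ = subst (λ x → (τ v a , x) ≻ X+δ b) (ℤₚ.+-identityˡ _)
      (negative⇒≻ 1≤n v (+ 1) (+ 0) b≤n (ℕₚ.≤-trans (ℕₚ.<⇒≤ a<b) b≤n)
        (subst (λ γ → isAffPos n (⊝̂_ n (actŴ n v (γ , + 1)))) (neg-r (suc n) a b)
          (proj₂ (δ−I⇒N (root (suc n) a b , Iab′ , refl)))))

    negv-injective : ∀ {u u′ : Vec ℤ (suc n)} → negv u ≡ negv u′ → u ≡ u′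
    negv-injective {u} {u′} eq = co-ext λ k _ →
      ℤₚ.neg-injective (trans (sym (co-neg u k)) (trans (cong (λ v → co v k) eq) (co-neg u′ k)))

    ≻⇒I : ∀ {a b} → a < b → b ≤ n → X a ≻ X+δ b → I (root (suc n) a b)
    ≻⇒I {a} {b} a<b b≤n gt with N⇒δ−I {γ = (root (suc n) b a , + 1)}
      ( ≻⇒isAffPos {i = + 1} {j = + 0} b≤n a≤n b≢a (inj₁ (ℤ.+<+ (s≤s z≤n)))
      , ≻⇒negative 1≤n v (+ 1) (+ 0) b≤n a≤n b≢a
          (subst (λ x → (τ v a , x) ≻ X+δ b) (sym (ℤₚ.+-identityˡ _)) gt))
      where
      a≤n = ℕₚ.≤-trans (ℕₚ.<⇒≤ a<b) b≤n
      b≢a = ℕₚ.>⇒≢ a<b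
    ... | β , Iβ , eq = subst I (negv-injective (trans (sym (cong proj₁ eq)) (sym (neg-r (suc n) a b)))) Iβ

    -- Write `-θ + 2δ` as `(e_n + 2δ) - e_0` and compare its image with `α_p = e_p - e_{p+1}`.
    endpoints : (τ v n ≡ p × τ v 0 ≡ suc p) × d v 0 ≡ ℤ.suc (ℤ.suc (d v n))
    endpoints = r-injective (s≤s (τ-bounded 1≤n v ℕₚ.≤-refl)) (s≤s (τ-bounded 1≤n v z≤n))
        (s≤s (ℕₚ.<⇒≤ p<n)) (s≤s p<n) (ℕₚ.<⇒≢ (ℕₚ.n<1+n p)) (trans (cong proj₁ eq) (α≡r n i))
      , sym (trans (lem (d v n)) (trans (ℤₚ.i-j≡0⇒i≡j _ _ (cong proj₂ eq)) (ℤₚ.+-identityˡ _)))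
      where
      lem : ∀ x → + 1 ℤ.+ (+ 1 ℤ.+ x) ≡ + 2 ℤ.+ x
      lem = solve-∀
      eq : (root (suc n) (τ v n) (τ v 0) , (+ 2 ℤ.+ d v n) ℤ.- (+ 0 ℤ.+ d v 0)) ≡ (α n i , + 0)
      eq = trans (sym (actŴ-r 1≤n v (+ 2) (+ 0) ℕₚ.≤-refl z≤n))
        (trans (cong (λ β → actŴ n v (β , + 2)) (sym (trans (cong negv (θ≡r n)) (neg-r (suc n) 0 n))))
               (proj₂ (proj₂ (proj₂ iab))))

    dₙ : ℤ
    dₙ = d v n

    Xn : X n ≡ (p , dₙ)
    Xn = cong (_, dₙ) (proj₁ (proj₁ endpoints))
    X0 : X 0 ≡ (suc p , ℤ.suc (ℤ.suc dₙ))
    X0 = cong₂ _,_ (proj₂ (proj₁ endpoints)) (proj₂ endpoints)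

    high? : ∀ a → Dec (X a ≻ X+δ n)
    high? a = X a ≻? X+δ n

    -- X 0 is covered by X n + 2δ in the order ≻.
    low⇒firstRow : ∀ {b} → b ≤ n → b ≢ 0 → ¬ (X b ≻ X+δ n) → X 0 ≻ X+δ b
    low⇒firstRow {b} b≤n b≢0 low = subst (_≻ X+δ b) (sym X0) step
      where
      below : (p , ℤ.suc dₙ) ≻ X b
      below with b ℕ.≟ n
      ... | yes refl = subst ((p , ℤ.suc dₙ) ≻_) (sym Xn) (inj₁ (ℤₚ.suc[i]≤j⇒i<j ℤₚ.≤-refl))
      ... | no b≢n with X-cmp b≢n (d v b) (ℤ.suc dₙ)
      ... | inj₁ gt = ⊥-elim (low gt)
      ... | inj₂ lt = subst (λ x → (x , ℤ.suc dₙ) ≻ X b) (proj₁ (proj₁ endpoints)) lt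
      step : (suc p , ℤ.suc (ℤ.suc dₙ)) ≻ X+δ b
      step with ≻-suc below
      ... | inj₁ lt = inj₁ lt
      ... | inj₂ (eq , p<τ) = inj₂ (eq , ℕₚ.≤∧≢⇒< p<τ
               λ e → b≢0 (τ-injective 1≤n v (trans (sym e) (sym (proj₂ (proj₁ endpoints))))))

    high⇒¬firstRow : ∀ {b} → X b ≻ X+δ n → ¬ (X 0 ≻ X+δ b)
    high⇒¬firstRow hb gt = ≻-irrefl (≻-trans
      (subst ((p , ℤ.suc (ℤ.suc dₙ)) ≻_) (sym X0) (inj₂ (refl , ℕₚ.n<1+n p)))
      (≻-trans gt (subst (λ x → X+δ _ ≻ (x , ℤ.suc (ℤ.suc dₙ))) (proj₁ (proj₁ endpoints)) (≻-suc hb))))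

    0-high : X 0 ≻ X+δ n
    0-high = subst (_≻ X+δ n) (sym X0) (inj₁ (ℤₚ.suc[i]≤j⇒i<j ℤₚ.≤-refl))

    n-low : ¬ (X n ≻ X+δ n)
    n-low (inj₁ lt)       = ℤₚ.<-asym lt (ℤₚ.suc[i]≤j⇒i<j ℤₚ.≤-refl)
    n-low (inj₂ (eq , _)) = suc≢ eq

    X≼X0 : ∀ {a} → a ≤ n → a ≡ 0 ⊎ X 0 ≻ X a
    X≼X0 {zero}  _   = inj₁ refl
    X≼X0 {suc a} a<n = inj₂ (X-decreasing (s≤s z≤n) a<n)

    -- The left side numbers the `δ`-windows that begin at the vectors `e_p + iδ`, one of which is
    -- `X n`. A high `X a` is squeezed between `X n + δ` and `X 0`, which is covered by `X n + 2δ`,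
    -- so its window is determined; `low-shift` treats the window that starts at `X n` itself.
    high-shift : ∀ {a} → a ≤ n → X a ≻ X+δ n → d v a ℤ.+ ι (τ v a <ᵇ suc p) ≡ ℤ.suc dₙ ℤ.+ + 1
    high-shift {a} a≤n high with subst (λ x → X a ≻ (x , ℤ.suc dₙ)) (proj₁ (proj₁ endpoints)) high | X≼X0 a≤n
    ... | _ | inj₁ refl rewrite proj₂ (proj₁ endpoints) | ≤⇒<ᵇ≡ {suc p} {suc p} ℕₚ.≤-refl =
      trans (ℤₚ.+-identityʳ _) (trans (proj₂ endpoints) (ℤₚ.+-comm (+ 1) (ℤ.suc dₙ)))
    ... | h | inj₂ gt with subst (_≻ X a) X0 gt
    ... | inj₂ (eq , p<τ) rewrite ≤⇒<ᵇ≡ {τ v a} {suc p} (ℕₚ.<⇒≤ p<τ) =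
      trans (ℤₚ.+-identityʳ _) (trans (sym eq) (ℤₚ.+-comm (+ 1) (ℤ.suc dₙ)))
    ... | inj₁ lt with h
    ... | inj₁ lt′ = ⊥-elim (ℤₚ.<-irrefl refl (ℤₚ.<-≤-trans lt′ (<-suc⇒≤ lt)))
    ... | inj₂ (eq , τ<p) rewrite <⇒<ᵇ≡ {τ v a} {suc p} (ℕₚ.m≤n⇒m≤1+n τ<p) = cong (ℤ._+ + 1) eq

    low-shift : ∀ {a} → a ≤ n → ¬ (X a ≻ X+δ n) → d v a ℤ.+ ι (τ v a <ᵇ suc p) ≡ ℤ.suc dₙ ℤ.+ + 0
    low-shift {a} a≤n low with a ℕ.≟ n
    ... | yes refl rewrite proj₁ (proj₁ endpoints) | <⇒<ᵇ≡ {p} {suc p} ℕₚ.≤-refl =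
      trans (ℤₚ.+-comm dₙ (+ 1)) (sym (ℤₚ.+-identityʳ _))
    ... | no a≢n with X-cmp a≢n (d v a) (ℤ.suc dₙ)
    ... | inj₁ gt = ⊥-elim (low gt)
    ... | inj₂ lt with subst (λ x → (x , ℤ.suc dₙ) ≻ X a) (proj₁ (proj₁ endpoints)) lt
                     | subst (X a ≻_) Xn (X-decreasing (ℕₚ.≤∧≢⇒< a≤n a≢n) ℕₚ.≤-refl)
    ... | inj₂ (eq , p<τ) | _ rewrite ≤⇒<ᵇ≡ {τ v a} {suc p} p<τ = cong (ℤ._+ + 0) (sym eq)
    ... | inj₁ lt₁ | inj₁ lt₂ = ⊥-elim (ℤₚ.<-irrefl refl (ℤₚ.<-≤-trans lt₂ (<-suc⇒≤ lt₁)))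
    ... | inj₁ _ | inj₂ (eq , τ<p) rewrite <⇒<ᵇ≡ {τ v a} {suc p} (ℕₚ.m≤n⇒m≤1+n τ<p) =
      trans (cong (ℤ._+ + 1) eq) (trans (ℤₚ.+-comm dₙ (+ 1)) (sym (ℤₚ.+-identityʳ _)))

    isHigh : ℕ → Bool
    isHigh a = does (high? a)

    isHigh-down : ∀ k → suc k < suc n → isHigh (suc k) ≡ true → isHigh k ≡ true
    isHigh-down k (s≤s k<n) eq with high? (suc k) | high? k
    ... | _     | yes _  = refl
    ... | yes h | no low = ⊥-elim (low (≻-trans (X-decreasing (ℕₚ.n<1+n k) k<n) h))

    threshold : ∃[ q ] (q ≤ suc n × (∀ {k} → k < suc n → isHigh k ≡ (k <ᵇ q)))
    threshold = downClosed⇒threshold (suc n) isHigh isHigh-down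

    q : ℕ
    q = proj₁ threshold

    shift : ∀ {a} → a < suc n → d v a ℤ.+ ι (τ v a <ᵇ suc p) ≡ ℤ.suc dₙ ℤ.+ ι (a <ᵇ q)
    shift {a} (s≤s a≤n) = trans step (cong (λ b → ℤ.suc dₙ ℤ.+ ι b) (proj₂ (proj₂ threshold) (s≤s a≤n)))
      where
      step : d v a ℤ.+ ι (τ v a <ᵇ suc p) ≡ ℤ.suc dₙ ℤ.+ ι (isHigh a)
      step with high? a
      ... | yes h = high-shift a≤n h
      ... | no l  = low-shift a≤n l

    isHigh-n : isHigh n ≡ false
    isHigh-n with high? n
    ... | yes h = ⊥-elim (n-low h)
    ... | no _  = refl

    q≡ : q ≡ suc p
    -- Summing `shift` over all indices gives `(n + 1)(dₙ + 1) + q`, while `balance` evaluates the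
    -- same sum to `p + 1`.
    q≡ = balance-solution n (ℤ.suc dₙ) q p
      (<ᵇ≡⇒≤ n q (trans (sym (proj₂ (proj₂ threshold) (ℕₚ.n<1+n n))) isHigh-n)) p<n
      (trans (sym (sumF-threshold (suc n) q (ℤ.suc dₙ) (proj₁ (proj₂ threshold))))
      (trans (sym (sumF-cong (suc n) shift)) (balance 1≤n v (suc p) (s≤s (ℕₚ.<⇒≤ p<n)))))

    high⇔≤p : ∀ {a} → a ≤ n → isHigh a ≡ (a <ᵇ suc p)
    high⇔≤p a≤n = trans (proj₂ (proj₂ threshold) (s≤s a≤n)) (cong (_ <ᵇ_) q≡)

    ≤p⇒high : ∀ {a} → a ≤ p → X a ≻ X+δ n
    ≤p⇒high {a} a≤p with high? a | high⇔≤p {a} (ℕₚ.≤-trans a≤p (ℕₚ.<⇒≤ p<n))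
    ... | yes h | _ = h
    ... | no _  | eq with () ← trans eq (<⇒<ᵇ≡ (s≤s a≤p))

    high⇒≤p : ∀ {a} → a ≤ n → X a ≻ X+δ n → a ≤ p
    high⇒≤p {a} a≤n h with high? a | high⇔≤p a≤n
    ... | yes _ | eq = ℕ.s≤s⁻¹ (<ᵇ≡⇒< a (suc p) (sym eq))
    ... | no l  | _ = ⊥-elim (l h)

    ≻-weakenˡ : ∀ {a a′ y} → a′ ≤ a → a ≤ n → X a ≻ y → X a′ ≻ y
    ≻-weakenˡ {a} {a′} a′≤a a≤n gt with ℕₚ.m≤n⇒m<n∨m≡n a′≤a
    ... | inj₁ lt   = ≻-trans (X-decreasing lt a≤n) gt
    ... | inj₂ refl = gt

    ≻-weakenʳ : ∀ {b b′ y} → b ≤ b′ → b′ ≤ n → y ≻ X+δ b → y ≻ X+δ b′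
    ≻-weakenʳ {b} {b′} b≤b′ b′≤n gt with ℕₚ.m≤n⇒m<n∨m≡n b≤b′
    ... | inj₁ lt   = ≻-trans gt (≻-suc (X-decreasing lt b′≤n))
    ... | inj₂ refl = gt

  iab⇒staircase : Staircase n I p
  iab⇒staircase = record
    { p<n = p<n
    ; positive = positive
    -- The arbitrary predicate `I` becomes decidable here, since `≻` is; the searches for rim cells
    -- depend on it.
    ; member? = λ {a} {b} a<b b≤n → map′ (≻⇒I a<b b≤n) (I⇒≻ a<b b≤n) (X a ≻? X+δ b)
    ; upward = λ a<b b≤n mem a′≤a b≤b′ b′≤n →
        ≻⇒I (ℕₚ.≤-<-trans a′≤a (ℕₚ.<-≤-trans a<b b≤b′)) b′≤n
          (≻-weakenˡ a′≤a (ℕₚ.≤-trans (ℕₚ.<⇒≤ a<b) b≤n) (≻-weakenʳ b≤b′ b′≤n (I⇒≻ a<b b≤n mem)))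
    ; row≤p = λ a<b b≤n mem → high⇒≤p (ℕₚ.≤-trans (ℕₚ.<⇒≤ a<b) b≤n) (≻-weakenʳ b≤n ℕₚ.≤-refl (I⇒≻ a<b b≤n mem))
    ; p<column = λ {a} {b} a<b b≤n mem → ℕₚ.≰⇒> λ b≤p → high⇒¬firstRow (≤p⇒high b≤p)
        (≻-weakenˡ z≤n (ℕₚ.≤-trans (ℕₚ.<⇒≤ a<b) b≤n) (I⇒≻ a<b b≤n mem))
    ; lastColumn = λ a≤p → ≻⇒I (ℕₚ.≤-<-trans a≤p p<n) ℕₚ.≤-refl (≤p⇒high a≤p)
    ; firstRow = λ { {suc b} p<b b≤n → ≻⇒I (s≤s z≤n) b≤n
        (low⇒firstRow b≤n (λ ()) (λ h → ℕₚ.<⇒≱ p<b (high⇒≤p b≤n h))) }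
    }

-- Borders

private
  cancel : ∀ {m} (x y z : Vec ℤ m) → (x -v z) -v (x -v y) ≡ y -v z
  cancel x y z = co-ext λ k _ → trans (co-minus (x -v z) (x -v y) k)
    (trans (cong₂ ℤ._-_ (co-minus x z k) (co-minus x y k))
    (trans (lem (co x k) (co y k) (co z k)) (sym (co-minus y z k))))
    where
    lem : ∀ x y z → x ℤ.- z ℤ.- (x ℤ.- y) ≡ y ℤ.- z
    lem = solve-∀

  cancel′ : ∀ {m} (x y z : Vec ℤ m) → (x -v z) -v (y -v z) ≡ x -v y
  cancel′ x y z = co-ext λ k _ → trans (co-minus (x -v z) (y -v z) k)
    (trans (cong₂ ℤ._-_ (co-minus x z k) (co-minus y z k))
    (trans (lem (co x k) (co y k) (co z k)) (sym (co-minus x y k))))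
    where
    lem : ∀ x y z → x ℤ.- z ℤ.- (y ℤ.- z) ≡ x ℤ.- y
    lem = solve-∀

psum-inside : ∀ {n a b} k → a < k → k ≤ b → b ≤ n → psum k (root (suc n) a b) ≡ + 1
psum-inside {n} {a} {b} k a<k k≤b b≤n =
  trans (psum-r (s≤s (ℕₚ.≤-trans (ℕₚ.<⇒≤ (ℕₚ.<-≤-trans a<k k≤b)) b≤n)) (s≤s b≤n) k)
  (cong₂ (λ x y → ι x ℤ.- ι y) (<⇒<ᵇ≡ a<k) (≤⇒<ᵇ≡ k≤b))

psum-≤ : ∀ {n a b} k → a ≤ n → b ≤ n → k ≤ a → k ≤ b → psum k (root (suc n) a b) ≡ + 0
psum-≤ k a≤n b≤n k≤a k≤b = trans (psum-r (s≤s a≤n) (s≤s b≤n) k)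
  (cong₂ (λ x y → ι x ℤ.- ι y) (≤⇒<ᵇ≡ k≤a) (≤⇒<ᵇ≡ k≤b))

psum-> : ∀ {n a b} k → a ≤ n → b ≤ n → a < k → b < k → psum k (root (suc n) a b) ≡ + 0
psum-> k a≤n b≤n a<k b<k = trans (psum-r (s≤s a≤n) (s≤s b≤n) k)
  (cong₂ (λ x y → ι x ℤ.- ι y) (<⇒<ᵇ≡ a<k) (<⇒<ᵇ≡ b<k))

psum-pos : ∀ {n a b} k → a < b → b ≤ n →
  (a < k × k ≤ b × psum k (root (suc n) a b) ≡ + 1) ⊎ (¬ (a < k × k ≤ b) × psum k (root (suc n) a b) ≡ + 0)
psum-pos {n} {a} {b} k a<b b≤n with a ℕ.<? k | k ℕ.≤? b
... | yes a<k | yes k≤b = inj₁ (a<k , k≤b , psum-inside k a<k k≤b b≤n)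
... | no a≮k  | _ = inj₂ ((λ (p , _) → a≮k p) ,
   psum-≤ k (ℕₚ.≤-trans (ℕₚ.<⇒≤ a<b) b≤n) b≤n (ℕₚ.≮⇒≥ a≮k) (ℕₚ.≤-trans (ℕₚ.≮⇒≥ a≮k) (ℕₚ.<⇒≤ a<b)))
... | yes a<k | no k≰b = inj₂ ((λ (_ , p) → k≰b p) , psum-> k (ℕₚ.≤-trans (ℕₚ.<⇒≤ a<b) b≤n) b≤n a<k (ℕₚ.≰⇒> k≰b))

module _ {n : ℕ} where

  private
    ψ-diff : ∀ k β (h : Fin n) → psum k (β -v α n h) ≡ psum k β ℤ.- psum k (α n h)
    ψ-diff k β h = psum-minus k β (α n h)

    ψα-at : ∀ (h : Fin n) → psum (suc (toℕ h)) (α n h) ≡ + 1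
    ψα-at h = trans (cong (psum (suc (toℕ h))) (α≡r n h))
      (psum-inside (suc (toℕ h)) (ℕₚ.n<1+n (toℕ h)) ℕₚ.≤-refl (Finₚ.toℕ<n h))

    ψα-off : ∀ (h : Fin n) k → k ≢ suc (toℕ h) → psum k (α n h) ≡ + 0
    ψα-off h k k≢ with psum-pos k (ℕₚ.n<1+n (toℕ h)) (Finₚ.toℕ<n h)
    ... | inj₁ (p , q , _) = ⊥-elim (k≢ (ℕₚ.≤-antisym q p))
    ... | inj₂ (_ , e) = trans (cong (psum k) (α≡r n h)) e

    -- The support of a positive root is an interval. Removing an inner simple root leaves a hole:
    -- the partial sums at `h` and `h + 2` are 1, the one at `h + 1` is 0.
    removable : ∀ {a b} (h : Fin n) → a ≤ b → b < n → isPos n (root (suc n) a (suc b) -v α n h) →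
      toℕ h ≡ a ⊎ toℕ h ≡ b
    removable {a} {b} h a≤b b<n pos with isPos⇒PosRoot pos
    ... | c , d , c<d , d≤n , eq with toℕ h ℕ.≟ a | toℕ h ℕ.≟ b
    ... | yes p | _     = inj₁ p
    ... | no _  | yes p = inj₂ p
    ... | no h≢a | no h≢b = ⊥-elim contra
      where
      at : ∀ k → psum k (root (suc n) a (suc b)) ℤ.- psum k (α n h) ≡ psum k (root (suc n) c d)
      at k = trans (sym (ψ-diff k (root (suc n) a (suc b)) h)) (cong (psum k) eq)
      inside : ∀ k → a < k → k ≤ suc b → k ≢ suc (toℕ h) → c < k × k ≤ d
      inside k a<k k≤b k≢ with psum-pos k c<d d≤n
      ... | inj₁ (p , q , _) = p , q
      ... | inj₂ (_ , e) with () ← trans (sym (cong₂ ℤ._-_ (psum-inside k a<k k≤b b<n) (ψα-off h k k≢))) (trans (at k) e)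
      a≤h : a ≤ toℕ h × toℕ h ≤ b × ¬ (c < suc (toℕ h) × suc (toℕ h) ≤ d)
      a≤h with psum-pos (suc (toℕ h)) (s≤s a≤b) b<n | psum-pos (suc (toℕ h)) c<d d≤n
      ... | inj₁ (s≤s p , s≤s q , _) | inj₂ (out , _) = p , q , out
      ... | inj₁ (_ , _ , e) | inj₁ (_ , _ , e′)
        with () ← trans (sym (cong₂ ℤ._-_ e (ψα-at h))) (trans (at (suc (toℕ h))) e′)
      ... | inj₂ (_ , e) | inj₁ (_ , _ , e′)
        with () ← trans (sym (cong₂ ℤ._-_ e (ψα-at h))) (trans (at (suc (toℕ h))) e′)
      ... | inj₂ (_ , e) | inj₂ (_ , e′)
        with () ← trans (sym (cong₂ ℤ._-_ e (ψα-at h))) (trans (at (suc (toℕ h))) e′)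
      contra : ⊥
      contra with a≤h
      ... | p , q , out = out (ℕₚ.m≤n⇒m≤1+n (proj₁ below) , ℕₚ.<⇒≤ (proj₂ above))
        where
        a<h = ℕₚ.≤∧≢⇒< p (h≢a ∘ sym)
        h<b = ℕₚ.≤∧≢⇒< q h≢b
        below : c < toℕ h × toℕ h ≤ d
        below = inside (toℕ h) a<h (ℕₚ.m≤n⇒m≤1+n q) (ℕₚ.<⇒≢ (ℕₚ.n<1+n _))
        above : c < suc (suc (toℕ h)) × suc (toℕ h) < d
        above = inside (suc (suc (toℕ h))) (ℕₚ.m≤n⇒m≤1+n (ℕₚ.m≤n⇒m≤1+n a<h)) (s≤s h<b) (ℕₚ.>⇒≢ (ℕₚ.n<1+n _))

    -- The border condition also ranges over `h₁ = h₂`. There the coefficient of `α_h` drops below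
    -- zero.
    twice : ∀ {a b} (h : Fin n) → a ≤ b → b < n → ¬ PosRoot n (root (suc n) a (suc b) -v α n h -v α n h)
    twice {a} {b} h a≤b b<n (c , d , c<d , d≤n , eq)
      with psum-pos (suc (toℕ h)) (s≤s a≤b) b<n | psum-pos (suc (toℕ h)) c<d d≤n
    ... | x | y = contra (value x) (value y)
      where
      at : psum (suc (toℕ h)) (root (suc n) a (suc b)) ℤ.- + 1 ℤ.- + 1 ≡ psum (suc (toℕ h)) (root (suc n) c d)
      at = trans (sym (trans (ψ-diff (suc (toℕ h)) (root (suc n) a (suc b) -v α n h) h)
        (cong₂ ℤ._-_ (trans (ψ-diff (suc (toℕ h)) (root (suc n) a (suc b)) h) (cong (ℤ._-_ (psum (suc (toℕ h)) (root (suc n) a (suc b)))) (ψα-at h))) (ψα-at h))))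
        (cong (psum (suc (toℕ h))) eq)
      value : ∀ {A B : Set} {z : ℤ} → (A × B × z ≡ + 1) ⊎ (¬ (A × B) × z ≡ + 0) → z ≡ + 1 ⊎ z ≡ + 0
      value (inj₁ (_ , _ , e)) = inj₁ e
      value (inj₂ (_ , e))     = inj₂ e
      contra : psum (suc (toℕ h)) (root (suc n) a (suc b)) ≡ + 1 ⊎ psum (suc (toℕ h)) (root (suc n) a (suc b)) ≡ + 0 →
               psum (suc (toℕ h)) (root (suc n) c d) ≡ + 1 ⊎ psum (suc (toℕ h)) (root (suc n) c d) ≡ + 0 → ⊥
      contra (inj₁ e) (inj₁ e′) with () ← trans (sym (cong (λ z → z ℤ.- + 1 ℤ.- + 1) e)) (trans at e′)
      contra (inj₁ e) (inj₂ e′) with () ← trans (sym (cong (λ z → z ℤ.- + 1 ℤ.- + 1) e)) (trans at e′)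
      contra (inj₂ e) (inj₁ e′) with () ← trans (sym (cong (λ z → z ℤ.- + 1 ℤ.- + 1) e)) (trans at e′)
      contra (inj₂ e) (inj₂ e′) with () ← trans (sym (cong (λ z → z ℤ.- + 1 ℤ.- + 1) e)) (trans at e′)

  module _ (I : Pred (E n) 0ℓ) where

    Cell : ℕ → ℕ → Set
    Cell a b = a < b × b ≤ n × I (root (suc n) a b)

    -- About the cell (a , b + 1), so that its diagonal neighbour (a + 1 , b) needs no subtraction.
    Rim : ℕ → ℕ → Set
    Rim a b = Cell a (suc b) × ¬ Cell (suc a) b

    module _ (positive : ∀ {β} → I β → PosRoot n β) where

      private
        both-ends : ∀ {a b} (h₁ h₂ : Fin n) → toℕ h₁ ≡ a → toℕ h₂ ≡ b →
          (root (suc n) a (suc b) -v α n h₁ -v α n h₂ ≡ root (suc n) (suc a) b) ×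
          (root (suc n) a (suc b) -v α n h₂ -v α n h₁ ≡ root (suc n) (suc a) b)
        both-ends h₁ h₂ refl refl =
          trans (cong₂ (λ x y → β -v x -v y) (α≡r n h₁) (α≡r n h₂))
            (trans (cong (_-v root (suc n) (toℕ h₂) (suc (toℕ h₂))) (cancel (x a) (x (suc a)) (x (suc b))))
                   (cancel′ (x (suc a)) (x b) (x (suc b)))) ,
          trans (cong₂ (λ x y → β -v x -v y) (α≡r n h₂) (α≡r n h₁))
            (trans (cong (_-v root (suc n) (toℕ h₁) (suc (toℕ h₁))) (cancel′ (x a) (x b) (x (suc b))))
                   (cancel (x a) (x (suc a)) (x b)))
          where
          a = toℕ h₁
          b = toℕ h₂
          x = eN (suc n)
          β = root (suc n) a (suc b)

        cell : ∀ {a b} → suc a ≤ n → b ≤ n → I (root (suc n) (suc a) b) → Cell (suc a) b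
        cell a<n b≤n mem with positive mem
        ... | c , d , c<d , d≤n , eq with refl , refl ← r-injective (s≤s a<n) (s≤s b≤n)
                (s≤s (ℕₚ.≤-trans (ℕₚ.<⇒≤ c<d) d≤n)) (s≤s d≤n) (ℕₚ.<⇒≢ c<d) eq = c<d , d≤n , mem

      rim⇒border : ∀ {a b} → Rim a b → Border n I (root (suc n) a (suc b))
      rim⇒border {a} {b} ((s≤s a≤b , b<n , mem) , corner) = mem , λ h₁ h₂ pos₁ pos₂ mem′ →
        ends h₁ h₂ (removable h₁ a≤b b<n pos₁) (removable h₂ a≤b b<n pos₂) mem′
        where
        same : ∀ h₁ h₂ → toℕ h₁ ≡ toℕ h₂ → ¬ I (root (suc n) a (suc b) -v α n h₁ -v α n h₂)
        same h₁ h₂ e mem′ with refl ← Finₚ.toℕ-injective e = twice h₁ a≤b b<n (positive mem′)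
        ends : ∀ h₁ h₂ → toℕ h₁ ≡ a ⊎ toℕ h₁ ≡ b → toℕ h₂ ≡ a ⊎ toℕ h₂ ≡ b →
               ¬ I (root (suc n) a (suc b) -v α n h₁ -v α n h₂)
        ends h₁ h₂ (inj₁ p) (inj₁ q) = same h₁ h₂ (trans p (sym q))
        ends h₁ h₂ (inj₂ p) (inj₂ q) = same h₁ h₂ (trans p (sym q))
        ends h₁ h₂ (inj₁ p) (inj₂ q) mem′ = corner
          (cell (ℕₚ.≤-<-trans a≤b b<n) (ℕₚ.<⇒≤ b<n) (subst I (proj₁ (both-ends h₁ h₂ p q)) mem′))
        ends h₁ h₂ (inj₂ p) (inj₁ q) mem′ = corner
          (cell (ℕₚ.≤-<-trans a≤b b<n) (ℕₚ.<⇒≤ b<n) (subst I (proj₂ (both-ends h₂ h₁ q p)) mem′))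

      border⇒rim : ∀ {β} → Border n I β → ∃[ a ] ∃[ b ] (β ≡ root (suc n) a (suc b) × Rim a b)
      border⇒rim (mem , corner) with positive mem
      ... | a , suc b , a<b , b<n , refl = a , b , refl , (a<b , b<n , mem) , rim
        where
        rim : ¬ Cell (suc a) b
        -- The simple roots to subtract are those at the two ends of the support, `α_a` and `α_b`.
        rim (a<b′ , b≤n , mem′) = corner (Fin.fromℕ< a<n) (Fin.fromℕ< b<n)
          (subst (isPos n) (sym (trans (cong (_-v_ (root (suc n) a (suc b))) αa) (cancel (x a) (x (suc a)) (x (suc b)))))
            (r-isPos (ℕₚ.m≤n⇒m≤1+n a<b′) b<n))
          (subst (isPos n) (sym (trans (cong (_-v_ (root (suc n) a (suc b))) αb) (cancel′ (x a) (x b) (x (suc b)))))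
            (r-isPos (ℕₚ.<⇒≤ a<b′) b≤n))
          (subst I (sym (proj₁ (both-ends (Fin.fromℕ< a<n) (Fin.fromℕ< b<n) (Finₚ.toℕ-fromℕ< a<n) (Finₚ.toℕ-fromℕ< b<n)))) mem′)
          where
          x = eN (suc n)
          a<n : a < n
          a<n = ℕₚ.≤-<-trans (ℕ.s≤s⁻¹ a<b) b<n
          αa : α n (Fin.fromℕ< a<n) ≡ root (suc n) a (suc a)
          αa = trans (α≡r n _) (cong (λ z → root (suc n) z (suc z)) (Finₚ.toℕ-fromℕ< a<n))
          αb : α n (Fin.fromℕ< b<n) ≡ root (suc n) b (suc b)
          αb = trans (α≡r n _) (cong (λ z → root (suc n) z (suc z)) (Finₚ.toℕ-fromℕ< b<n))

-- From simplices to graphs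

-- Truncates at m.
fin : ∀ m → ℕ → Fin (suc m)
fin m       zero    = Fin.zero
fin zero    (suc k) = Fin.zero
fin (suc m) (suc k) = Fin.suc (fin m k)

toℕ-fin : ∀ {m k} → k ≤ m → toℕ (fin m k) ≡ k
toℕ-fin {m}     {zero}  _         = refl
toℕ-fin {suc m} {suc k} (s≤s k≤m) = cong suc (toℕ-fin k≤m)

fin-toℕ : ∀ {m} (k : Fin (suc m)) → fin m (toℕ k) ≡ k
fin-toℕ {m} k = Finₚ.toℕ-injective (toℕ-fin (ℕ.s≤s⁻¹ (Finₚ.toℕ<n k)))

module _ {n : ℕ} (I : Pred (E n) 0ℓ) (p : ℕ) (S : Staircase n I p) where

  open Staircase S

  private
    P : ℕ → ℕ → Set
    P = Cell I

    Bd : ℕ → ℕ → Set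
    Bd = Rim I

    P? : ∀ a b → Dec (P a b)
    P? a b with a ℕ.<? b | b ℕ.≤? n
    ... | no ¬p | _     = no (¬p ∘ proj₁)
    ... | yes _ | no ¬p = no (¬p ∘ proj₁ ∘ proj₂)
    ... | yes a<b | yes b≤n = map′ (λ m → a<b , b≤n , m) (proj₂ ∘ proj₂) (member? a<b b≤n)

    P-up : ∀ {a b a′ b′} → P a b → a′ ≤ a → b ≤ b′ → b′ ≤ n → P a′ b′
    P-up (a<b , b≤n , m) a′≤a b≤b′ b′≤n =
      ℕₚ.≤-<-trans a′≤a (ℕₚ.<-≤-trans a<b b≤b′) , b′≤n , upward a<b b≤n m a′≤a b≤b′ b′≤n

    P-row : ∀ {a b} → P a b → a ≤ p
    P-row (a<b , b≤n , m) = row≤p a<b b≤n m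

    P-col : ∀ {a b} → P a b → p < b
    P-col (a<b , b≤n , m) = p<column a<b b≤n m

    -- Walk from `(a , b + 1)` to `(a + 1 , b)` as long as this stays in `I`; the last cell is on
    -- the rim. The recursion is on the column.
    antidiagonal-search : ∀ b a → P a (suc b) → ∃[ a′ ] ∃[ b′ ] (a′ ℕ.+ b′ ≡ a ℕ.+ b × Bd a′ b′)
    antidiagonal-search b a c with P? (suc a) b
    ... | no ¬c = a , b , refl , c , ¬c
    antidiagonal-search (suc b) a c | yes c′ with antidiagonal-search b (suc a) c′
    ... | a′ , b′ , eq , rim = a′ , b′ , trans eq (sym (ℕₚ.+-suc a b)) , rim

    -- The leftmost member of a row is on the rim: by upward closure `(a + 1 , b)` in `I` would put
    -- `(a , b)` there too.
    row-search : ∀ b a → P a (suc b) → ∃[ b′ ] Bd a b′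
    row-search b a c with P? a b
    ... | no ¬c = b , c , λ c′ → ¬c (P-up c′ (ℕₚ.n≤1+n a) ℕₚ.≤-refl (proj₁ (proj₂ c′)))
    row-search (suc b) a c | yes c′ = row-search b a c′

    -- The lowest member of a column is on the rim. `f` is fuel: since members of `I` have rows at
    -- most `p`, `p - a` steps down suffice.
    column-search : ∀ f b a → p ≤ a ℕ.+ f → P a (suc b) → ∃[ a′ ] Bd a′ b
    column-search f b a le c with P? (suc a) (suc b)
    ... | no ¬c = a , c , λ c′ → ¬c (P-up c′ ℕₚ.≤-refl (ℕₚ.n≤1+n b) (proj₁ (proj₂ c)))
    column-search zero b a le c | yes c′ =
      ⊥-elim (ℕₚ.<⇒≱ (P-row c′) (ℕₚ.≤-trans le (ℕₚ.≤-reflexive (ℕₚ.+-identityʳ a))))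
    column-search (suc f) b a le c | yes c′ =
      column-search f b (suc a) (ℕₚ.≤-trans le (ℕₚ.≤-reflexive (ℕₚ.+-suc a f))) c′

    -- If the column went back while the row advances, the second cell would push the diagonal
    -- neighbour of the first into `I`.
    rim-mono : ∀ {a b a′ b′} → Bd a b → Bd a′ b′ → a < a′ → b ≤ b′
    rim-mono ((_ , b<n , _) , corner) (c′ , _) a<a′ = ℕₚ.≮⇒≥ λ b′<b →
      corner (P-up c′ a<a′ b′<b (ℕₚ.<⇒≤ b<n))

    rim-unique : ∀ {a b a′ b′} → Bd a b → Bd a′ b′ → a ℕ.+ b ≡ a′ ℕ.+ b′ → a ≡ a′ × b ≡ b′
    rim-unique {a} {b} {a′} {b′} rim rim′ eq with ℕₚ.<-cmp a a′
    ... | tri< lt _ _ = ⊥-elim (ℕₚ.<⇒≢ (ℕₚ.+-mono-<-≤ lt (rim-mono rim rim′ lt)) eq)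
    ... | tri≈ _ refl _ = refl , ℕₚ.+-cancelˡ-≡ a b b′ eq
    ... | tri> _ _ gt = ⊥-elim (ℕₚ.>⇒≢ (ℕₚ.+-mono-<-≤ gt (rim-mono rim′ rim gt)) eq)

    -- Exactly `n` antidiagonals meet the rectangle. The search starts in the full first row while
    -- column `k + p + 1` exists, and in the full last column afterwards.
    cell : ∀ k → k < n → ∃[ a ] ∃[ b ] (a ℕ.+ b ≡ k ℕ.+ p × Bd a b)
    cell k k<n with k ℕ.+ p ℕ.<? n
    ... | yes lt = antidiagonal-search (k ℕ.+ p) 0
            (s≤s z≤n , lt , firstRow (s≤s (ℕₚ.m≤n+m p k)) lt)
    ... | no ge = last n k<n refl (ℕₚ.≮⇒≥ ge)
      where
      last : ∀ m → k < m → m ≡ n → n ≤ k ℕ.+ p → ∃[ a ] ∃[ b ] (a ℕ.+ b ≡ k ℕ.+ p × Bd a b)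
      last (suc m) (s≤s k≤m) refl le = subst (λ z → ∃[ a ] ∃[ b ] (a ℕ.+ b ≡ z × Bd a b))
        (ℕₚ.m∸n+n≡m m≤) (antidiagonal-search m (k ℕ.+ p ℕ.∸ m)
          (ℕₚ.≤-<-trans a≤p p<n , ℕₚ.≤-refl , lastColumn a≤p))
        where
        m≤ : m ≤ k ℕ.+ p
        m≤ = ℕₚ.<⇒≤ le
        a≤p : k ℕ.+ p ℕ.∸ m ≤ p
        a≤p = ℕₚ.m≤n+o⇒m∸n≤o (k ℕ.+ p) m (ℕₚ.+-monoˡ-≤ p k≤m)

  module _ (w : List (Fin n)) (mono : BlockMono n (suc p) (sg w)) where

    private
      vertex : ℕ → Fin (suc n)
      vertex a = fin n (sg w a)

      toℕ-vertex : ∀ {a} → a ≤ n → toℕ (vertex a) ≡ sg w a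
      toℕ-vertex a≤n = toℕ-fin (sg-bounded w a≤n)

      vertex-injective : ∀ {a b} → a ≤ n → b ≤ n → vertex a ≡ vertex b → a ≡ b
      vertex-injective a≤n b≤n eq =
        sg-injective w (trans (sym (toℕ-vertex a≤n)) (trans (cong toℕ eq) (toℕ-vertex b≤n)))

      vertex-pi : ∀ v → vertex (pi w (toℕ v)) ≡ v
      vertex-pi v = trans (cong (fin n) (sg-pi w (toℕ v))) (fin-toℕ v)

      row col : Fin n → ℕ
      row k = proj₁ (cell (toℕ k) (Finₚ.toℕ<n k))
      col k = proj₁ (proj₂ (cell (toℕ k) (Finₚ.toℕ<n k)))

      row+col : ∀ k → row k ℕ.+ col k ≡ toℕ k ℕ.+ p
      row+col k = proj₁ (proj₂ (proj₂ (cell (toℕ k) (Finₚ.toℕ<n k))))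

      rim : ∀ k → Bd (row k) (col k)
      rim k = proj₂ (proj₂ (proj₂ (cell (toℕ k) (Finₚ.toℕ<n k))))

      row≤n : ∀ {a b} → Bd a b → a ≤ n
      row≤n ((a<b , b≤n , _) , _) = ℕₚ.≤-trans (ℕₚ.<⇒≤ a<b) b≤n

      col<n : ∀ {a b} → Bd a b → b < n
      col<n ((_ , b<n , _) , _) = b<n

      edge : Fin n → Fin (suc n) × Fin (suc n)
      edge k = vertex (row k) , vertex (suc (col k))

      edge-injective : ∀ {j k} → edge j ≡ edge k → j ≡ k
      edge-injective {j} {k} eq = Finₚ.toℕ-injective (ℕₚ.+-cancelʳ-≡ p (toℕ j) (toℕ k)
        (trans (sym (row+col j)) (trans (cong₂ ℕ._+_
          (vertex-injective (row≤n (rim j)) (row≤n (rim k)) (cong proj₁ eq))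
          (ℕₚ.suc-injective (vertex-injective (col<n (rim j)) (col<n (rim k)) (cong proj₂ eq))))
          (row+col k))))

    rimGraph : Graph n
    rimGraph = List.tabulate edge

    ∈-rimGraph⁻ : ∀ {s t} → (s , t) ∈ rimGraph →
      ∃[ a ] ∃[ b ] (Bd a b × s ≡ vertex a × t ≡ vertex (suc b))
    ∈-rimGraph⁻ st∈ with ∈-tabulate⁻ st∈
    ... | k , refl = row k , col k , rim k , refl , refl

    ∈-rimGraph⁺ : ∀ {a b} → Bd a b → (vertex a , vertex (suc b)) ∈ rimGraph
    ∈-rimGraph⁺ {a} {b} bd = subst (_∈ rimGraph) eq (∈-tabulate⁺ k)
      where
      p≤b : p ≤ b
      p≤b = ℕ.s≤s⁻¹ (P-col (proj₁ bd))
      k<n : a ℕ.+ b ℕ.∸ p < n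
      k<n = ℕₚ.≤-<-trans (ℕₚ.m≤n+o⇒m∸n≤o (a ℕ.+ b) p (ℕₚ.+-monoˡ-≤ b (P-row (proj₁ bd)))) (col<n bd)
      k : Fin n
      k = Fin.fromℕ< k<n
      same : row k ℕ.+ col k ≡ a ℕ.+ b
      same = trans (row+col k) (trans (cong (ℕ._+ p) (Finₚ.toℕ-fromℕ< k<n))
               (ℕₚ.m∸n+n≡m (ℕₚ.≤-trans p≤b (ℕₚ.m≤n+m b a))))
      eq : edge k ≡ (vertex a , vertex (suc b))
      eq = cong₂ (λ x y → vertex x , vertex (suc y)) (proj₁ (rim-unique (rim k) bd same))
                                                     (proj₂ (rim-unique (rim k) bd same))

    private
      source-label : ∀ {v} → IsSource n rimGraph v → pi w (toℕ v) ≤ p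
      source-label (_ , e) with ∈-rimGraph⁻ e
      ... | a , b , bd , refl , _ =
        subst (_≤ p) (sym (trans (cong (pi w) (toℕ-vertex (row≤n bd))) (pi-sg w a))) (P-row (proj₁ bd))

      target-label : ∀ {v} → IsTarget n rimGraph v → p < pi w (toℕ v)
      target-label (_ , e) with ∈-rimGraph⁻ e
      ... | a , b , bd , _ , refl =
        subst (p <_) (sym (trans (cong (pi w) (toℕ-vertex (col<n bd))) (pi-sg w (suc b)))) (P-col (proj₁ bd))

      -- Fullness of the last column makes every row up to `p` meet `I`, hence the rim; fullness of
      -- the first row does this for the columns.
      sourceOrTarget : ∀ v → IsSource n rimGraph v ⊎ IsTarget n rimGraph v
      sourceOrTarget v = go (pi w (toℕ v)) (vertex-pi v) (pi-bounded w (ℕ.s≤s⁻¹ (Finₚ.toℕ<n v)))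
        where
        go : ∀ x → vertex x ≡ v → x ≤ n → IsSource n rimGraph v ⊎ IsTarget n rimGraph v
        go x eq x≤n with x ℕ.≤? p
        go x refl x≤n | yes x≤p = inj₁ (from n refl)
          where
          from : ∀ m → m ≡ n → IsSource n rimGraph (vertex x)
          from zero    refl = ⊥-elim (ℕₚ.n≮0 p<n)
          from (suc m) refl with row-search m x (ℕₚ.≤-<-trans x≤p p<n , ℕₚ.≤-refl , lastColumn x≤p)
          ... | b , bd = vertex (suc b) , ∈-rimGraph⁺ bd
        go zero    refl x≤n | no x≰p = ⊥-elim (x≰p z≤n)
        go (suc b) refl x≤n | no x≰p
          with column-search p b 0 ℕₚ.≤-refl (s≤s z≤n , x≤n , firstRow (ℕₚ.≰⇒> x≰p) x≤n)
        ... | a , bd = inj₂ (vertex a , ∈-rimGraph⁺ bd)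

      weakMono : ∀ {a b} → a ≤ b → b ≤ n → (a <ᵇ suc p) ≡ (b <ᵇ suc p) → sg w a ≤ sg w b
      weakMono a≤b b≤n same with ℕₚ.m≤n⇒m<n∨m≡n a≤b
      ... | inj₁ a<b  = ℕₚ.<⇒≤ (mono a<b b≤n same)
      ... | inj₂ refl = ℕₚ.≤-refl

      -- `w` increases on rows, so the order of two sources is the order of their rows; `rim-mono`
      -- passes to columns, on which `w` increases as well.
      edges-mono : ∀ s t s′ t′ → (s , t) ∈ rimGraph → (s′ , t′) ∈ rimGraph → s Fin.< s′ → t Fin.≤ t′
      edges-mono s t s′ t′ e e′ s<s′ with ∈-rimGraph⁻ e | ∈-rimGraph⁻ e′
      ... | a , b , bd , refl , refl | a′ , b′ , bd′ , refl , refl =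
        subst₂ _≤_ (sym (toℕ-vertex (col<n bd))) (sym (toℕ-vertex (col<n bd′)))
          (weakMono (s≤s (rim-mono bd bd′ a<a′)) (col<n bd′)
            (trans (≤⇒<ᵇ≡ {suc b} (P-col (proj₁ bd))) (sym (≤⇒<ᵇ≡ {suc b′} (P-col (proj₁ bd′))))))
        where
        a<a′ : a < a′
        a<a′ = ℕₚ.≰⇒> λ a′≤a → ℕₚ.<⇒≱
          (subst₂ _<_ (toℕ-vertex (row≤n bd)) (toℕ-vertex (row≤n bd′)) s<s′)
          (weakMono a′≤a (row≤n bd)
            (trans (<⇒<ᵇ≡ {a′} (s≤s (P-row (proj₁ bd′)))) (sym (<⇒<ᵇ≡ {a} (s≤s (P-row (proj₁ bd)))))))

    rimGraph-antiStandard : AntiStandard n rimGraph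
    rimGraph-antiStandard =
      Uniqueₚ.tabulate⁺ edge-injective ,
      length-tabulate edge ,
      noLoops ,
      (λ v → sourceOrTarget v , λ (src , tgt) → ℕₚ.<⇒≱ (target-label tgt) (source-label src)) ,
      edges-mono
      where
      noLoops : ∀ s t → (s , t) ∈ rimGraph → s ≢ t
      noLoops s t e refl = ℕₚ.<⇒≱ (target-label (s , e)) (source-label (t , e))

    border-image≐R : image n (actW n w) (Border n I) ≐ R n rimGraph
    border-image≐R = to , from
      where
      to : ∀ {x} → image n (actW n w) (Border n I) x → R n rimGraph x
      to (β , bβ , refl) with border⇒rim I positive bβ
      ... | a , b , refl , bd = vertex a , vertex (suc b) , ∈-rimGraph⁺ bd ,
        trans (actW-r w (row≤n bd) (col<n bd)) (sym (trans (ρ≡r n (vertex a) (vertex (suc b)))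
          (cong₂ (root (suc n)) (toℕ-vertex (row≤n bd)) (toℕ-vertex (col<n bd)))))
      from : ∀ {x} → R n rimGraph x → image n (actW n w) (Border n I) x
      from (s , t , e , eq) with ∈-rimGraph⁻ e
      ... | a , b , bd , refl , refl = root (suc n) a (suc b) , rim⇒border I positive bd ,
        trans eq (trans (ρ≡r n (vertex a) (vertex (suc b)))
          (trans (cong₂ (root (suc n)) (toℕ-vertex (row≤n bd)) (toℕ-vertex (col<n bd)))
            (sym (actW-r w (row≤n bd) (col<n bd)))))

simplex⇒graph : ∀ {n} → 1 ≤ n → ∀ {S} → SimplexT′ n S → FromGraph n S
simplex⇒graph {n} 1≤n (i , w , min , I , iab , S⊆ , ⊆S) =
  rimGraph I p stair w mono , rimGraph-antiStandard I p stair w mono ,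
  (proj₁ eq ∘ S⊆) , (⊆S ∘ proj₂ eq)
  where
  p = toℕ i
  stair : Staircase n I p
  stair = iab⇒staircase 1≤n iab
  mono : BlockMono n (suc p) (sg w)
  mono = increasing⇒blockMono (suc p) (sg w) λ {h} h<n h≢p →
    subst (λ z → sg w z < sg w (suc z)) (Finₚ.toℕ-fromℕ< h<n)
      (minCosetRep⇒increasing i w min (Fin.fromℕ< h<n)
        λ e → h≢p (cong suc (trans (sym (Finₚ.toℕ-fromℕ< h<n)) (cong toℕ e))))
  eq = border-image≐R I p stair w mono

-- Rotation of the affine diagram

step̂ : ∀ n → Fin (suc n) → ℕ × ℤ → ℕ × ℤ
step̂ n h (a , i) = σ̂ h a , i ℤ.+ ε̂ h a

-- Adding 1 to the index a of the affine basis vectors e_{a + k(n+1)} = e_a - kδ.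
rot : ℕ → ℕ × ℤ → ℕ × ℤ
rot n (a , i) with a ℕ.≟ n
... | yes _ = 0 , ℤ.pred i
... | no _  = suc a , i

rot-last : ∀ n i → rot n (n , i) ≡ (0 , ℤ.pred i)
rot-last n i with n ℕ.≟ n
... | yes _ = refl
... | no p  = ⊥-elim (p refl)

rot-< : ∀ {n a} i → a < n → rot n (a , i) ≡ (suc a , i)
rot-< {n} {a} i a<n with a ℕ.≟ n
... | yes refl = ⊥-elim (ℕₚ.<-irrefl refl a<n)
... | no _     = refl

rot-bounded : ∀ {n x} → proj₁ x ≤ n → proj₁ (rot n x) ≤ n
rot-bounded {n} {a , i} a≤n with a ℕ.≟ n
... | yes _ = z≤n
... | no p  = ℕₚ.≤∧≢⇒< a≤n p

private
  <⇒≤pred : ∀ {i j} → j ℤ.< i → j ℤ.≤ ℤ.pred i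
  <⇒≤pred {i} {j} lt = subst (ℤ._≤ ℤ.pred i) (lem j) (ℤₚ.+-monoʳ-≤ -[1+ 0 ] (ℤₚ.i<j⇒suc[i]≤j lt))
    where
    lem : ∀ i → -[1+ 0 ] ℤ.+ (+ 1 ℤ.+ i) ≡ i
    lem = solve-∀

  pred< : ∀ i → ℤ.pred i ℤ.< i
  pred< i = ℤₚ.suc[i]≤j⇒i<j (ℤₚ.≤-reflexive (lem i))
    where
    lem : ∀ i → + 1 ℤ.+ (-[1+ 0 ] ℤ.+ i) ≡ i
    lem = solve-∀

rot-≻ : ∀ {n x y} → proj₁ x ≤ n → proj₁ y ≤ n → x ≻ y → rot n x ≻ rot n y
rot-≻ {n} {a , i} {b , j} a≤n b≤n x≻y with a ℕ.≟ n | b ℕ.≟ n | x≻y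
... | yes refl | yes refl | inj₁ j<i       = inj₁ (ℤₚ.+-monoʳ-< -[1+ 0 ] j<i)
... | yes refl | yes refl | inj₂ (_ , a<b) = ⊥-elim (ℕₚ.<-irrefl refl a<b)
... | yes refl | no _     | inj₂ (_ , a<b) = ⊥-elim (ℕₚ.<⇒≱ a<b b≤n)
-- The wrap lowers the `δ`-coefficient of the larger vector, possibly to that of the smaller one;
-- then index 0 against a successor decides.
... | yes refl | no _     | inj₁ j<i with j ℤₚ.≟ ℤ.pred i
...   | yes e = inj₂ (sym e , s≤s z≤n)
...   | no ¬e = inj₁ (ℤₚ.≤∧≢⇒< (<⇒≤pred j<i) ¬e)
rot-≻ a≤n b≤n x≻y | no _ | yes refl | inj₁ j<i         = inj₁ (ℤₚ.<-trans (pred< _) j<i)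
rot-≻ a≤n b≤n x≻y | no _ | yes refl | inj₂ (refl , _)  = inj₁ (pred< _)
rot-≻ a≤n b≤n x≻y | no _ | no _ | inj₁ j<i             = inj₁ j<i
rot-≻ a≤n b≤n x≻y | no _ | no _ | inj₂ (i≡j , a<b)     = inj₂ (i≡j , s≤s a<b)

-- The cyclic shift of the nodes of the affine diagram, in which `Fin.zero` is the affine node.
rotIndex : ∀ {n} → 1 ≤ n → Fin (suc n) → Fin (suc n)
rotIndex     1≤n Fin.zero    = Fin.suc (Fin.fromℕ< 1≤n)
rotIndex {n} _   (Fin.suc j) with suc (toℕ j) ℕ.<? n
... | yes lt = Fin.suc (Fin.fromℕ< lt)
... | no _   = Fin.zero

private
  step-first : ∀ {n} → 1 ≤ n → ∀ i → step̂ n Fin.zero (0 , i) ≡ (n , ℤ.suc i)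
  step-first {suc m} _ i = cong (suc m ,_) (lem i)
    where
    lem : ∀ i → i ℤ.+ (+ 1 ℤ.- + 0) ≡ + 1 ℤ.+ i
    lem = solve-∀

  step-last : ∀ {n} → 1 ≤ n → ∀ i → step̂ n Fin.zero (n , i) ≡ (0 , ℤ.pred i)
  step-last {suc m} 1≤n i = cong₂ _,_ (Transposition.left (swapEnds-transposition 1≤n))
    (trans (cong (λ x → i ℤ.+ (+ 0 ℤ.- x)) (δ-refl m)) (lem i))
    where
    lem : ∀ i → i ℤ.+ (+ 0 ℤ.- + 1) ≡ -[1+ 0 ] ℤ.+ i
    lem = solve-∀

  step-other : ∀ {n} → 1 ≤ n → ∀ {a} i → a ≢ 0 → a ≢ n → step̂ n Fin.zero (a , i) ≡ (a , i)
  step-other 1≤n {a} i a≢0 a≢n = cong₂ _,_ (Transposition.other (swapEnds-transposition 1≤n) a a≢n a≢0)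
    (trans (cong₂ (λ x y → i ℤ.+ (x ℤ.- y)) (δ-≢ a≢0) (δ-≢ a≢n)) (ℤₚ.+-identityʳ i))

  step-swp : ∀ {n} (j : Fin n) a i → step̂ n (Fin.suc j) (a , i) ≡ (swp (toℕ j) a , i)
  step-swp j a i = cong (swp (toℕ j) a ,_) (ℤₚ.+-identityʳ i)

-- Conjugating a simple reflection by the rotation gives the next one. The delicate nodes are the
-- affine one and the last, where the `δ`-shifts of `s_0` must match the loss of `δ` in the wrap
-- from `n` to 0.
rot-step : ∀ {n} (1≤n : 1 ≤ n) h {a} i → a ≤ n →
  step̂ n (rotIndex 1≤n h) (rot n (a , i)) ≡ rot n (step̂ n h (a , i))
rot-step {n@(suc m)} 1≤n Fin.zero {a} i a≤n = main (a ℕ.≟ 0) (a ℕ.≟ n)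
  where
  main : Dec (a ≡ 0) → Dec (a ≡ n) →
    step̂ n (Fin.suc Fin.zero) (rot n (a , i)) ≡ rot n (step̂ n Fin.zero (a , i))
  main (yes refl) _ = trans (cong (step̂ n (Fin.suc Fin.zero)) (rot-< {n} i (s≤s z≤n)))
      (trans (step-swp {n} Fin.zero 1 i) (sym (trans (cong (rot n) (step-first 1≤n i)) (trans (rot-last n (ℤ.suc i)) (cong (0 ,_) (ℤₚ.pred-suc i))))))
  main (no _) (yes refl) = trans (cong (step̂ n (Fin.suc Fin.zero)) (rot-last n i))
      (trans (step-swp {n} Fin.zero 0 (ℤ.pred i))
        (sym (trans (cong (rot n) (step-last 1≤n i)) (rot-< {n} (ℤ.pred i) (s≤s z≤n)))))
  main (no a≢0) (no a≢n) = trans (cong (step̂ n (Fin.suc Fin.zero)) (rot-< i a<n))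
      (trans (step-swp {n} Fin.zero (suc a) i)
      (trans (cong (_, i) (swp-other 0 (suc a) (λ ()) (a≢0 ∘ ℕₚ.suc-injective)))
        (sym (trans (cong (rot n) (step-other 1≤n i a≢0 a≢n)) (rot-< i a<n)))))
    where
    a<n : a < n
    a<n = ℕₚ.≤∧≢⇒< a≤n a≢n
rot-step {n} 1≤n (Fin.suc j) {a} i a≤n with suc (toℕ j) ℕ.<? n
rot-step {n} 1≤n (Fin.suc j) {a} i a≤n | yes lt =
  trans (cong (λ k → swp k (proj₁ (rot n (a , i))) , proj₂ (rot n (a , i)) ℤ.+ + 0) (Finₚ.toℕ-fromℕ< lt))
  (trans (cong (swp (suc (toℕ j)) (proj₁ (rot n (a , i))) ,_) (ℤₚ.+-identityʳ _))
  (trans (main (a ℕ.≟ n)) (cong (rot n) (sym (step-swp j a i)))))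
  where
  main : Dec (a ≡ n) → (swp (suc (toℕ j)) (proj₁ (rot n (a , i))) , proj₂ (rot n (a , i))) ≡ rot n (swp (toℕ j) a , i)
  main (yes refl) = trans (cong (λ x → swp (suc (toℕ j)) (proj₁ x) , proj₂ x) (rot-last n i))
    (sym (trans (cong (λ x → rot n (x , i)) (swp-other (toℕ j) n (ℕₚ.>⇒≢ (ℕₚ.<-trans (ℕₚ.n<1+n _) lt)) (ℕₚ.>⇒≢ lt)))
           (rot-last n i)))
  main (no a≢n) = trans (cong (λ x → swp (suc (toℕ j)) (proj₁ x) , proj₂ x) (rot-< i (ℕₚ.≤∧≢⇒< a≤n a≢n)))
    (sym (rot-< i (below n lt (ℕₚ.≤∧≢⇒< a≤n a≢n))))
    where
    below : ∀ n → suc (toℕ j) < n → a < n → swp (toℕ j) a < n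
    below (suc m) (s≤s lt) (s≤s a≤m) = s≤s (swp-bounded lt a≤m)
rot-step {n} 1≤n (Fin.suc j) {a} i a≤n | no ≮n =
  trans (wrap (ℕₚ.≤-antisym (Finₚ.toℕ<n j) (ℕₚ.≮⇒≥ ≮n)) a≤n) (cong (rot n) (sym (step-swp j a i)))
  where
  wrap : ∀ {n k} → suc k ≡ n → a ≤ n → step̂ n Fin.zero (rot n (a , i)) ≡ rot n (swp k a , i)
  wrap {n} {k} refl a≤n = main (a ℕ.≟ suc k) (a ℕ.≟ k)
    where
    main : Dec (a ≡ suc k) → Dec (a ≡ k) → step̂ n Fin.zero (rot n (a , i)) ≡ rot n (swp k a , i)
    main (yes refl) _ = trans (cong (step̂ n Fin.zero) (rot-last n i))
        (trans (step-first (s≤s z≤n) (ℤ.pred i)) (trans (cong (n ,_) (ℤₚ.suc-pred i))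
          (sym (trans (cong (λ x → rot n (x , i)) (swp-right k)) (rot-< i (ℕₚ.n<1+n k))))))
    main (no _) (yes refl) = trans (cong (step̂ n Fin.zero) (rot-< i (ℕₚ.n<1+n k)))
        (trans (step-last (s≤s z≤n) i)
          (sym (trans (cong (λ x → rot n (x , i)) (swp-left k)) (rot-last n i))))
    main (no a≢n) (no a≢k) = trans (cong (step̂ n Fin.zero) (rot-< i (ℕₚ.≤∧≢⇒< a≤n a≢n)))
        (trans (step-other (s≤s z≤n) i (λ ()) (a≢k ∘ ℕₚ.suc-injective))
          (sym (trans (cong (λ x → rot n (x , i)) (swp-other k a a≢k a≢n)) (rot-< i (ℕₚ.≤∧≢⇒< a≤n a≢n)))))

-- The ideal of a shuffle of rows and columns

rotBy : ℕ → ℕ → ℕ × ℤ → ℕ × ℤ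
rotBy n zero    x = x
rotBy n (suc j) x = rot n (rotBy n j x)

rotBy-bounded : ∀ {n} j {x} → proj₁ x ≤ n → proj₁ (rotBy n j x) ≤ n
rotBy-bounded zero    x≤n = x≤n
rotBy-bounded (suc j) x≤n = rot-bounded (rotBy-bounded j x≤n)

rotBy-≻ : ∀ {n} j {x y} → proj₁ x ≤ n → proj₁ y ≤ n → x ≻ y → rotBy n j x ≻ rotBy n j y
rotBy-≻ zero    _   _   x≻y = x≻y
rotBy-≻ (suc j) x≤n y≤n x≻y = rot-≻ (rotBy-bounded j x≤n) (rotBy-bounded j y≤n) (rotBy-≻ j x≤n y≤n x≻y)

rotBy-≻⁻ : ∀ {n} j {x y} → proj₁ x ≤ n → proj₁ y ≤ n → rotBy n j x ≻ rotBy n j y → x ≻ y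
rotBy-≻⁻ j {x} {y} x≤n y≤n gt with ≻-cmp x y
... | inj₁ x≻y         = x≻y
... | inj₂ (inj₁ refl) = ⊥-elim (≻-irrefl gt)
... | inj₂ (inj₂ y≻x)  = ⊥-elim (≻-irrefl (≻-trans gt (rotBy-≻ j y≤n x≤n y≻x)))

rotBy-+ : ∀ {n} j k i → k ℕ.+ j ≤ n → rotBy n j (k , i) ≡ (k ℕ.+ j , i)
rotBy-+ zero    k i _  = cong (_, i) (sym (ℕₚ.+-identityʳ k))
rotBy-+ {n} (suc j) k i le = trans (cong (rot n) (rotBy-+ j k i (ℕₚ.<⇒≤ lt)))
  (trans (rot-< i lt) (cong (_, i) (sym (ℕₚ.+-suc k j))))
  where
  lt : k ℕ.+ j < n
  lt = ℕₚ.≤-trans (ℕₚ.≤-reflexive (sym (ℕₚ.+-suc k j))) le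

rotBy-∘ : ∀ {n} j l x → rotBy n (j ℕ.+ l) x ≡ rotBy n j (rotBy n l x)
rotBy-∘ zero    l x = refl
rotBy-∘ {n} (suc j) l x = cong (rot n) (rotBy-∘ j l x)

-- Of the `p + 1` rotations, `p - a` lead to index `n`, one wraps to 0 at the cost of a `δ`, and `a`
-- more lead to `a`.
rotBy-wrap : ∀ {n} p a i → p ≤ n → a ≤ p → rotBy n (suc p) (n ℕ.∸ p ℕ.+ a , i) ≡ (a , ℤ.pred i)
rotBy-wrap {n} p a i p≤n a≤p =
  trans (cong (λ j → rotBy n j (n ℕ.∸ p ℕ.+ a , i)) p≡)
  (trans (rotBy-∘ a (suc (p ℕ.∸ a)) _)
  (trans (cong (rotBy n a) (trans (cong (rot n) (trans (rotBy-+ (p ℕ.∸ a) (n ℕ.∸ p ℕ.+ a) i (ℕₚ.≤-reflexive n≡))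
                               (cong (_, i) n≡)))
                           (rot-last n i)))
  (rotBy-+ a 0 (ℤ.pred i) (ℕₚ.≤-trans a≤p p≤n))))
  where
  p≡ : suc p ≡ a ℕ.+ suc (p ℕ.∸ a)
  p≡ = sym (trans (ℕₚ.+-suc a (p ℕ.∸ a)) (cong suc (ℕₚ.m+[n∸m]≡n a≤p)))
  n≡ : n ℕ.∸ p ℕ.+ a ℕ.+ (p ℕ.∸ a) ≡ n
  n≡ = trans (ℕₚ.+-assoc (n ℕ.∸ p) a (p ℕ.∸ a))
       (trans (cong (n ℕ.∸ p ℕ.+_) (ℕₚ.m+[n∸m]≡n a≤p)) (ℕₚ.m∸n+n≡m p≤n))

module _ {n : ℕ} (1≤n : 1 ≤ n) where

  actP : List (Fin (suc n)) → ℕ × ℤ → ℕ × ℤ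
  actP v (a , i) = τ v a , i ℤ.+ d v a

  private
    actP-∷ : ∀ h v x → actP (h ∷ v) x ≡ step̂ n h (actP v x)
    actP-∷ h v (a , i) = cong (τ (h ∷ v) a ,_) (sym (ℤₚ.+-assoc i (d v a) (ε̂ h (τ v a))))

  actP-rot : ∀ v x → proj₁ x ≤ n → actP (List.map (rotIndex 1≤n) v) (rot n x) ≡ rot n (actP v x)
  actP-rot [] x@(a , i) x≤n =
    trans (cong (proj₁ (rot n x) ,_) (ℤₚ.+-identityʳ _)) (cong (λ z → rot n (a , z)) (sym (ℤₚ.+-identityʳ i)))
  actP-rot (h ∷ v) x x≤n = trans (actP-∷ (rotIndex 1≤n h) (List.map (rotIndex 1≤n) v) (rot n x))
    (trans (cong (step̂ n (rotIndex 1≤n h)) (actP-rot v x x≤n))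
    (trans (rot-step 1≤n h (proj₂ (actP v x)) (τ-bounded 1≤n v x≤n))
      (cong (rot n) (sym (actP-∷ h v x)))))

  rotWord : ℕ → List (Fin (suc n)) → List (Fin (suc n))
  rotWord zero    v = v
  rotWord (suc j) v = List.map (rotIndex 1≤n) (rotWord j v)

  actP-rotBy : ∀ j v x → proj₁ x ≤ n → actP (rotWord j v) (rotBy n j x) ≡ rotBy n j (actP v x)
  actP-rotBy zero    v x x≤n = refl
  actP-rotBy (suc j) v x x≤n =
    trans (actP-rot (rotWord j v) (rotBy n j x) (rotBy-bounded j x≤n)) (cong (rot n) (actP-rotBy j v x x≤n))

  actP-finite : ∀ w a i → actP (List.map Fin.suc w) (a , i) ≡ (sg w a , i)
  actP-finite []      a i = cong (a ,_) (ℤₚ.+-identityʳ i)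
  actP-finite (h ∷ w) a i = trans (actP-∷ (Fin.suc h) (List.map Fin.suc w) (a , i))
    (trans (cong (step̂ n (Fin.suc h)) (actP-finite w a i)) (cong (sg (h ∷ w) a ,_) (ℤₚ.+-identityʳ i)))

private
  -- The flags `b`, `b′` mark rows, the numbers `u`, `u′` are places. For a positive affine root the
  -- two cases with `k = 0` will be impossible; the remaining one, a column minus a row plus `δ`,
  -- describes the cells of the ideal.
  decode-≻ : ∀ {u u′ k} (b b′ : Bool) → (u′ , ι b′) ≻ (u , + k ℤ.+ ι b) →
    (k ≡ 0 × b ≡ b′ × u′ < u) ⊎ (k ≡ 0 × b ≡ false × b′ ≡ true) ⊎ (k ≡ 1 × b ≡ false × b′ ≡ true × u′ < u)
  decode-≻ {k = zero}        true  true  (inj₂ (_ , lt)) = inj₁ (refl , refl , lt)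
  decode-≻ {k = zero}        false false (inj₂ (_ , lt)) = inj₁ (refl , refl , lt)
  decode-≻ {k = zero}        false true  _               = inj₂ (inj₁ (refl , refl , refl))
  decode-≻ {k = suc zero}    false true  (inj₂ (_ , lt)) = inj₂ (inj₂ (refl , refl , refl , lt))
  decode-≻ {k = zero}        true  true  (inj₁ (ℤ.+<+ (s≤s ())))
  decode-≻ {k = zero}        false false (inj₁ (ℤ.+<+ ()))
  decode-≻ {k = zero}        true  false (inj₁ (ℤ.+<+ ()))
  decode-≻ {k = zero}        true  false (inj₂ (() , _))
  decode-≻ {k = suc zero}    false true  (inj₁ (ℤ.+<+ (s≤s ())))
  decode-≻ {k = suc zero}    false false (inj₁ (ℤ.+<+ ()))
  decode-≻ {k = suc zero}    true  true  (inj₁ (ℤ.+<+ (s≤s ())))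
  decode-≻ {k = suc zero}    true  false (inj₁ (ℤ.+<+ ()))
  decode-≻ {k = suc (suc k)} true  true  (inj₁ (ℤ.+<+ (s≤s ())))
  decode-≻ {k = suc (suc k)} true  false (inj₁ (ℤ.+<+ ()))
  decode-≻ {k = suc (suc k)} false true  (inj₁ (ℤ.+<+ (s≤s ())))
  decode-≻ {k = suc (suc k)} false false (inj₁ (ℤ.+<+ ()))

module _ {n : ℕ} (i : Fin n) where

  private
    p : ℕ
    p = toℕ i
    p<n : p < n
    p<n = Finₚ.toℕ<n i

  -- Labels in the order in which the rotated word lists them: first the columns, then the rows.
  label : ℕ → ℕ
  label a = if a <ᵇ suc p then n ℕ.∸ p ℕ.+ a else a ℕ.∸ suc p

  label-bounded : ∀ {a} → a ≤ n → label a ≤ n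
  label-bounded {a} a≤n with a <ᵇ suc p in eq
  ... | true  = ℕₚ.≤-trans (ℕₚ.+-monoʳ-≤ (n ℕ.∸ p) (ℕ.s≤s⁻¹ (<ᵇ≡⇒< a (suc p) eq)))
                          (ℕₚ.≤-reflexive (ℕₚ.m∸n+n≡m (ℕₚ.<⇒≤ p<n)))
  ... | false = ℕₚ.≤-trans (ℕₚ.m∸n≤m a (suc p)) a≤n

module _ {n : ℕ} (i : Fin n) (w : List (Fin n)) where

  private
    p : ℕ
    p = toℕ i
    p<n : p < n
    p<n = Finₚ.toℕ<n i
    1≤n : 1 ≤ n
    1≤n = ℕₚ.≤-trans (s≤s z≤n) p<n

  place : ℕ → ℕ
  place a = sg w (label i a)

  place-bounded : ∀ {a} → a ≤ n → place a ≤ n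
  place-bounded a≤n = sg-bounded w (label-bounded i a≤n)

  affineWord : List (Fin (suc n))
  affineWord = rotWord 1≤n (suc p) (List.map Fin.suc w)

  private
    rotBy-label : ∀ {a} k → a ≤ n → rotBy n (suc p) (label i a , k ℤ.+ ι (a <ᵇ suc p)) ≡ (a , k)
    rotBy-label {a} k a≤n with a <ᵇ suc p in eq
    ... | true = trans (rotBy-wrap p a (k ℤ.+ + 1) (ℕₚ.<⇒≤ p<n) (ℕ.s≤s⁻¹ (<ᵇ≡⇒< a (suc p) eq)))
           (cong (a ,_) (lem k))
      where
      lem : ∀ k → -[1+ 0 ] ℤ.+ (k ℤ.+ + 1) ≡ k
      lem = solve-∀
    ... | false = trans (rotBy-+ (suc p) (a ℕ.∸ suc p) (k ℤ.+ + 0) (ℕₚ.≤-trans (ℕₚ.≤-reflexive a≡) a≤n))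
           (cong₂ _,_ a≡ (ℤₚ.+-identityʳ k))
      where
      a≡ : a ℕ.∸ suc p ℕ.+ suc p ≡ a
      a≡ = ℕₚ.m∸n+n≡m (<ᵇ≡⇒≤ a (suc p) eq)

  -- The conjugate of `w` by `p + 1` rotations: `(a , k)` is itself the rotation of
  -- `(label i a , k + ι (a <ᵇ suc p))`.
  actP-affineWord : ∀ {a} k → a ≤ n →
    actP 1≤n affineWord (a , k) ≡ rotBy n (suc p) (place a , k ℤ.+ ι (a <ᵇ suc p))
  actP-affineWord {a} k a≤n = trans (cong (actP 1≤n affineWord) (sym (rotBy-label k a≤n)))
    (trans (actP-rotBy 1≤n (suc p) (List.map Fin.suc w) _ (label-bounded i a≤n))
           (cong (rotBy n (suc p)) (actP-finite 1≤n w (label i a) _)))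

  module _ (mono : BlockMono n (suc p) place) (place-0 : place 0 ≡ 0) (place-n : place n ≡ n) where

    PathIdeal : Pred (E n) 0ℓ
    PathIdeal β = ∃[ a ] ∃[ b ] (a < suc p × suc p ≤ b × b ≤ n × place a < place b × β ≡ root (suc n) a b)

    pathIdeal-cell : ∀ {a b} → Cell PathIdeal a b → a < suc p × suc p ≤ b × place a < place b
    pathIdeal-cell {a} {b} (a<b , b≤n , c , c′ , c≤ , ≤c′ , c′≤n , lt , eq)
      with refl , refl ← r-injective (s≤s (ℕₚ.≤-trans (ℕₚ.<⇒≤ a<b) b≤n)) (s≤s b≤n)
             (s≤s (ℕₚ.≤-trans (ℕₚ.<⇒≤ (ℕₚ.<-≤-trans c≤ ≤c′)) c′≤n)) (s≤s c′≤n) (ℕₚ.<⇒≢ (ℕₚ.<-≤-trans c≤ ≤c′)) eq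
      = c≤ , ≤c′ , lt

    cell-pathIdeal : ∀ {a b} → a < suc p → suc p ≤ b → b ≤ n → place a < place b → Cell PathIdeal a b
    cell-pathIdeal a< ≤b b≤n lt = ℕₚ.<-≤-trans a< ≤b , b≤n , _ , _ , a< , ≤b , b≤n , lt , refl

    pathIdeal-positive : ∀ {β} → PathIdeal β → PosRoot n β
    pathIdeal-positive (a , b , a< , ≤b , b≤n , _ , eq) = a , b , ℕₚ.<-≤-trans a< ≤b , b≤n , eq

    private
      V : List (Fin (suc n))
      V = affineWord

      place-mono : ∀ {a b} → a ≤ b → b ≤ n → (a <ᵇ suc p) ≡ (b <ᵇ suc p) → place a ≤ place b
      place-mono a≤b b≤n same with ℕₚ.m≤n⇒m<n∨m≡n a≤b
      ... | inj₁ a<b  = ℕₚ.<⇒≤ (mono a<b b≤n same)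
      ... | inj₂ refl = ℕₚ.≤-refl

      negative⇒ : ∀ {a b} k → a ≤ n → b ≤ n → isAffPos n (⊝̂_ n (actŴ n V (root (suc n) a b , + k))) →
        (place b , ι (b <ᵇ suc p)) ≻ (place a , + k ℤ.+ ι (a <ᵇ suc p))
      negative⇒ {a} {b} k a≤n b≤n neg = rotBy-≻⁻ (suc p) (place-bounded b≤n) (place-bounded a≤n)
        (subst₂ _≻_ (trans (actP-affineWord (+ 0) b≤n)
                 (cong (λ z → rotBy n (suc p) (place b , z)) (ℤₚ.+-identityˡ _)))
               (actP-affineWord (+ k) a≤n)
          (negative⇒≻ 1≤n V (+ k) (+ 0) a≤n b≤n
            (subst (λ z → isAffPos n (⊝̂_ n (actŴ n V (root (suc n) a b , z)))) (sym (ℤₚ.+-identityʳ (+ k))) neg)))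

      negative⇐ : ∀ {a b} k → a ≤ n → b ≤ n → a ≢ b →
        (place b , ι (b <ᵇ suc p)) ≻ (place a , + k ℤ.+ ι (a <ᵇ suc p)) →
        isAffPos n (⊝̂_ n (actŴ n V (root (suc n) a b , + k)))
      negative⇐ {a} {b} k a≤n b≤n a≢b gt =
        subst (λ z → isAffPos n (⊝̂_ n (actŴ n V (root (suc n) a b , z)))) (ℤₚ.+-identityʳ (+ k))
          (≻⇒negative 1≤n V (+ k) (+ 0) a≤n b≤n a≢b
            (subst₂ _≻_ (sym (trans (actP-affineWord (+ 0) b≤n)
                 (cong (λ z → rotBy n (suc p) (place b , z)) (ℤₚ.+-identityˡ _))))
               (sym (actP-affineWord (+ k) a≤n))
               (rotBy-≻ (suc p) (place-bounded b≤n) (place-bounded a≤n) gt)))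

      inversion⇒δ−I : ∀ {a b} k → a ≤ n → b ≤ n → (k ≡ 0 → a < b) →
        isAffPos n (⊝̂_ n (actŴ n V (root (suc n) a b , + k))) → δminus n PathIdeal (root (suc n) a b , + k)
      inversion⇒δ−I {a} {b} k a≤n b≤n pos neg
        with decode-≻ (a <ᵇ suc p) (b <ᵇ suc p) (negative⇒ k a≤n b≤n neg)
      ... | inj₁ (k≡0 , same , lt) = ⊥-elim (ℕₚ.<-asym lt (mono (pos k≡0) b≤n same))
      ... | inj₂ (inj₁ (k≡0 , ea , eb)) = ⊥-elim (ℕₚ.<-asym (pos k≡0)
             (ℕₚ.<-≤-trans (<ᵇ≡⇒< b (suc p) eb) (<ᵇ≡⇒≤ a (suc p) ea)))
      ... | inj₂ (inj₂ (refl , ea , eb , lt)) = root (suc n) b a ,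
             (b , a , <ᵇ≡⇒< b (suc p) eb , <ᵇ≡⇒≤ a (suc p) ea , a≤n , lt , refl) ,
             cong (_, + 1) (sym (neg-r (suc n) b a))

      N⇒δ−I : ∀ {γ} → isAffPos n γ × isAffPos n (⊝̂_ n (actŴ n V γ)) → δminus n PathIdeal γ
      N⇒δ−I {_ , _} (inj₁ (pos , refl) , neg) with isPos⇒PosRoot pos
      ... | a , b , a<b , b≤n , refl = inversion⇒δ−I 0 (ℕₚ.≤-trans (ℕₚ.<⇒≤ a<b) b≤n) b≤n (λ _ → a<b) neg
      N⇒δ−I {_ , + suc k} (inj₂ (isR , _) , neg) with isRoot⇒r isR
      ... | a , b , a≢b , a≤n , b≤n , refl = inversion⇒δ−I (suc k) a≤n b≤n (λ ()) neg
      N⇒δ−I {_ , + zero} (inj₂ (isR , ℤ.+≤+ ()) , neg)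

      δ−I⇒N : ∀ {γ} → δminus n PathIdeal γ → isAffPos n γ × isAffPos n (⊝̂_ n (actŴ n V γ))
      δ−I⇒N (_ , (a , b , a< , ≤b , b≤n , lt , refl) , refl) =
        subst (λ β → isAffPos n (β , + 1) × isAffPos n (⊝̂_ n (actŴ n V (β , + 1)))) (sym (neg-r (suc n) a b))
          ( ≻⇒isAffPos {i = + 1} {j = + 0} b≤n a≤n b≢a (inj₁ (ℤ.+<+ (s≤s z≤n)))
          , negative⇐ 1 b≤n a≤n b≢a (inj₂ (heights , lt)))
        where
        a<b = ℕₚ.<-≤-trans a< ≤b
        a≤n = ℕₚ.≤-trans (ℕₚ.<⇒≤ a<b) b≤n
        b≢a = ℕₚ.>⇒≢ a<b
        heights : ι (a <ᵇ suc p) ≡ + 1 ℤ.+ ι (b <ᵇ suc p)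
        heights rewrite <⇒<ᵇ≡ a< | ≤⇒<ᵇ≡ ≤b = refl

      -- This is where the first and last places count: `(n , 2)` wraps at the first rotation and
      -- ends at `(p , 1)`, while `(0 , 1)` does not wrap and ends at `(p + 1 , 1)`.
      highest : actŴ n V (⊝_ n (θ n) , + 2) ≡ (α n i , + 0)
      highest = trans (cong (λ β → actŴ n V (β , + 2)) (trans (cong negv (θ≡r n)) (neg-r (suc n) 0 n)))
        (trans (actŴ-r 1≤n V (+ 2) (+ 0) ℕₚ.≤-refl z≤n)
        (trans (cong₂ (λ x y → root (suc n) (proj₁ x) (proj₁ y) , proj₂ x ℤ.- proj₂ y) end start)
               (cong (_, + 0) (sym (α≡r n i)))))
        where
        end : actP 1≤n V (n , + 2) ≡ (p , + 1)
        end = trans (actP-affineWord (+ 2) ℕₚ.≤-refl)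
          (trans (cong₂ (λ x b → rotBy n (suc p) (x , + 2 ℤ.+ ι b)) place-n (≤⇒<ᵇ≡ p<n))
          (trans (cong (λ j → rotBy n j (n , + 2)) (ℕₚ.+-comm 1 p))
          (trans (rotBy-∘ p 1 (n , + 2))
          (trans (cong (rotBy n p) (rot-last n (+ 2))) (rotBy-+ p 0 (+ 1) (ℕₚ.<⇒≤ p<n))))))
        start : actP 1≤n V (0 , + 0) ≡ (suc p , + 1)
        start = trans (actP-affineWord (+ 0) z≤n)
          (trans (cong (λ x → rotBy n (suc p) (x , + 1)) place-0) (rotBy-+ (suc p) 0 (+ 1) p<n))

      lincombOver : Vec ℕ n → List (Fin n) → Vec ℤ (suc n)
      lincombOver c = List.foldr (λ h acc → _⊕_ n (_·_ n (+ Vec.lookup c h) (α n h)) acc) (𝟎 n)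

      psum-lincomb : ∀ k (c : Vec ℕ n) hs → + 0 ℤ.≤ psum k (lincombOver c hs)
      psum-lincomb k c [] = ℤₚ.≤-reflexive (sym (psum-zero (suc n) k))
      psum-lincomb k c (h ∷ hs) = subst (+ 0 ℤ.≤_) (sym (psum-+ k (_·_ n (+ Vec.lookup c h) (α n h)) (lincombOver c hs)))
        (ℤₚ.+-mono-≤ {+ 0} {_} {+ 0} term (psum-lincomb k c hs))
        where
        simple : + 0 ℤ.≤ psum k (α n h)
        simple with psum-pos k (ℕₚ.n<1+n (toℕ h)) (Finₚ.toℕ<n h)
        ... | inj₁ (_ , _ , e) = subst (+ 0 ℤ.≤_) (sym (trans (cong (psum k) (α≡r n h)) e)) (ℤ.+≤+ z≤n)
        ... | inj₂ (_ , e)     = subst (+ 0 ℤ.≤_) (sym (trans (cong (psum k) (α≡r n h)) e)) (ℤ.+≤+ z≤n)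
        term : + 0 ℤ.≤ psum k (_·_ n (+ Vec.lookup c h) (α n h))
        term = subst₂ ℤ._≤_ (ℤₚ.*-zeroʳ (+ Vec.lookup c h)) (sym (psum-scale k (+ Vec.lookup c h) (α n h)))
          (ℤₚ.*-monoˡ-≤-nonNeg (+ Vec.lookup c h) simple)

      -- A nonnegative combination of simple roots has nonnegative partial sums, so the partial sum
      -- of the larger root cannot be 0 where that of the smaller is 1.
      support : ∀ {a b c d} k → b ≤ n → c < d → d ≤ n → _≼_ n (root (suc n) a b) (root (suc n) c d) →
        a < k → k ≤ b → c < k × k ≤ d
      support {a} {b} {c} {d} k b≤n c<d d≤n (cs , eq) a<k k≤b with psum-pos k c<d d≤n
      ... | inj₁ (p , q , _) = p , q
      ... | inj₂ (_ , e) with () ← subst (+ 0 ℤ.≤_) (trans (cong (psum k) (sym eq))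
             (trans (psum-minus k (root (suc n) c d) (root (suc n) a b)) (cong₂ ℤ._-_ e (psum-inside k a<k k≤b b≤n))))
             (psum-lincomb k cs (List.allFin n))

      upward : ∀ β γ → PathIdeal β → isPos n γ → _≼_ n β γ → PathIdeal γ
      upward β γ (a , b , a< , ≤b , b≤n , lt , refl) pos le with isPos⇒PosRoot pos
      ... | c , d , c<d , d≤n , refl = c , d , ℕₚ.≤-<-trans c≤a a< , ℕₚ.≤-trans ≤b b≤d , d≤n ,
            ℕₚ.≤-<-trans (place-mono c≤a a≤n (trans (<⇒<ᵇ≡ (ℕₚ.≤-<-trans c≤a a<)) (sym (<⇒<ᵇ≡ a<))))
              (ℕₚ.<-≤-trans lt (place-mono b≤d d≤n (trans (≤⇒<ᵇ≡ ≤b) (sym (≤⇒<ᵇ≡ (ℕₚ.≤-trans ≤b b≤d)))))) , refl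
        where
        a<b = ℕₚ.<-≤-trans a< ≤b
        a≤n = ℕₚ.≤-trans (ℕₚ.<⇒≤ a<b) b≤n
        c≤a : c ≤ a
        c≤a = ℕ.s≤s⁻¹ (proj₁ (support (suc a) b≤n c<d d≤n le ℕₚ.≤-refl a<b))
        b≤d : b ≤ d
        b≤d = proj₂ (support b b≤n c<d d≤n le a<b ℕₚ.≤-refl)

      -- β + γ has partial sum 2 up to p, roots have partial sums at most 1.
      abelian : ∀ β γ → PathIdeal β → PathIdeal γ → ¬ isRoot n (_⊕_ n β γ)
      abelian β γ (a , b , a< , ≤b , b≤n , _ , refl) (a′ , b′ , a′< , ≤b′ , b′≤n , _ , refl) isR
        with isRoot⇒r isR
      ... | c , d , _ , c≤n , d≤n , eq = bound (c <ᵇ suc p) (d <ᵇ suc p)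
            (trans (sym (trans (psum-+ (suc p) (root (suc n) a b) (root (suc n) a′ b′))
                          (cong₂ ℤ._+_ (psum-inside (suc p) a< ≤b b≤n) (psum-inside (suc p) a′< ≤b′ b′≤n))))
                   (trans (cong (psum (suc p)) eq) (psum-r (s≤s c≤n) (s≤s d≤n) (suc p))))
        where
        bound : ∀ x y → + 2 ≢ ι x ℤ.- ι y
        bound true  true  ()
        bound true  false ()
        bound false true  ()
        bound false false ()

    pathIdeal-iab : Iab n PathIdeal (α n i)
    pathIdeal-iab =
      ((λ β → λ { (a , b , a< , ≤b , b≤n , _ , refl) → r-isPos (ℕₚ.<-≤-trans a< ≤b) b≤n }) , upward , abelian) ,
      -- `Iab` applies the reversed word, that is, the inverse of the element; `V` is this inverse.
      reverse V ,
      ( (λ {γ} (pos , neg) → N⇒δ−I (pos , subst (λ u → isAffPos n (⊝̂_ n (actŴ n u γ))) (reverse-involutive V) neg))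
      , (λ {γ} mem → proj₁ (δ−I⇒N mem) ,
           subst (λ u → isAffPos n (⊝̂_ n (actŴ n u γ))) (sym (reverse-involutive V)) (proj₂ (δ−I⇒N mem)))) ,
      trans (cong (λ u → actŴ n u (⊝_ n (θ n) , + 2)) (reverse-involutive V)) highest

-- Lattice paths

Unique⇒lookup-injective : ∀ {A : Set} {xs : List A} → Unique xs → ∀ {i j} →
  List.lookup xs i ≡ List.lookup xs j → i ≡ j
Unique⇒lookup-injective (_ AllPairs.∷ _) {Fin.zero}  {Fin.zero}  _  = refl
Unique⇒lookup-injective (x∉ AllPairs.∷ _) {Fin.zero}  {Fin.suc j} eq = ⊥-elim (All.lookup x∉ (∈-lookup j) eq)
Unique⇒lookup-injective (x∉ AllPairs.∷ _) {Fin.suc i} {Fin.zero}  eq = ⊥-elim (All.lookup x∉ (∈-lookup i) (sym eq))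
Unique⇒lookup-injective (_ AllPairs.∷ u) {Fin.suc i} {Fin.suc j} eq = cong Fin.suc (Unique⇒lookup-injective u eq)

injective⇒surjective : ∀ {n} (f : Fin n → Fin n) → (∀ {i j} → f i ≡ f j → i ≡ j) → ∀ k → ∃[ j ] f j ≡ k
injective⇒surjective {suc m} f inj k with Finₚ.any? (λ j → f j Fin.≟ k)
... | yes hit = hit
... | no miss = ⊥-elim (ℕₚ.1+n≰n (Finₚ.injective⇒≤ {f = λ j → Fin.punchOut {i = k} (λ e → miss (j , sym e))}
        λ {i} {j} e → inj (Finₚ.punchOut-injective {i = k} _ _ e)))

-- `f k` and `g k` count the row and column steps before cell `k`, which is `(f k , g k + p + 1)`
-- for `k < n`. The `n + 1` letters are row 0 at position 0 and one letter per step; `f-last` makes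
-- the additional last step flat, which places column `n` at position `n`.
module Path {n : ℕ} (i : Fin n) (f : ℕ → ℕ) (f-0 : f 0 ≡ 0) (f-n : f n ≡ toℕ i)
  (f-step : ∀ k → f (suc k) ≡ f k ⊎ f (suc k) ≡ suc (f k))
  (f-last : ∀ {m} → suc m ≡ n → f m ≡ toℕ i) where

  private
    p : ℕ
    p = toℕ i
    p<n : p < n
    p<n = Finₚ.toℕ<n i

  g : ℕ → ℕ
  g k = k ℕ.∸ f k

  f≤ : ∀ k → f k ≤ k
  f≤ zero = ℕₚ.≤-reflexive f-0
  f≤ (suc k) with f-step k
  ... | inj₁ e = ℕₚ.≤-trans (ℕₚ.≤-reflexive e) (ℕₚ.m≤n⇒m≤1+n (f≤ k))
  ... | inj₂ e = ℕₚ.≤-trans (ℕₚ.≤-reflexive e) (s≤s (f≤ k))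

  f+g : ∀ k → f k ℕ.+ g k ≡ k
  f+g k = ℕₚ.m+[n∸m]≡n (f≤ k)

  g-flat : ∀ k → f (suc k) ≡ f k → g (suc k) ≡ suc (g k)
  g-flat k e = trans (cong (suc k ℕ.∸_) e) (ℕₚ.+-∸-assoc 1 (f≤ k))

  g-rise : ∀ k → f (suc k) ≡ suc (f k) → g (suc k) ≡ g k
  g-rise k e = cong (suc k ℕ.∸_) e

  f-mono : ∀ {j k} → j ≤ k → f j ≤ f k
  f-mono {j} {k} j≤k with ℕₚ.m≤n⇒m<n∨m≡n j≤k
  ... | inj₂ refl = ℕₚ.≤-refl
  f-mono {j} {suc k} _ | inj₁ (s≤s j≤k) with f-step k
  ... | inj₁ e = ℕₚ.≤-trans (f-mono j≤k) (ℕₚ.≤-reflexive (sym e))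
  ... | inj₂ e = ℕₚ.≤-trans (f-mono j≤k) (ℕₚ.≤-trans (ℕₚ.n≤1+n _) (ℕₚ.≤-reflexive (sym e)))

  g-mono : ∀ {j k} → j ≤ k → g j ≤ g k
  g-mono {j} {k} j≤k with ℕₚ.m≤n⇒m<n∨m≡n j≤k
  ... | inj₂ refl = ℕₚ.≤-refl
  g-mono {j} {suc k} _ | inj₁ (s≤s j≤k) with f-step k
  ... | inj₁ e = ℕₚ.≤-trans (g-mono j≤k) (ℕₚ.≤-trans (ℕₚ.n≤1+n _) (ℕₚ.≤-reflexive (sym (g-flat k e))))
  ... | inj₂ e = ℕₚ.≤-trans (g-mono j≤k) (ℕₚ.≤-reflexive (sym (g-rise k e)))

  g-n : g n ≡ n ℕ.∸ p
  g-n = cong (n ℕ.∸_) f-n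

  f≤p : ∀ {k} → k ≤ n → f k ≤ p
  f≤p k≤n = ℕₚ.≤-trans (f-mono k≤n) (ℕₚ.≤-reflexive f-n)

  -- The label placed at each position: a row when the path rises, a column when it is flat.
  labelAt : ℕ → ℕ
  labelAt zero    = n ℕ.∸ p
  labelAt (suc k) with f-step k
  ... | inj₁ _ = g k
  ... | inj₂ _ = n ℕ.∸ p ℕ.+ f (suc k)

  private
    RowAt ColumnAt : ℕ → Set
    RowAt j    = labelAt j ≡ n ℕ.∸ p ℕ.+ f j × (∀ {k} → k < j → f k < f j)
    ColumnAt j = ∃[ j′ ] (j ≡ suc j′ × labelAt j ≡ g j′ × g j ≡ suc (g j′))

    classify : ∀ j → RowAt j ⊎ ColumnAt j
    classify zero = inj₁ (trans (sym (ℕₚ.+-identityʳ _)) (cong (n ℕ.∸ p ℕ.+_) (sym f-0)) , λ ())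
    classify (suc k) with f-step k
    ... | inj₁ e = inj₂ (k , refl , refl , g-flat k e)
    ... | inj₂ e = inj₁ (refl , λ { (s≤s le) → ℕₚ.≤-trans (s≤s (f-mono le)) (ℕₚ.≤-reflexive (sym e)) })

    row≥ : ∀ {j} → RowAt j → n ℕ.∸ p ≤ labelAt j
    row≥ (e , _) = ℕₚ.≤-trans (ℕₚ.m≤m+n _ _) (ℕₚ.≤-reflexive (sym e))

    column< : ∀ {j} → j ≤ n → ColumnAt j → labelAt j < n ℕ.∸ p
    column< j≤n (j′ , refl , e , e′) =
      ℕₚ.≤-trans (ℕₚ.≤-reflexive (trans (cong suc e) (sym e′))) (ℕₚ.≤-trans (g-mono j≤n) (ℕₚ.≤-reflexive g-n))

    labelAt-bounded : ∀ {j} → j ≤ n → labelAt j ≤ n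
    labelAt-bounded {j} j≤n with classify j
    ... | inj₁ (e , _) = ℕₚ.≤-trans (ℕₚ.≤-reflexive e)
          (ℕₚ.≤-trans (ℕₚ.+-monoʳ-≤ (n ℕ.∸ p) (f≤p j≤n)) (ℕₚ.≤-reflexive (ℕₚ.m∸n+n≡m (ℕₚ.<⇒≤ p<n))))
    ... | inj₂ c = ℕₚ.≤-trans (ℕₚ.<⇒≤ (column< j≤n c)) (ℕₚ.m∸n≤m n p)

    labelAt-mono : ∀ {j k} → j < k → k ≤ n → (labelAt j <ᵇ n ℕ.∸ p) ≡ (labelAt k <ᵇ n ℕ.∸ p) →
      labelAt j < labelAt k
    labelAt-mono {j} {k} j<k k≤n same with classify j | classify k
    ... | inj₁ (e , _) | inj₁ (e′ , lt) = subst₂ _<_ (sym e) (sym e′) (ℕₚ.+-monoʳ-< (n ℕ.∸ p) (lt j<k))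
    ... | inj₂ (j′ , refl , e , e₁) | inj₂ (k′ , refl , e′ , _) =
      subst₂ _<_ (sym e) (sym e′) (ℕₚ.≤-trans (ℕₚ.≤-reflexive (sym e₁)) (g-mono (ℕ.s≤s⁻¹ j<k)))
    ... | inj₁ row | inj₂ column
      with () ← trans (sym (≤⇒<ᵇ≡ (row≥ row))) (trans same (<⇒<ᵇ≡ (column< k≤n column)))
    ... | inj₂ column | inj₁ row
      with () ← trans (sym (<⇒<ᵇ≡ (column< (ℕₚ.≤-trans (ℕₚ.<⇒≤ j<k) k≤n) column))) (trans same (≤⇒<ᵇ≡ (row≥ row)))

    sorting : ∃[ w ] (∀ {a} → a ≤ n → labelAt (sg {n} w a) ≡ a)
    sorting = blockSort (n ℕ.∸ p) labelAt labelAt-bounded labelAt-mono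

  word : List (Fin n)
  word = proj₁ sorting

  pos : ℕ → ℕ
  pos = place i word

  private
    labelAt-pos : ∀ {a} → a ≤ n → labelAt (pos a) ≡ label i a
    labelAt-pos a≤n = proj₂ sorting (label-bounded i a≤n)

    label-row : ∀ {a} → a ≤ p → label i a ≡ n ℕ.∸ p ℕ.+ a
    label-row a≤p rewrite <⇒<ᵇ≡ (s≤s a≤p) = refl

    label-column : ∀ {b} → p < b → label i b ≡ b ℕ.∸ suc p
    label-column p<b rewrite ≤⇒<ᵇ≡ p<b = refl

    -- A row is placed at the first position at which the path reaches it, a column (`pos-column`)
    -- right after the last cell before the path leaves that column.
    pos-row : ∀ {a} → a ≤ p → f (pos a) ≡ a × (∀ {k} → k < pos a → f k < a)
    pos-row {a} a≤p with classify (pos a) | trans (labelAt-pos (ℕₚ.≤-trans a≤p (ℕₚ.<⇒≤ p<n))) (label-row a≤p)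
    ... | inj₂ column | e = ⊥-elim (ℕₚ.<⇒≱
          (column< (place-bounded i word (ℕₚ.≤-trans a≤p (ℕₚ.<⇒≤ p<n))) column)
          (ℕₚ.≤-trans (ℕₚ.m≤m+n _ a) (ℕₚ.≤-reflexive (sym e))))
    ... | inj₁ (e₁ , lt) | e = fa , λ k< → ℕₚ.<-≤-trans (lt k<) (ℕₚ.≤-reflexive fa)
      where
      fa = ℕₚ.+-cancelˡ-≡ (n ℕ.∸ p) _ _ (trans (sym e₁) e)

    pos-column : ∀ {b} → p < b → b ≤ n →
      ∃[ j ] (pos b ≡ suc j × g j ≡ b ℕ.∸ suc p × g (pos b) ≡ suc (b ℕ.∸ suc p))
    pos-column {b} p<b b≤n with classify (pos b) | trans (labelAt-pos b≤n) (label-column p<b)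
    ... | inj₁ row | e = ⊥-elim (ℕₚ.<⇒≱ (ℕₚ.∸-monoˡ-< (s≤s b≤n) p<b)
          (ℕₚ.≤-trans (row≥ row) (ℕₚ.≤-reflexive e)))
    ... | inj₂ (j , e₁ , e₂ , e₃) | e = j , e₁ , trans (sym e₂) e , trans e₃ (cong suc (trans (sym e₂) e))

  -- Together with `pos-<⇐`: the ideal is the up-set generated by the path cells. The witness is
  -- `pos a`, the index of the first path cell in row `a`.
  pos-<⇒ : ∀ {a b} → a ≤ p → p < b → b ≤ n → pos a < pos b → ∃[ k ] (k < n × a ≤ f k × g k ≤ b ℕ.∸ suc p)
  pos-<⇒ {a} {b} a≤p p<b b≤n lt with pos-column p<b b≤n
  ... | j , e , gj , _ = pos a , ℕₚ.<-≤-trans lt (place-bounded i word b≤n) ,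
        ℕₚ.≤-reflexive (sym (proj₁ (pos-row a≤p))) ,
        ℕₚ.≤-trans (g-mono (ℕ.s≤s⁻¹ (ℕₚ.<-≤-trans lt (ℕₚ.≤-reflexive e)))) (ℕₚ.≤-reflexive gj)

  pos-<⇐ : ∀ {a b} k → a ≤ p → p < b → b ≤ n → a ≤ f k → g k ≤ b ℕ.∸ suc p → pos a < pos b
  pos-<⇐ {a} {b} k a≤p p<b b≤n a≤fk gk≤ = ℕₚ.≤-<-trans
    (ℕₚ.≮⇒≥ λ k< → ℕₚ.<⇒≱ (proj₂ (pos-row a≤p) k<) a≤fk)
    (ℕₚ.≰⇒> λ le → ℕₚ.1+n≰n (ℕₚ.≤-trans
      (ℕₚ.≤-trans (ℕₚ.≤-reflexive (sym (proj₂ (proj₂ (proj₂ (pos-column p<b b≤n)))))) (g-mono le)) gk≤))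

  pos-blockMono : BlockMono n (suc p) pos
  pos-blockMono {a} {b} a<b b≤n same with a ℕ.≤? p
  ... | yes a≤p = ℕₚ.≰⇒> λ le → ℕₚ.<⇒≱ a<b (subst₂ _≤_ (proj₁ (pos-row b≤p)) (proj₁ (pos-row a≤p)) (f-mono le))
    where
    b≤p : b ≤ p
    b≤p = ℕ.s≤s⁻¹ (<ᵇ≡⇒< b (suc p) (trans (sym same) (<⇒<ᵇ≡ (s≤s a≤p))))
  ... | no a≰p = ℕₚ.≰⇒> λ le → ℕₚ.<⇒≱ a<b
      (subst₂ _≤_ (ℕₚ.m∸n+n≡m p<b) (ℕₚ.m∸n+n≡m p<a) (ℕₚ.+-monoˡ-≤ (suc p) (ℕ.s≤s⁻¹
        (subst₂ _≤_ (proj₂ (proj₂ (proj₂ (pos-column p<b b≤n))))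
                    (proj₂ (proj₂ (proj₂ (pos-column p<a (ℕₚ.≤-trans (ℕₚ.<⇒≤ a<b) b≤n))))) (g-mono le)))))
    where
    p<a : p < a
    p<a = ℕₚ.≰⇒> a≰p
    p<b : p < b
    p<b = ℕₚ.<-trans p<a a<b

  pos-0 : pos 0 ≡ 0
  pos-0 with pos 0 | proj₂ (pos-row {0} z≤n)
  ... | zero  | _  = refl
  ... | suc j | lt with () ← lt {0} (s≤s z≤n)

  pos-n : pos n ≡ n
  pos-n = trans (cong (sg word) (trans (label-column p<n) (trans (sym (labelAt-n n refl)) labelAt≡pi))) (sg-pi word n)
    where
    labelAt-n : ∀ m → m ≡ n → labelAt m ≡ m ℕ.∸ suc p
    labelAt-n zero    refl = ⊥-elim (ℕₚ.n≮0 p<n)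
    labelAt-n (suc m) refl with f-step m
    ... | inj₁ _ = cong (m ℕ.∸_) (f-last refl)
    ... | inj₂ e = ⊥-elim (ℕₚ.1+n≢n (trans (sym e) (trans f-n (sym (f-last refl)))))
    labelAt≡pi : labelAt n ≡ pi word n
    labelAt≡pi = trans (cong labelAt (sym (sg-pi word n))) (proj₂ sorting (pi-bounded word ℕₚ.≤-refl))

  ideal : Pred (E n) 0ℓ
  ideal = PathIdeal i word pos-blockMono pos-0 pos-n

  ideal-iab : Iab n ideal (α n i)
  ideal-iab = pathIdeal-iab i word pos-blockMono pos-0 pos-n

  ideal-positive : ∀ {β} → ideal β → PosRoot n β
  ideal-positive = pathIdeal-positive i word pos-blockMono pos-0 pos-n

  private
    cell⇒ : ∀ {a b} → Cell ideal a b → a ≤ p × p < b × ∃[ k ] (k < n × a ≤ f k × g k ≤ b ℕ.∸ suc p)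
    cell⇒ c@(_ , b≤n , _) with pathIdeal-cell i word pos-blockMono pos-0 pos-n c
    ... | s≤s a≤p , p<b , lt = a≤p , p<b , pos-<⇒ a≤p p<b b≤n lt

    cell⇐ : ∀ {a b} k → a ≤ p → p < b → b ≤ n → a ≤ f k → g k ≤ b ℕ.∸ suc p → Cell ideal a b
    cell⇐ k a≤p p<b b≤n a≤ ≤b = cell-pathIdeal i word pos-blockMono pos-0 pos-n (s≤s a≤p) p<b b≤n
      (pos-<⇐ k a≤p p<b b≤n a≤ ≤b)

    f<⇒< : ∀ {j k} → f j < f k → j < k
    f<⇒< lt = ℕₚ.≰⇒> λ le → ℕₚ.<⇒≱ lt (f-mono le)

    g<⇒< : ∀ {j k} → g j < g k → j < k
    g<⇒< lt = ℕₚ.≰⇒> λ le → ℕₚ.<⇒≱ lt (g-mono le)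

    shrink : ∀ {x b} → x < b ℕ.∸ p → x ≤ b ℕ.∸ suc p
    shrink {x} {b} lt = subst (x ≤_) (ℕₚ.pred[m∸n]≡m∸[1+n] b p) (ℕₚ.<⇒≤pred lt)

    nonempty : ∀ {x b} → x < b ℕ.∸ p → p < b
    nonempty {x} {b} lt = ℕₚ.≰⇒> λ b≤p → ℕₚ.n≮0 (subst (x <_) (ℕₚ.m≤n⇒m∸n≡0 b≤p) lt)

  -- A path cell generating the diagonal neighbour would have a larger `f` and a smaller `g`, hence
  -- come both later and earlier than cell `k`.
  path⇒rim : ∀ {k} → k < n → Rim ideal (f k) (g k ℕ.+ p)
  path⇒rim {k} k<n =
    cell⇐ k (f≤p (ℕₚ.<⇒≤ k<n)) (s≤s (ℕₚ.m≤n+m p (g k))) bound ℕₚ.≤-refl (ℕₚ.≤-reflexive (sym (ℕₚ.m+n∸n≡m (g k) p))) ,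
    corner
    where
    bound : suc (g k ℕ.+ p) ≤ n
    bound = below n refl
      where
      below : ∀ m → m ≡ n → g k ℕ.+ p < m
      below zero    refl = ⊥-elim (ℕₚ.n≮0 k<n)
      below (suc m) refl = s≤s (ℕₚ.≤-trans (ℕₚ.+-monoˡ-≤ p (g-mono (ℕ.s≤s⁻¹ k<n)))
        (ℕₚ.≤-reflexive (trans (cong (λ x → m ℕ.∸ x ℕ.+ p) (f-last refl)) (ℕₚ.m∸n+n≡m (ℕ.s≤s⁻¹ p<n)))))
    corner : ¬ Cell ideal (suc (f k)) (g k ℕ.+ p)
    corner c with cell⇒ c
    ... | _ , p<b , k′ , _ , fk< , gk′≤ = ℕₚ.<-asym (f<⇒< fk<) (g<⇒< (ℕₚ.≤-<-trans gk′≤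
          (ℕₚ.<-≤-trans (ℕₚ.∸-monoʳ-< (ℕₚ.n<1+n p) p<b) (ℕₚ.≤-reflexive (ℕₚ.m+n∸n≡m (g k) p)))))

  -- Compare with the path cell `k₀` on the same antidiagonal. If that lies lower, it generates the
  -- diagonal neighbour of the rim cell; if it lies higher, the path cell below the given one
  -- contradicts monotonicity.
  rim⇒path : ∀ {a b} → Rim ideal a b → ∃[ k ] (k < n × a ≡ f k × b ≡ g k ℕ.+ p)
  rim⇒path {a} {b} (c@(_ , b<n , _) , corner) with cell⇒ c
  ... | a≤p , s≤s p≤b , k , _ , a≤fk , gk≤ = k₀ , k₀<n , a≡ ,
        trans (sym (ℕₚ.m∸n+n≡m p≤b)) (cong (ℕ._+ p) (ℕₚ.+-cancelˡ-≡ a _ _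
          (trans (sym (f+g k₀)) (cong (ℕ._+ g k₀) (sym a≡)))))
    where
    k₀ : ℕ
    k₀ = a ℕ.+ (b ℕ.∸ p)
    k₀<n : k₀ < n
    k₀<n = ℕₚ.≤-<-trans (ℕₚ.≤-trans (ℕₚ.+-monoˡ-≤ (b ℕ.∸ p) a≤p) (ℕₚ.≤-reflexive (ℕₚ.m+[n∸m]≡n p≤b))) b<n
    a≡ : a ≡ f k₀
    a≡ with ℕₚ.<-cmp a (f k₀)
    ... | tri≈ _ e _ = e
    ... | tri< a< _ _ = ⊥-elim (corner (cell⇐ k₀ (ℕₚ.≤-trans a< (f≤p (ℕₚ.<⇒≤ k₀<n))) (nonempty g<)
            (ℕₚ.<⇒≤ b<n) a< (shrink g<)))
      where
      g< : g k₀ < b ℕ.∸ p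
      g< = ℕₚ.+-cancelˡ-< a _ _ (ℕₚ.<-≤-trans (ℕₚ.+-monoˡ-< (g k₀) a<) (ℕₚ.≤-reflexive (f+g k₀)))
    ... | tri> _ _ a> = ⊥-elim (ℕₚ.<-asym (f<⇒< (ℕₚ.<-≤-trans a> a≤fk)) (g<⇒< (ℕₚ.≤-<-trans gk≤ g>)))
      where
      g> : b ℕ.∸ p < g k₀
      g> = ℕₚ.+-cancelˡ-< a _ _ (ℕₚ.≤-<-trans (ℕₚ.≤-reflexive (sym (f+g k₀))) (ℕₚ.+-monoˡ-< (g k₀) a>))

-- From graphs to simplices

module _ {n : ℕ} (G : Graph n) (anti : AntiStandard n G) where

  private
    unique = proj₁ anti
    len = proj₁ (proj₂ anti)
    polar = proj₁ (proj₂ (proj₂ (proj₂ anti)))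
    chain = proj₂ (proj₂ (proj₂ (proj₂ anti)))

  isSource : Fin (suc n) → Bool
  isSource v with proj₁ (polar v)
  ... | inj₁ _ = true
  ... | inj₂ _ = false

  isSource-source : ∀ {s t} → (s , t) ∈ G → isSource s ≡ true
  isSource-source {s} {t} e with proj₁ (polar s)
  ... | inj₁ _   = refl
  ... | inj₂ tgt = ⊥-elim (proj₂ (polar s) ((t , e) , tgt))

  isSource-target : ∀ {s t} → (s , t) ∈ G → isSource t ≡ false
  isSource-target {s} {t} e with proj₁ (polar t)
  ... | inj₁ src = ⊥-elim (proj₂ (polar t) (src , (s , e)))
  ... | inj₂ _   = refl

  sourcesFirst : Sorted {n} (isSource ∘ fin n)
  sourcesFirst = sort (isSource ∘ fin n)

  module _ (i : Fin n) (q≡ : Sorted.q sourcesFirst ≡ suc (toℕ i)) where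

    private
      p : ℕ
      p = toℕ i
      p<n : p < n
      p<n = Finₚ.toℕ<n i
      module Σ₀ = Sorted sourcesFirst
      w : List (Fin n)
      w = Σ₀.word

      -- The place of a vertex in the list with sources first: a row number for a source, a column
      -- number for a target.
      rank : Fin (suc n) → ℕ
      rank v = pi w (toℕ v)

      rank≤n : ∀ v → rank v ≤ n
      rank≤n v = pi-bounded w (ℕ.s≤s⁻¹ (Finₚ.toℕ<n v))

      rank-injective : ∀ {u v} → rank u ≡ rank v → u ≡ v
      rank-injective {u} {v} eq = Finₚ.toℕ-injective
        (trans (sym (sg-pi w (toℕ u))) (trans (cong (sg w) eq) (sg-pi w (toℕ v))))

      rank-colour : ∀ v → isSource v ≡ (rank v <ᵇ suc p)
      rank-colour v = trans (sym (cong isSource (trans (cong (fin n) (sg-pi w (toℕ v))) (fin-toℕ v))))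
        (trans (Σ₀.colour (rank≤n v)) (cong (rank v <ᵇ_) q≡))

      source≤p : ∀ {s t} → (s , t) ∈ G → rank s ≤ p
      source≤p {s} e = ℕ.s≤s⁻¹ (<ᵇ≡⇒< (rank s) (suc p) (trans (sym (rank-colour s)) (isSource-source e)))

      p<target : ∀ {s t} → (s , t) ∈ G → p < rank t
      p<target {t = t} e = <ᵇ≡⇒≤ (rank t) (suc p) (trans (sym (rank-colour t)) (isSource-target e))

      mono : BlockMono n (suc p) (sg w)
      mono = subst (λ q → BlockMono n q (sg w)) q≡ Σ₀.mono

      rank-< : ∀ {u v} → rank u < rank v → isSource u ≡ isSource v → u Fin.< v
      rank-< {u} {v} lt same = subst₂ _<_ (sg-pi w (toℕ u)) (sg-pi w (toℕ v))
        (mono lt (rank≤n v) (trans (sym (rank-colour u)) (trans same (rank-colour v))))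

      rank-chain : ∀ {s t s′ t′} → (s , t) ∈ G → (s′ , t′) ∈ G → rank s < rank s′ → rank t ≤ rank t′
      rank-chain {s} {t} {s′} {t′} e e′ lt = ℕₚ.≮⇒≥ λ gt → ℕₚ.<⇒≱
        (rank-< gt (trans (isSource-target e′) (sym (isSource-target e))))
        (chain s t s′ t′ e e′ (rank-< lt (trans (isSource-source e) (sym (isSource-source e′)))))

      -- Condition (2) on the graph makes the edges a chain in the product order of ranks, and a
      -- chain meets each antidiagonal at most once.
      sameSum : ∀ {s t s′ t′} → (s , t) ∈ G → (s′ , t′) ∈ G →
        rank s ℕ.+ rank t ≡ rank s′ ℕ.+ rank t′ → rank s ≡ rank s′ × rank t ≡ rank t′
      sameSum {s} {t} {s′} {t′} e e′ eq with ℕₚ.<-cmp (rank s) (rank s′)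
      ... | tri< lt _ _ = ⊥-elim (ℕₚ.<⇒≢ (ℕₚ.+-mono-<-≤ lt (rank-chain e e′ lt)) eq)
      ... | tri≈ _ r≡ _ = r≡ , ℕₚ.+-cancelˡ-≡ (rank s) _ _ (trans eq (cong (ℕ._+ rank t′) (sym r≡)))
      ... | tri> _ _ gt = ⊥-elim (ℕₚ.>⇒≢ (ℕₚ.+-mono-<-≤ gt (rank-chain e′ e gt)) eq)

      edge : Fin n → Fin (suc n) × Fin (suc n)
      edge j = List.lookup G (Fin.cast (sym len) j)

      edge∈G : ∀ j → edge j ∈ G
      edge∈G j = ∈-lookup (Fin.cast (sym len) j)

      edge-injective : ∀ {j k} → edge j ≡ edge k → j ≡ k
      edge-injective {j} {k} eq = Finₚ.toℕ-injective
        (trans (sym (Finₚ.toℕ-cast (sym len) j))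
        (trans (cong toℕ (Unique⇒lookup-injective unique eq)) (Finₚ.toℕ-cast (sym len) k)))

      weight : Fin (suc n) × Fin (suc n) → ℕ
      weight (s , t) = rank s ℕ.+ rank t

      weight≥ : ∀ {s t} → (s , t) ∈ G → suc p ≤ weight (s , t)
      weight≥ {s} {t} e = ℕₚ.≤-trans (p<target e) (ℕₚ.m≤n+m (rank t) (rank s))

      -- Weights lie between `p + 1` and `p + n`. These are as many values as there are edges, so
      -- injectivity makes every level occur.
      level : Fin n → Fin n
      level j = Fin.fromℕ< {weight (edge j) ℕ.∸ suc p}
        (ℕₚ.m<n+o⇒m∸n<o _ (suc p) {n} ⦃ ℕ.>-nonZero (ℕₚ.≤-trans (s≤s z≤n) p<n) ⦄
          (s≤s (ℕₚ.+-mono-≤ (source≤p (edge∈G j)) (rank≤n (proj₂ (edge j))))))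

      level-weight : ∀ j → toℕ (level j) ℕ.+ suc p ≡ weight (edge j)
      level-weight j = trans (cong (ℕ._+ suc p) (Finₚ.toℕ-fromℕ< _)) (ℕₚ.m∸n+n≡m (weight≥ (edge∈G j)))

      level-injective : ∀ {j k} → level j ≡ level k → j ≡ k
      level-injective {j} {k} eq = edge-injective (cong₂ _,_ (rank-injective (proj₁ same)) (rank-injective (proj₂ same)))
        where
        same = sameSum (edge∈G j) (edge∈G k)
          (trans (sym (level-weight j)) (trans (cong (λ l → toℕ l ℕ.+ suc p) eq) (level-weight k)))

      edgeAt : ∀ {k} → k < n → ∃[ s ] ∃[ t ] ((s , t) ∈ G × rank s ℕ.+ rank t ≡ k ℕ.+ suc p)
      edgeAt {k} k<n = found (injective⇒surjective level level-injective (Fin.fromℕ< k<n))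
        where
        found : ∃[ j ] level j ≡ Fin.fromℕ< k<n → ∃[ s ] ∃[ t ] ((s , t) ∈ G × rank s ℕ.+ rank t ≡ k ℕ.+ suc p)
        found (j , eq) = proj₁ (edge j) , proj₂ (edge j) , edge∈G j , trans (sym (level-weight j)) (cong (ℕ._+ suc p) (trans (cong toℕ eq) (Finₚ.toℕ-fromℕ< k<n)))

      f : ℕ → ℕ
      f k with k ℕ.<? n
      ... | yes k<n = rank (proj₁ (edgeAt k<n))
      -- Beyond the last edge the path stays in row `p`, the row of the last edge; this makes the
      -- additional last step flat.
      ... | no _    = p

      f-edge : ∀ {k} → k < n → ∃[ s ] ∃[ t ] ((s , t) ∈ G × f k ≡ rank s × rank s ℕ.+ rank t ≡ k ℕ.+ suc p)
      f-edge {k} k<n with k ℕ.<? n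
      ... | yes k<n′ = proj₁ (edgeAt k<n′) , proj₁ (proj₂ (edgeAt k<n′)) ,
                       proj₁ (proj₂ (proj₂ (edgeAt k<n′))) , refl , proj₂ (proj₂ (proj₂ (edgeAt k<n′)))
      ... | no k≮n   = ⊥-elim (k≮n k<n)

      f-≥n : ∀ {k} → n ≤ k → f k ≡ p
      f-≥n {k} n≤k with k ℕ.<? n
      ... | yes k<n = ⊥-elim (ℕₚ.<⇒≱ k<n n≤k)
      ... | no _    = refl

      f-0 : f 0 ≡ 0
      f-0 with f-edge (ℕₚ.≤-trans (s≤s z≤n) p<n)
      ... | s , t , e , f≡ , sum = trans f≡ (ℕₚ.n≤0⇒n≡0 (ℕₚ.+-cancelʳ-≤ (suc p) (rank s) 0
              (ℕₚ.≤-trans (ℕₚ.+-monoʳ-≤ (rank s) (p<target e)) (ℕₚ.≤-reflexive sum))))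

      f-last : ∀ {m} → suc m ≡ n → f m ≡ p
      f-last {m} refl with f-edge (ℕₚ.n<1+n m)
      ... | s , t , e , f≡ , sum = trans f≡ (ℕₚ.≤-antisym (source≤p e) (ℕₚ.+-cancelʳ-≤ (suc m) p (rank s)
              (ℕₚ.≤-trans (ℕₚ.≤-reflexive (trans (ℕₚ.+-suc p m) (trans (cong suc (ℕₚ.+-comm p m))
                             (trans (sym (ℕₚ.+-suc m p)) (sym sum)))))
                          (ℕₚ.+-monoʳ-≤ (rank s) (rank≤n t)))))

      -- From one level to the next the weight grows by one and neither rank can fall, so exactly
      -- one of them rises, and by one.
      f-step : ∀ k → f (suc k) ≡ f k ⊎ f (suc k) ≡ suc (f k)
      f-step k with ℕₚ.<-cmp (suc k) n
      ... | tri≈ _ e _ = inj₁ (trans (f-≥n (ℕₚ.≤-reflexive (sym e))) (sym (f-last e)))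
      ... | tri> _ _ (s≤s n≤k) = inj₁ (trans (f-≥n (ℕₚ.m≤n⇒m≤1+n n≤k)) (sym (f-≥n n≤k)))
      ... | tri< k+1<n _ _ with f-edge (ℕₚ.<-trans (ℕₚ.n<1+n k) k+1<n) | f-edge k+1<n
      ... | s , t , e , f≡ , sum | s′ , t′ , e′ , f≡′ , sum′ with ℕₚ.<-cmp (rank s) (rank s′)
      ... | tri≈ _ r≡ _ = inj₁ (trans f≡′ (trans (sym r≡) (sym f≡)))
      ... | tri> _ _ gt = ⊥-elim (ℕₚ.<⇒≱ (ℕₚ.n<1+n (k ℕ.+ suc p))
              (subst₂ _≤_ sum′ sum (ℕₚ.+-mono-≤ (ℕₚ.<⇒≤ gt) (rank-chain e′ e gt))))
      ... | tri< lt _ _ with ℕₚ.m≤n⇒m<n∨m≡n lt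
      ... | inj₂ r≡ = inj₂ (trans f≡′ (trans (sym r≡) (cong suc (sym f≡))))
      ... | inj₁ lt′ = ⊥-elim (ℕₚ.<-irrefl refl (subst₂ _<_ (cong suc sum) sum′
              (ℕₚ.+-mono-<-≤ lt′ (rank-chain e e′ lt))))

      open Path i f f-0 (f-≥n ℕₚ.≤-refl) f-step f-last

      f-edge′ : ∀ {k} → k < n → ∃[ s ] ∃[ t ] ((s , t) ∈ G × f k ≡ rank s × suc (g k ℕ.+ p) ≡ rank t)
      f-edge′ {k} k<n with f-edge k<n
      ... | s , t , e , f≡ , sum = s , t , e , f≡ , sym (ℕₚ.+-cancelˡ-≡ (rank s) _ _ (trans sum
              (trans (cong (ℕ._+ suc p) (sym (f+g k))) (trans (ℕₚ.+-assoc (f k) (g k) (suc p))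
                (cong₂ ℕ._+_ f≡ (ℕₚ.+-suc (g k) p))))))

      -- The edge that `f` selects on this level has the same weight, hence the same ranks by
      -- `sameSum`.
      edge⇒path : ∀ {s t} → (s , t) ∈ G → ∃[ k ] (k < n × f k ≡ rank s × suc (g k ℕ.+ p) ≡ rank t)
      edge⇒path {s} {t} e = k , k<n , here′ (f-edge′ k<n)
        where
        k : ℕ
        k = weight (s , t) ℕ.∸ suc p
        k<n : k < n
        k<n = ℕₚ.m<n+o⇒m∸n<o _ (suc p) {n} ⦃ ℕ.>-nonZero (ℕₚ.≤-trans (s≤s z≤n) p<n) ⦄
                (s≤s (ℕₚ.+-mono-≤ (source≤p e) (rank≤n t)))
        here′ : ∃[ s′ ] ∃[ t′ ] ((s′ , t′) ∈ G × f k ≡ rank s′ × suc (g k ℕ.+ p) ≡ rank t′) →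
                f k ≡ rank s × suc (g k ℕ.+ p) ≡ rank t
        here′ (s′ , t′ , e′ , f≡ , g≡) = trans f≡ (proj₁ same) , trans g≡ (proj₂ same)
          where
          same = sameSum e′ e (trans (cong₂ ℕ._+_ (sym f≡) (sym g≡))
            (trans (cong (f k ℕ.+_) (sym (ℕₚ.+-suc (g k) p)))
            (trans (sym (ℕₚ.+-assoc (f k) (g k) (suc p)))
            (trans (cong (ℕ._+ suc p) (f+g k)) (ℕₚ.m∸n+n≡m (weight≥ e))))))

      edge-root : ∀ {k s t} → k < n → f k ≡ rank s → suc (g k ℕ.+ p) ≡ rank t →
        ρ n s t ≡ actW n w (root (suc n) (f k) (suc (g k ℕ.+ p)))
      edge-root {k} {s} {t} k<n f≡ g≡ = trans (ρ≡r n s t) (trans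
        (cong₂ (root (suc n)) (sym (trans (cong (sg w) f≡) (sg-pi w (toℕ s))))
                           (sym (trans (cong (sg w) g≡) (sg-pi w (toℕ t)))))
        (sym (actW-r w (ℕₚ.≤-trans (ℕₚ.≤-reflexive f≡) (rank≤n s)) (ℕₚ.≤-trans (ℕₚ.≤-reflexive g≡) (rank≤n t)))))

      edge⇒border : ∀ {s t} → (s , t) ∈ G → image n (actW n w) (Border n ideal) (ρ n s t)
      edge⇒border e = go (edge⇒path e)
        where
        go : ∀ {s t} → ∃[ k ] (k < n × f k ≡ rank s × suc (g k ℕ.+ p) ≡ rank t) →
             image n (actW n w) (Border n ideal) (ρ n s t)
        go (k , k<n , f≡ , g≡) = root (suc n) (f k) (suc (g k ℕ.+ p)) ,
          rim⇒border ideal ideal-positive (path⇒rim k<n) , edge-root k<n f≡ g≡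

      path-root : ∀ {k} → k < n → R n G (actW n w (root (suc n) (f k) (suc (g k ℕ.+ p))))
      path-root {k} k<n = go (f-edge′ k<n)
        where
        go : ∃[ s ] ∃[ t ] ((s , t) ∈ G × f k ≡ rank s × suc (g k ℕ.+ p) ≡ rank t) →
             R n G (actW n w (root (suc n) (f k) (suc (g k ℕ.+ p))))
        go (s , t , e , f≡ , g≡) = s , t , e , sym (edge-root k<n f≡ g≡)

      border⇒edge : ∀ {β} → Border n ideal β → R n G (actW n w β)
      border⇒edge bβ = go (border⇒rim ideal ideal-positive bβ)
        where
        step : ∀ {a b} → ∃[ k ] (k < n × a ≡ f k × b ≡ g k ℕ.+ p) → R n G (actW n w (root (suc n) a (suc b)))
        step (k , k<n , a≡ , b≡) =
          subst (R n G ∘ actW n w) (sym (cong₂ (λ a b → root (suc n) a (suc b)) a≡ b≡)) (path-root k<n)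
        go : ∀ {β} → ∃[ a ] ∃[ b ] (β ≡ root (suc n) a (suc b) × Rim ideal a b) → R n G (actW n w β)
        go (a , b , β≡ , rim) = subst (R n G ∘ actW n w) (sym β≡) (step (rim⇒path rim))

    graphSimplex : SimplexT′ n (R n G)
    graphSimplex = i , w , sorted⇒minCosetRep sourcesFirst i q≡ , ideal , ideal-iab ,
      (λ { (s , t , e , eq) → subst (image n (actW n w) (Border n ideal)) (sym eq) (edge⇒border e) }) ,
      (λ { (β , bβ , eq) → subst (R n G) (sym eq) (border⇒edge bβ) })

  -- As `n ≥ 1` there is an edge; its source is ranked below `q` and its target is not, so both
  -- blocks are nonempty.
  sourceCount : 1 ≤ n → ∃[ i ] (Sorted.q sourcesFirst ≡ suc (toℕ {n} i))
  sourceCount 1≤n = bounds (someEdge G len)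
    where
    open Sorted sourcesFirst using (word; q; colour)
    someEdge : ∀ (H : Graph n) → length H ≡ n → ∃[ s ] ∃[ t ] ((s , t) ∈ H)
    someEdge []            e = ⊥-elim (ℕₚ.<⇒≢ 1≤n e)
    someEdge ((s , t) ∷ H) e = s , t , here refl
    colour′ : ∀ v → isSource v ≡ (pi word (toℕ v) <ᵇ q)
    colour′ v = trans (sym (cong isSource (trans (cong (fin n) (sg-pi word (toℕ v))) (fin-toℕ v))))
      (colour (pi-bounded word (ℕ.s≤s⁻¹ (Finₚ.toℕ<n v))))
    bounds : ∃[ s ] ∃[ t ] ((s , t) ∈ G) → ∃[ i ] (q ≡ suc (toℕ {n} i))
    bounds (s , t , e) = between q
      (ℕₚ.≤-<-trans z≤n (<ᵇ≡⇒< _ q (trans (sym (colour′ s)) (isSource-source e))))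
      (ℕₚ.≤-trans (<ᵇ≡⇒≤ _ q (trans (sym (colour′ t)) (isSource-target e)))
        (pi-bounded word (ℕ.s≤s⁻¹ (Finₚ.toℕ<n t))))
      where
      between : ∀ m → 0 < m → m ≤ n → ∃[ i ] (m ≡ suc (toℕ {n} i))
      between (suc p) _ p<n = Fin.fromℕ< p<n , cong suc (sym (Finₚ.toℕ-fromℕ< p<n))

SimplexT′-resp-≐ : ∀ {n S S′} → S ≐ S′ → SimplexT′ n S′ → SimplexT′ n S
SimplexT′-resp-≐ (S⊆ , ⊆S) (i , w , min , I , iab , to , from) =
  i , w , min , I , iab , to ∘ S⊆ , ⊆S ∘ from

graph⇒simplex : ∀ {n} → 1 ≤ n → ∀ {S} → FromGraph n S → SimplexT′ n S
graph⇒simplex 1≤n (G , anti , S≐R) = SimplexT′-resp-≐ S≐R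
  (graphSimplex G anti (proj₁ (sourceCount G anti 1≤n)) (proj₂ (sourceCount G anti 1≤n)))

theorem7p2 : (n : ℕ) → 1 ≤ n → (S : Pred (E n) 0ℓ) → (∀ v → S v → isRoot n v) →
    (SimplexT′ n S → FromGraph n S) × (FromGraph n S → SimplexT′ n S)
theorem7p2 n 1≤n S _ = simplex⇒graph 1≤n , graph⇒simplex 1≤n
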